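{- Let $n\ge 1$, let $a_1,\dots,a_n$ be pairwise relatively prime positive integers, and let $t$ be an integer with $0<t<a_1+\dots+a_n$. Then $$\sum_{j=1}^n\sigma_t(a_1,\dots,\hat a_j,\dots,a_n;a_j)=-R'_t(a_1,\dots,a_n),$$ where $\hat a_j$ means that the entry $a_j$ is omitted, and $$R'_t(a_1,\dots,a_n)=\operatorname{Res}\left(\frac{z^{t-1}}{(z^{a_1}-1)\cdots(z^{a_n}-1)},\,z=1\right).$$
   Context: Fourier-Dedekind sum: for integers $c_1,\dots,c_m$ each relatively prime to a positive integer $c$, and $t\in\mathbb Z$, $$\sigma_t(c_1,\dots,c_m;c)=\frac1c\sum_{\lambda^c=1,\ \lambda\ne1}\frac{\lambda^t}{(\lambda^{c_1}-1)\cdots(\lambda^{c_m}-1)},$$ the sum being over all complex $c$-th roots of unity $\lambda\neq 1$ (so it is $0$ if $c=1$); an empty product in the denominator is $1$. $\operatorname{Res}(G(z),z=1)$ denotes the residue of the meromorphic function $G$ at $z=1$. -}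

module Defs where

open import Level as Level using (0ℓ)
open import Algebra.Bundles using (CommutativeRing)
open import Data.Fin.Base using (Fin; zero; suc; toℕ)
import Data.Fin.Properties as Fin
open import Data.Integer.Base as ℤ using (ℤ; +_; -[1+_])
open import Data.Integer.Coprimality as ℤ using ()
import Data.Integer.Properties as ℤ
open import Data.Nat.Base as ℕ using (ℕ; zero; suc)
open import Data.Nat.Coprimality as Coprimality using (Coprime; coprime-Bézout; 1-coprimeTo)
open import Data.Nat.GCD using (module Bézout)
import Data.Nat.Properties as ℕ
open import Data.Product.Base using (∃; ∃-syntax; _×_; _,_; proj₁; proj₂)
open import Data.Rational.Base as ℚ using (ℚ)
open import Data.Sum.Base as Sum using (_⊎_; inj₁; inj₂)
open import Data.Vec.Functional using (Vector)
open import Relation.Binary.Definitions using (tri<; tri≈; tri>)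
open import Relation.Binary.PropositionalEquality as ≡ using (_≡_; _≢_)
open import Relation.Nullary using (¬_; yes; no; contradiction)
import Algebra.Definitions
import Algebra.Properties.CommutativeMonoid.Sum
import Algebra.Properties.CommutativeSemiring.Exp
import Algebra.Properties.Ring
import Algebra.Properties.Semiring.Sum
import Relation.Binary.Reasoning.Setoid

module InvertibleElements {c ℓ} (R : CommutativeRing c ℓ) where

  open CommutativeRing R hiding (zero)
  open Algebra.Properties.Ring ring
    using (-‿distribˡ-*; -‿distribʳ-*; x[y-z]≈xy-xz; [y-z]x≈yx-zx; -‿involutive; x∙y⁻¹≈ε⇒x≈y; x≈y⇒x∙y⁻¹≈ε; ⁻¹-anti-homo-//)
  open Algebra.Properties.CommutativeSemiring.Exp commutativeSemiring public using (_^_)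
  open Algebra.Properties.CommutativeSemiring.Exp commutativeSemiring
    using (^-congˡ; ^-congʳ; ^-homo-*; ^-assocʳ; ^-distrib-*)
  open Algebra.Properties.Semiring.Sum semiring
    using (sum; sum-cong-≋; *-distribˡ-sum; ∑-comm; sum-replicate; sum-replicate-zero)
  open Algebra.Properties.CommutativeMonoid.Sum *-commutativeMonoid public
    using () renaming (sum to product)
  open Relation.Binary.Reasoning.Setoid setoid

  Invertible : Carrier → Set _
  Invertible = Algebra.Definitions.RightInvertible _≈_ 1# _*_

  inverse : ∀ {x} → Invertible x → Carrier
  inverse = proj₁

  infixr 8 _^ℤ_

  _^ℤ_ : ∃ Invertible → ℤ → Carrier
  (x , _ , _)   ^ℤ (+ n)      = x ^ n
  (_ , x⁻¹ , _) ^ℤ (-[1+ n ]) = x⁻¹ ^ suc n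

  abstract
    swap-* : ∀ x y z w → (x * y) * (z * w) ≈ (x * z) * (y * w)
    swap-* x y z w = begin
      (x * y) * (z * w)   ≈⟨ *-assoc x y (z * w) ⟩
      x * (y * (z * w))   ≈⟨ *-congˡ (*-assoc y z w) ⟨
      x * ((y * z) * w)   ≈⟨ *-congˡ (*-congʳ (*-comm y z)) ⟩
      x * ((z * y) * w)   ≈⟨ *-congˡ (*-assoc z y w) ⟩
      x * (z * (y * w))   ≈⟨ *-assoc x z (y * w) ⟨
      (x * z) * (y * w)   ∎

    1^ : ∀ n → 1# ^ n ≈ 1#
    1^ zero    = refl
    1^ (suc n) = trans (*-identityˡ (1# ^ n)) (1^ n)

  invertible-resp : ∀ {x y} → x ≈ y → Invertible x → Invertible y
  invertible-resp x≈y (x⁻¹ , p) = x⁻¹ , trans (*-congʳ (sym x≈y)) p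

  invertible-1 : Invertible 1#
  invertible-1 = 1# , *-identityˡ 1#

  invertible-* : ∀ {x y} → Invertible x → Invertible y → Invertible (x * y)
  invertible-* {x} {y} (x⁻¹ , p) (y⁻¹ , q) =
    x⁻¹ * y⁻¹ , trans (swap-* x y x⁻¹ y⁻¹) (trans (*-cong p q) (*-identityˡ 1#))

  invertible-^ : ∀ {x} n → Invertible x → Invertible (x ^ n)
  invertible-^ zero    p = invertible-1
  invertible-^ (suc n) p = invertible-* p (invertible-^ n p)

  invertible-factor : ∀ {x y z} → x * y ≈ z → Invertible z → Invertible x
  invertible-factor {x} {y} {z} xy≈z (z⁻¹ , p) =
    y * z⁻¹ , trans (sym (*-assoc x y z⁻¹)) (trans (*-congʳ xy≈z) p)

  invertible-neg : ∀ {x} → Invertible x → Invertible (- x)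
  invertible-neg {x} (x⁻¹ , p) = - x⁻¹ , (begin
    - x * - x⁻¹     ≈⟨ -‿distribˡ-* x (- x⁻¹) ⟨
    - (x * - x⁻¹)   ≈⟨ -‿cong (-‿distribʳ-* x x⁻¹) ⟨
    - (- (x * x⁻¹)) ≈⟨ -‿involutive (x * x⁻¹) ⟩
    x * x⁻¹         ≈⟨ p ⟩
    1#              ∎)

  invertible-sub-swap : ∀ {x y} → Invertible (x - y) → Invertible (y - x)
  invertible-sub-swap {x} {y} p = invertible-resp (⁻¹-anti-homo-// x y) (invertible-neg p)

  invertible-cancel : ∀ {x y} → Invertible x → x * y ≈ 0# → y ≈ 0#
  invertible-cancel {x} {y} (x⁻¹ , p) xy≈0 = begin
    y              ≈⟨ *-identityˡ y ⟨
    1# * y         ≈⟨ *-congʳ (trans (*-comm x⁻¹ x) p) ⟨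
    (x⁻¹ * x) * y  ≈⟨ *-assoc x⁻¹ x y ⟩
    x⁻¹ * (x * y)  ≈⟨ *-congˡ xy≈0 ⟩
    x⁻¹ * 0#       ≈⟨ zeroʳ x⁻¹ ⟩
    0#             ∎

  invertible-product : ∀ {n} (x : Vector Carrier n) → (∀ i → Invertible (x i)) → Invertible (product x)
  invertible-product {zero}  x p = invertible-1
  invertible-product {suc n} x p = invertible-* (p zero) (invertible-product (λ i → x (suc i)) (λ i → p (suc i)))

  geometric : Carrier → ℕ → Carrier
  geometric x n = sum {n} (λ k → x ^ toℕ k)

  abstract
    geometric-suc : ∀ x n → geometric x (suc n) ≈ 1# + x * geometric x n
    geometric-suc x n = +-congˡ (sym (*-distribˡ-sum {n} x (λ k → x ^ toℕ k)))

    sub-1-* : ∀ x y → (x - 1#) * y ≈ x * y - y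
    sub-1-* x y = trans ([y-z]x≈yx-zx y x 1#) (+-congˡ (-‿cong (*-identityˡ y)))

    sub-chain : ∀ x y z → (x - y) + (z - x) ≈ z - y
    sub-chain x y z = begin
      (x - y) + (z - x)       ≈⟨ +-comm (x - y) (z - x) ⟩
      (z - x) + (x - y)       ≈⟨ +-assoc z (- x) (x - y) ⟩
      z + (- x + (x - y))     ≈⟨ +-congˡ (+-assoc (- x) x (- y)) ⟨
      z + ((- x + x) - y)     ≈⟨ +-congˡ (+-congʳ (-‿inverseˡ x)) ⟩
      z + (0# - y)            ≈⟨ +-congˡ (+-identityˡ (- y)) ⟩
      z - y                   ∎

    complement : ∀ {x y z} → (x + y) * z ≈ 1# → y * z ≈ 1# - x * z
    complement {x} {y} {z} p = begin
      y * z                        ≈⟨ +-identityʳ (y * z) ⟨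
      y * z + 0#                   ≈⟨ +-congˡ (-‿inverseʳ (x * z)) ⟨
      y * z + (x * z - x * z)      ≈⟨ +-assoc (y * z) (x * z) (- (x * z)) ⟨
      (y * z + x * z) - x * z      ≈⟨ +-congʳ (+-comm (y * z) (x * z)) ⟩
      (x * z + y * z) - x * z      ≈⟨ +-congʳ (trans (sym (distribʳ z x y)) p) ⟩
      1# - x * z                   ∎

    geometric-* : ∀ x n → (x - 1#) * geometric x n ≈ x ^ n - 1#
    geometric-* x zero    = trans (zeroʳ (x - 1#)) (sym (-‿inverseʳ 1#))
    geometric-* x (suc n) = begin
      (x - 1#) * geometric x (suc n)                    ≈⟨ *-congˡ (geometric-suc x n) ⟩
      (x - 1#) * (1# + x * geometric x n)               ≈⟨ distribˡ (x - 1#) 1# (x * geometric x n) ⟩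
      (x - 1#) * 1# + (x - 1#) * (x * geometric x n)    ≈⟨ +-cong (*-identityʳ (x - 1#)) (x∙yz≈y∙xz (x - 1#) x (geometric x n)) ⟩
      (x - 1#) + x * ((x - 1#) * geometric x n)         ≈⟨ +-congˡ (*-congˡ (geometric-* x n)) ⟩
      (x - 1#) + x * (x ^ n - 1#)                       ≈⟨ +-congˡ (trans (x[y-z]≈xy-xz x (x ^ n) 1#) (+-congˡ (-‿cong (*-identityʳ x)))) ⟩
      (x - 1#) + (x ^ suc n - x)                        ≈⟨ sub-chain x 1# (x ^ suc n) ⟩
      x ^ suc n - 1#                                    ∎
      where
      x∙yz≈y∙xz : ∀ x y z → x * (y * z) ≈ y * (x * z)
      x∙yz≈y∙xz x y z = trans (sym (*-assoc x y z)) (trans (*-congʳ (*-comm x y)) (*-assoc y x z))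

    root-power : ∀ x c k → x ^ c ≈ 1# → (x ^ k) ^ c ≈ 1#
    root-power x c k p = begin
      (x ^ k) ^ c      ≈⟨ ^-assocʳ x k c ⟩
      x ^ (k ℕ.* c)    ≈⟨ ^-congʳ x (ℕ.*-comm k c) ⟩
      x ^ (c ℕ.* k)    ≈⟨ ^-assocʳ x c k ⟨
      (x ^ c) ^ k      ≈⟨ ^-congˡ k p ⟩
      1# ^ k           ≈⟨ 1^ k ⟩
      1#               ∎

    root-period : ∀ x c k → x ^ c ≈ 1# → x ^ (k ℕ.* c) ≈ 1#
    root-period x c k p = trans (sym (^-assocʳ x k c)) (root-power x c k p)

    root-coprime : ∀ x c d → x ^ c ≈ 1# → Invertible (x - 1#) → Coprime d c → Invertible (x ^ d - 1#)
    root-coprime x c d x^c≈1 inv d⊥c with coprime-Bézout d⊥c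
    ... | Bézout.+- u v eq = invertible-factor (geometric-* (x ^ d) u) (invertible-resp (+-congʳ (begin
      x                      ≈⟨ *-identityʳ x ⟨
      x * 1#                 ≈⟨ *-congˡ (root-period x c v x^c≈1) ⟨
      x ^ suc (v ℕ.* c)      ≈⟨ ^-congʳ x (≡.trans eq (ℕ.*-comm u d)) ⟩
      x ^ (d ℕ.* u)          ≈⟨ ^-assocʳ x d u ⟨
      (x ^ d) ^ u            ∎)) inv)
    ... | Bézout.-+ u v eq = invertible-factor (geometric-* (x ^ d) u) (invertible-factor (begin
      ((x ^ d) ^ u - 1#) * x   ≈⟨ sub-1-* ((x ^ d) ^ u) x ⟩
      (x ^ d) ^ u * x - x      ≈⟨ +-congʳ (*-comm ((x ^ d) ^ u) x) ⟩
      x * (x ^ d) ^ u - x      ≈⟨ +-congʳ (*-congˡ (^-assocʳ x d u)) ⟩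
      x ^ suc (d ℕ.* u) - x    ≈⟨ +-congʳ (^-congʳ x (≡.trans (≡.cong suc (ℕ.*-comm d u)) eq)) ⟩
      x ^ (v ℕ.* c) - x        ≈⟨ +-congʳ (root-period x c v x^c≈1) ⟩
      1# - x                   ∎) (invertible-sub-swap inv))

    inverse-root : ∀ {x y} c → x * y ≈ 1# → x ^ c ≈ 1# → y ^ c ≈ 1#
    inverse-root {x} {y} c xy≈1 x^c≈1 = begin
      y ^ c           ≈⟨ *-identityˡ (y ^ c) ⟨
      1# * y ^ c      ≈⟨ *-congʳ x^c≈1 ⟨
      x ^ c * y ^ c   ≈⟨ ^-distrib-* x y c ⟨
      (x * y) ^ c     ≈⟨ ^-congˡ c xy≈1 ⟩
      1# ^ c          ≈⟨ 1^ c ⟩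
      1#              ∎

    inverse-sub-1 : ∀ {x y} → x * y ≈ 1# → Invertible (x - 1#) → Invertible (y - 1#)
    inverse-sub-1 {x} {y} xy≈1 inv = invertible-factor (begin
      (y - 1#) * x    ≈⟨ sub-1-* y x ⟩
      y * x - x       ≈⟨ +-congʳ (trans (*-comm y x) xy≈1) ⟩
      1# - x          ∎) (invertible-sub-swap inv)

    root-coprimeℤ : ∀ (x : ∃ Invertible) c d → proj₁ x ^ c ≈ 1# → Invertible (proj₁ x - 1#) →
                    Coprime ℤ.∣ d ∣ c → Invertible (x ^ℤ d - 1#)
    root-coprimeℤ (x , y , xy≈1) c (+ d)      p inv d⊥c = root-coprime x c d p inv d⊥c
    root-coprimeℤ (x , y , xy≈1) c (-[1+ d ]) p inv d⊥c =
      root-coprime y c (suc d) (inverse-root c xy≈1 p) (inverse-sub-1 xy≈1 inv) d⊥c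

  root-invertible : ∀ x c .{{_ : ℕ.NonZero c}} → x ^ c ≈ 1# → Invertible x
  root-invertible x (suc c) p = x ^ c , p

  -- In a local ring, the powers of a primitive n-th root of unity are all the n-th roots of unity.
  module PrimitiveRoot
    (local : ∀ {x y} → Invertible (x + y) → Invertible x ⊎ Invertible y)
    (n : ℕ) (ζ : Carrier) (n#0 : Invertible (sum {suc n} (λ _ → 1#)))
    (ζ^n≈1 : ζ ^ suc n ≈ 1#)
    (ζ-primitive : ∀ k → 0 ℕ.< k → k ℕ.< suc n → Invertible (ζ ^ k - 1#)) where

    sum-local : ∀ {m} (x : Vector Carrier (suc m)) → Invertible (sum x) → ∃[ k ] Invertible (x k)
    sum-local {zero}  x p = zero , invertible-resp (+-identityʳ (x zero)) p
    sum-local {suc m} x p with local p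
    ... | inj₁ q = zero , q
    ... | inj₂ q = let k , r = sum-local (λ i → x (suc i)) q in suc k , r

    η : Carrier
    η = ζ ^ n

    abstract
      power-# : ∀ {i j} → i ℕ.< j → j ℕ.< suc n → Invertible (ζ ^ j - ζ ^ i)
      power-# {i} {j} i<j j<n = invertible-resp (begin
        (ζ ^ (j ℕ.∸ i) - 1#) * ζ ^ i        ≈⟨ sub-1-* (ζ ^ (j ℕ.∸ i)) (ζ ^ i) ⟩
        ζ ^ (j ℕ.∸ i) * ζ ^ i - ζ ^ i       ≈⟨ +-congʳ (^-homo-* ζ (j ℕ.∸ i) i) ⟨
        ζ ^ (j ℕ.∸ i ℕ.+ i) - ζ ^ i         ≈⟨ +-congʳ (^-congʳ ζ (ℕ.m∸n+n≡m (ℕ.<⇒≤ i<j))) ⟩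
        ζ ^ j - ζ ^ i                       ∎)
        (invertible-* (ζ-primitive (j ℕ.∸ i) (ℕ.m<n⇒0<n∸m i<j) (ℕ.≤-<-trans (ℕ.m∸n≤m j i) j<n))
                      (root-invertible (ζ ^ i) (suc n) (root-power ζ (suc n) i ζ^n≈1)))

      powers-# : ∀ {i j} → i ℕ.< suc n → j ℕ.< suc n → i ≢ j → Invertible (ζ ^ i - ζ ^ j)
      powers-# {i} {j} i<n j<n i≢j with ℕ.<-cmp i j
      ... | tri< i<j _ _ = invertible-sub-swap (power-# i<j j<n)

      ... | tri≈ _ i≡j _ = contradiction i≡j i≢j
      ... | tri> _ _ j<i = power-# j<i i<n

      -- ∑ₖ (η ^ j) ^ k vanishes unless j = 0
      η-sum : ∀ j → j ℕ.< suc n → 0 ℕ.< j → geometric (η ^ j) (suc n) ≈ 0#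
      η-sum j j<n 0<j = invertible-cancel
        (inverse-sub-1 {ζ ^ j} {η ^ j} (trans (sym (^-distrib-* ζ η j)) (trans (^-congˡ j ζ^n≈1) (1^ j))) (ζ-primitive j 0<j j<n))
        (trans (geometric-* (η ^ j) (suc n))
          (x≈y⇒x∙y⁻¹≈ε (root-power η (suc n) j (root-power ζ (suc n) n ζ^n≈1))))

      complete : ∀ x → x ^ suc n ≈ 1# → ∃[ k ] x ≈ ζ ^ toℕ {suc n} k
      complete x x^n≈1 = k , (begin
        x                          ≈⟨ *-identityʳ x ⟨
        x * 1#                     ≈⟨ *-congˡ (η^ζ^ (toℕ k)) ⟨
        x * (η ^ toℕ k * ζ ^ toℕ k) ≈⟨ *-assoc x (η ^ toℕ k) (ζ ^ toℕ k) ⟨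
        μ k * ζ ^ toℕ k            ≈⟨ *-congʳ μ≈1 ⟩
        1# * ζ ^ toℕ k             ≈⟨ *-identityˡ (ζ ^ toℕ k) ⟩
        ζ ^ toℕ k                  ∎)
        where
        μ : Fin (suc n) → Carrier
        μ k = x * η ^ toℕ k

        η^ζ^ : ∀ k → η ^ k * ζ ^ k ≈ 1#
        η^ζ^ k = trans (sym (^-distrib-* η ζ k)) (trans (^-congˡ k (trans (*-comm η ζ) ζ^n≈1)) (1^ k))

        μ^n≈1 : ∀ k → μ k ^ suc n ≈ 1#
        μ^n≈1 k = trans (^-distrib-* x (η ^ toℕ k) (suc n)) (trans (*-cong x^n≈1
          (root-power η (suc n) (toℕ k) (root-power ζ (suc n) n ζ^n≈1))) (*-identityˡ 1#))

        swap-power : ∀ k j → μ k ^ toℕ {suc n} j ≈ x ^ toℕ j * (η ^ toℕ j) ^ toℕ k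
        swap-power k j = trans (^-distrib-* x (η ^ toℕ k) (toℕ j)) (*-congˡ (begin
          (η ^ toℕ k) ^ toℕ j    ≈⟨ ^-assocʳ η (toℕ k) (toℕ j) ⟩
          η ^ (toℕ k ℕ.* toℕ j)  ≈⟨ ^-congʳ η (ℕ.*-comm (toℕ k) (toℕ j)) ⟩
          η ^ (toℕ j ℕ.* toℕ k)  ≈⟨ ^-assocʳ η (toℕ j) (toℕ k) ⟨
          (η ^ toℕ j) ^ toℕ k    ∎))

        column : ∀ j → sum {suc n} (λ k → μ k ^ toℕ {suc n} j) ≈ x ^ toℕ j * geometric (η ^ toℕ j) (suc n)
        column j = trans (sum-cong-≋ (λ k → swap-power k j)) (sym (*-distribˡ-sum {suc n} (x ^ toℕ j) (λ k → (η ^ toℕ j) ^ toℕ k)))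

        total : sum {suc n} (λ k → geometric (μ k) (suc n)) ≈ sum {suc n} (λ _ → 1#)
        total = begin
          sum {suc n} (λ k → sum {suc n} (λ j → μ k ^ toℕ j))  ≈⟨ ∑-comm {suc n} {suc n} (λ k j → μ k ^ toℕ j) ⟩
          sum {suc n} (λ j → sum {suc n} (λ k → μ k ^ toℕ j))  ≈⟨ +-congˡ (trans
            (sum-cong-≋ {n} (λ j → trans (column (suc j)) (trans (*-congˡ (η-sum (suc (toℕ j)) (ℕ.s≤s (Fin.toℕ<n j)) ℕ.z<s)) (zeroʳ _))))
            (sum-replicate-zero n)) ⟩
          sum {suc n} (λ _ → 1#) + 0#                          ≈⟨ +-identityʳ _ ⟩
          sum {suc n} (λ _ → 1#)                               ∎

        unit : ∃[ k ] Invertible (geometric (μ k) (suc n))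
        unit = sum-local (λ k → geometric (μ k) (suc n)) (invertible-resp (sym total) n#0)

        k : Fin (suc n)
        k = proj₁ unit

        μ≈1 : μ k ≈ 1#
        μ≈1 = x∙y⁻¹≈ε⇒x≈y (μ k) 1# (invertible-cancel (proj₂ unit)
          (trans (*-comm (geometric (μ k) (suc n)) (μ k - 1#))
            (trans (geometric-* (μ k) (suc n)) (x≈y⇒x∙y⁻¹≈ε (μ^n≈1 k)))))

module PowerSeries {c ℓ} (R : CommutativeRing c ℓ) where

  open CommutativeRing R hiding (zero)
  open Algebra.Properties.Semiring.Sum semiring
    using (sum; sum-cong-≋; *-distribˡ-sum; ∑-distrib-+; sum-replicate-zero)
  open Relation.Binary.Reasoning.Setoid setoid

  Series : Set c
  Series = ℕ → Carrier

  infix  4 _≋_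
  infixl 6 _⊞_
  infixl 7 _⊠_

  _≋_ : Series → Series → Set ℓ
  f ≋ g = ∀ n → f n ≈ g n

  _⊞_ _⊠_ : Series → Series → Series
  (f ⊞ g) n = f n + g n
  (f ⊠ g) n = sum {suc n} (λ i → f (toℕ i) * g (n ℕ.∸ toℕ i))

  constant : Carrier → Series
  constant a zero    = a
  constant a (suc n) = 0#

  X : Series
  X zero          = 0#
  X (suc zero)    = 1#
  X (suc (suc n)) = 0#

  private
    tail : Series → Series
    tail f n = f (suc n)

  abstract
    ⊠-cong-≤ : ∀ n {f f′ g g′} → f ≋ f′ → (∀ i → i ℕ.≤ n → g i ≈ g′ i) → (f ⊠ g) n ≈ (f′ ⊠ g′) n
    ⊠-cong-≤ n p q = sum-cong-≋ {suc n} (λ i → *-cong (p (toℕ i)) (q (n ℕ.∸ toℕ i) (ℕ.m∸n≤m n (toℕ i))))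

    ⊠-cong : ∀ {f f′ g g′} → f ≋ f′ → g ≋ g′ → f ⊠ g ≋ f′ ⊠ g′
    ⊠-cong p q n = ⊠-cong-≤ n p (λ i _ → q i)

    ⊠-distribʳ : ∀ f g h → (g ⊞ h) ⊠ f ≋ (g ⊠ f) ⊞ (h ⊠ f)
    ⊠-distribʳ f g h n = trans
      (sum-cong-≋ {suc n} (λ i → distribʳ (f (n ℕ.∸ toℕ i)) (g (toℕ i)) (h (toℕ i))))
      (∑-distrib-+ {suc n} (λ i → g (toℕ i) * f (n ℕ.∸ toℕ i)) (λ i → h (toℕ i) * f (n ℕ.∸ toℕ i)))

    ⊠-scale : ∀ a f g → (λ n → a * f n) ⊠ g ≋ (λ n → a * (f ⊠ g) n)
    ⊠-scale a f g n = trans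
      (sum-cong-≋ {suc n} (λ i → *-assoc a (f (toℕ i)) (g (n ℕ.∸ toℕ i))))
      (sym (*-distribˡ-sum {suc n} a (λ i → f (toℕ i) * g (n ℕ.∸ toℕ i))))

    ⊠-last : ∀ f g n → (f ⊠ g) (suc n) ≈ (f ⊠ tail g) n + f (suc n) * g 0
    ⊠-last f g zero    = trans (+-congˡ (+-identityʳ _)) (+-congʳ (sym (+-identityʳ _)))
    ⊠-last f g (suc n) = trans (+-congˡ (⊠-last (tail f) g n)) (sym (+-assoc _ _ _))

    ⊠-comm : ∀ f g → f ⊠ g ≋ g ⊠ f
    ⊠-comm f g zero    = +-congʳ (*-comm (f 0) (g 0))
    ⊠-comm f g (suc n) = begin
      f 0 * g (suc n) + (tail f ⊠ g) n     ≈⟨ +-cong (*-comm (f 0) (g (suc n))) (⊠-comm (tail f) g n) ⟩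
      g (suc n) * f 0 + (g ⊠ tail f) n     ≈⟨ +-comm _ _ ⟩
      (g ⊠ tail f) n + g (suc n) * f 0     ≈⟨ ⊠-last g f n ⟨
      (g ⊠ f) (suc n)                      ∎

    ⊠-assoc : ∀ f g h → (f ⊠ g) ⊠ h ≋ f ⊠ (g ⊠ h)
    ⊠-assoc f g h zero = +-congʳ (begin
      (f 0 * g 0 + 0#) * h 0    ≈⟨ *-congʳ (+-identityʳ _) ⟩
      f 0 * g 0 * h 0           ≈⟨ *-assoc _ _ _ ⟩
      f 0 * (g 0 * h 0)         ≈⟨ *-congˡ (+-identityʳ _) ⟨
      f 0 * (g 0 * h 0 + 0#)    ∎)
    ⊠-assoc f g h (suc n) = begin
      (f 0 * g 0 + 0#) * h (suc n) + (tail (f ⊠ g) ⊠ h) n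
        ≈⟨ +-cong (trans (*-congʳ (+-identityʳ _)) (*-assoc _ _ _)) (⊠-distribʳ h (λ n → f 0 * tail g n) (tail f ⊠ g) n) ⟩
      f 0 * (g 0 * h (suc n)) + (((λ n → f 0 * tail g n) ⊠ h) n + ((tail f ⊠ g) ⊠ h) n)
        ≈⟨ +-congˡ (+-cong (⊠-scale (f 0) (tail g) h n) (⊠-assoc (tail f) g h n)) ⟩
      f 0 * (g 0 * h (suc n)) + (f 0 * (tail g ⊠ h) n + (tail f ⊠ (g ⊠ h)) n)
        ≈⟨ +-assoc _ _ _ ⟨
      f 0 * (g 0 * h (suc n)) + f 0 * (tail g ⊠ h) n + (tail f ⊠ (g ⊠ h)) n
        ≈⟨ +-congʳ (distribˡ _ _ _) ⟨
      f 0 * (g 0 * h (suc n) + (tail g ⊠ h) n) + (tail f ⊠ (g ⊠ h)) n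
        ∎

    ⊠-identityˡ : ∀ f → constant 1# ⊠ f ≋ f
    ⊠-identityˡ f n = begin
      1# * f n + sum {n} (λ i → 0# * f (n ℕ.∸ suc (toℕ i)))
        ≈⟨ +-cong (*-identityˡ (f n)) (trans (sum-cong-≋ {n} (λ i → zeroˡ _)) (sum-replicate-zero n)) ⟩
      f n + 0#
        ≈⟨ +-identityʳ (f n) ⟩
      f n
        ∎

  commutativeRing : CommutativeRing c ℓ
  commutativeRing = record
    { Carrier = Series ; _≈_ = _≋_ ; _+_ = _⊞_ ; _*_ = _⊠_ ; -_ = λ f n → - f n
    ; 0# = λ _ → 0# ; 1# = constant 1#
    ; isCommutativeRing = record
      { isRing = record
        { +-isAbelianGroup = record
          { isGroup = record
            { isMonoid = record
              { isSemigroup = record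
                { isMagma = record
                  { isEquivalence = record
                    { refl = λ _ → refl ; sym = λ p n → sym (p n) ; trans = λ p q n → trans (p n) (q n) }
                  ; ∙-cong = λ p q n → +-cong (p n) (q n)
                  }
                ; assoc = λ f g h n → +-assoc (f n) (g n) (h n)
                }
              ; identity = (λ f n → +-identityˡ (f n)) , (λ f n → +-identityʳ (f n))
              }
            ; inverse = (λ f n → -‿inverseˡ (f n)) , (λ f n → -‿inverseʳ (f n))
            ; ⁻¹-cong = λ p n → -‿cong (p n)
            }
          ; comm = λ f g n → +-comm (f n) (g n)
          }
        ; *-cong = ⊠-cong
        ; *-assoc = ⊠-assoc
        ; *-identity = ⊠-identityˡ , λ f n → trans (⊠-comm f (constant 1#) n) (⊠-identityˡ f n)
        ; distrib = (λ f g h n → trans (⊠-comm f (g ⊞ h) n) (trans (⊠-distribʳ f g h n)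
                                   (+-cong (⊠-comm g f n) (⊠-comm h f n))))
                  , ⊠-distribʳ
        }
      ; *-comm = ⊠-comm
      }
    }

  private
    module R = InvertibleElements R
    module S = InvertibleElements commutativeRing
    module R[[X]] = CommutativeRing commutativeRing
    open Algebra.Properties.Semiring.Sum R[[X]].semiring using () renaming (sum to sumˢ)
    open Algebra.Properties.CommutativeSemiring.Exp R[[X]].commutativeSemiring using () renaming (_^_ to _^ˢ_)
    open Algebra.Properties.CommutativeMonoid.Sum R[[X]].*-commutativeMonoid using () renaming (sum to productˢ)

  -- If f 0 is invertible, 1 / f is the limit of the X-adically convergent
  -- iteration g ↦ (1 - X g (f - f 0) / X) / f 0.
  module _ (f : Series) (f₀ : R.Invertible (f 0)) where

    private
      iterate : ℕ → Series
      iterate zero    n       = 0#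
      iterate (suc k) zero    = R.inverse f₀
      iterate (suc k) (suc n) = R.inverse f₀ * - (tail f ⊠ iterate k) n

      f⁻¹ : Series
      f⁻¹ n = iterate (suc n) n

      abstract
        iterate-stable : ∀ k l n → n ℕ.< k → n ℕ.< l → iterate k n ≈ iterate l n
        iterate-stable (suc k) (suc l) zero    _ _ = refl
        iterate-stable (suc k) (suc l) (suc n) (ℕ.s≤s n<k) (ℕ.s≤s n<l) =
          *-congˡ (-‿cong (⊠-cong-≤ n {tail f} {tail f} (λ _ → refl) (λ i i≤n →
            iterate-stable k l i (ℕ.≤-<-trans i≤n n<k) (ℕ.≤-<-trans i≤n n<l))))

        f⊠f⁻¹ : f ⊠ f⁻¹ ≋ constant 1#
        f⊠f⁻¹ zero    = trans (+-identityʳ _) (proj₂ f₀)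
        f⊠f⁻¹ (suc n) = begin
          f 0 * (R.inverse f₀ * - (tail f ⊠ iterate (suc n)) n) + (tail f ⊠ f⁻¹) n
            ≈⟨ +-congʳ (trans (sym (*-assoc _ _ _)) (trans (*-congʳ (proj₂ f₀)) (*-identityˡ _))) ⟩
          - (tail f ⊠ iterate (suc n)) n + (tail f ⊠ f⁻¹) n
            ≈⟨ +-congʳ (-‿cong (⊠-cong-≤ n {tail f} {tail f} (λ _ → refl) (λ i i≤n →
                 iterate-stable (suc n) (suc i) i (ℕ.s≤s i≤n) ℕ.≤-refl))) ⟩
          - (tail f ⊠ f⁻¹) n + (tail f ⊠ f⁻¹) n
            ≈⟨ -‿inverseˡ _ ⟩
          0# ∎

    invertible : S.Invertible f
    invertible = f⁻¹ , f⊠f⁻¹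

  1+X : Series
  1+X = constant 1# ⊞ X

  invertible-1+X : S.Invertible 1+X
  invertible-1+X = invertible 1+X (R.invertible-resp (sym (+-identityʳ 1#)) R.invertible-1)

  -- f / g = X⁻ᵒʳᵈᵉʳ coeff in formal Laurent series.
  record LaurentExpansion (f g : Series) : Set (c Level.⊔ ℓ) where
    field
      order    : ℕ
      coeff    : Series
      equation : g ⊠ coeff ≋ (X ^ˢ order) ⊠ f

  -- The coefficient of X⁻¹.
  residue : ∀ {f g} → LaurentExpansion f g → Carrier
  residue L with LaurentExpansion.order L
  ... | zero  = 0#
  ... | suc n = LaurentExpansion.coeff L n

  abstract
    1+X-1 : 1+X ⊞ (λ n → - constant 1# n) ≋ X
    1+X-1 n = trans (+-congʳ (+-comm _ _)) (trans (+-assoc _ _ _) (trans (+-congˡ (-‿inverseʳ _)) (+-identityʳ _)))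

    constant-^ : ∀ k → (1+X ^ˢ k) 0 ≈ 1#
    constant-^ zero    = refl
    constant-^ (suc k) = trans (+-identityʳ _) (trans (*-cong (+-identityʳ 1#) (constant-^ k)) (*-identityˡ 1#))

    constant-sum : ∀ {n} (f : Fin n → Series) → sumˢ f 0 ≈ sum (λ i → f i 0)
    constant-sum {zero}  f = refl
    constant-sum {suc n} f = +-congˡ (constant-sum (λ i → f (suc i)))

    constant-product : ∀ {n} (f : Fin n → Series) → (∀ i → R.Invertible (f i 0)) → R.Invertible (productˢ f 0)
    constant-product {zero}  f p = R.invertible-1
    constant-product {suc n} f p = R.invertible-resp (sym (+-identityʳ _))
      (R.invertible-* (p zero) (constant-product (λ i → f (suc i)) (λ i → p (suc i))))

    product-X : ∀ {n} (f g : Fin n → Series) → (∀ i → f i ≋ X ⊠ g i) → productˢ f ≋ (X ^ˢ n) ⊠ productˢ g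
    product-X {zero}  f g p = R[[X]].sym (R[[X]].*-identityˡ (constant 1#))
    product-X {suc n} f g p = R[[X]].trans
      (R[[X]].*-cong (p zero) (product-X (λ i → f (suc i)) (λ i → g (suc i)) (λ i → p (suc i))))
      (S.swap-* X (g zero) (X ^ˢ n) (productˢ (λ i → g (suc i))))

  -- (1 + X)ᵃ - 1 is X times the invertible series ∑ₖ (1 + X)ᵏ, k < a.
  laurentExpansion : ∀ {n} (a : Fin n → ℕ) → (∀ i → R.Invertible (sum {a i} (λ _ → 1#))) →
                     (f : Series) → LaurentExpansion f (productˢ (λ i → (1+X ^ˢ a i) R[[X]].- constant 1#))
  laurentExpansion {n} a a#0 f = record
    { order    = n
    ; coeff    = f ⊠ h⁻¹
    ; equation = eq
    }
    where
    h : Fin n → Series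
    h i = S.geometric 1+X (a i)

    h#0 : S.Invertible (productˢ h)
    h#0 = invertible (productˢ h) (constant-product h (λ i → R.invertible-resp
      (sym (trans (constant-sum {a i} (λ k → 1+X ^ˢ toℕ k)) (sum-cong-≋ {a i} (λ k → constant-^ (toℕ k))))) (a#0 i)))

    h⁻¹ : Series
    h⁻¹ = S.inverse {productˢ h} h#0

    abstract
      eq : productˢ (λ i → (1+X ^ˢ a i) R[[X]].- constant 1#) ⊠ (f ⊠ h⁻¹) ≋ (X ^ˢ n) ⊠ f
      eq = R[[X]].trans {_} {(X ^ˢ n) ⊠ productˢ h ⊠ (f ⊠ h⁻¹)} {(X ^ˢ n) ⊠ f}
        (R[[X]].*-congʳ {f ⊠ h⁻¹} {_} {(X ^ˢ n) ⊠ productˢ h} (product-X _ h (λ i →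
          R[[X]].trans {_} {(1+X ⊞ (λ n → - constant 1# n)) ⊠ h i} {X ⊠ h i}
            (R[[X]].sym {(1+X ⊞ (λ n → - constant 1# n)) ⊠ h i} (S.geometric-* 1+X (a i)))
            (R[[X]].*-congʳ {h i} {1+X ⊞ (λ n → - constant 1# n)} {X} 1+X-1))))
        (R[[X]].trans {_} {(X ^ˢ n) ⊠ f ⊠ (productˢ h ⊠ h⁻¹)} {_} (S.swap-* (X ^ˢ n) (productˢ h) f h⁻¹)
        (R[[X]].trans {_} {(X ^ˢ n) ⊠ f ⊠ constant 1#} {_}
          (R[[X]].*-congˡ {(X ^ˢ n) ⊠ f} {productˢ h ⊠ h⁻¹} {constant 1#} (proj₂ h#0)) (R[[X]].*-identityʳ _)))

module ComplexNumbers where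

  open ≡ using (refl; cong; cong₂; subst)
  open import Data.Rational.Base hiding (_≃_; NonZero)
  open import Data.Rational.Properties hiding (_≟_)
  open import Data.Rational.Solver using (module +-*-Solver)
  open import Relation.Nullary.Decidable using (toWitness; toWitnessFalse)

  module CauchySequences where

    module _ where
      open +-*-Solver

      halves : ∀ ε → ε ≡ ε * ½ + ε * ½
      halves = solve 1 (λ ε → ε := ε :* con ½ :+ ε :* con ½) refl

      sub-trans : ∀ p q r → p - r ≡ (p - q) + (q - r)
      sub-trans = solve 3 (λ p q r → p :- r := (p :- q) :+ (q :- r)) refl

      sub-+ : ∀ p q r s → (p + r) - (q + s) ≡ (p - q) + (r - s)
      sub-+ = solve 4 (λ p q r s → (p :+ r) :- (q :+ s) := (p :- q) :+ (r :- s)) refl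

      sub-* : ∀ p q r s → p * r - q * s ≡ p * (r - s) + s * (p - q)
      sub-* = solve 4 (λ p q r s → p :* r :- q :* s := p :* (r :- s) :+ s :* (p :- q)) refl

      neg-sub : ∀ p q → - (p - q) ≡ q - p
      neg-sub = solve 2 (λ p q → :- (p :- q) := q :- p) refl

      sub-neg : ∀ p q → (- p) - (- q) ≡ q - p
      sub-neg = solve 2 (λ p q → (:- p) :- (:- q) := q :- p) refl

      sub-add : ∀ p q → p ≡ (p - q) + q
      sub-add = solve 2 (λ p q → p := (p :- q) :+ q) refl

    0<½ : 0ℚ < ½
    0<½ = positive⁻¹ ½

    0<1 : 0ℚ < 1ℚ
    0<1 = positive⁻¹ 1ℚ

    *-pos : ∀ {p q} → 0ℚ < p → 0ℚ < q → 0ℚ < p * q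
    *-pos {p} {q} 0<p 0<q = positive⁻¹ (p * q) {{pos*pos⇒pos p {{positive 0<p}} q {{positive 0<q}}}}

    *-nonNeg : ∀ {p q} → 0ℚ ≤ p → 0ℚ ≤ q → 0ℚ ≤ p * q
    *-nonNeg {p} {q} 0≤p 0≤q =
      nonNegative⁻¹ (p * q) {{nonNeg*nonNeg⇒nonNeg p {{nonNegative 0≤p}} q {{nonNegative 0≤q}}}}

    *-mono : ∀ {p q r s} → 0ℚ ≤ p → 0ℚ ≤ s → p ≤ q → r ≤ s → p * r ≤ q * s
    *-mono {p} {q} {r} {s} 0≤p 0≤s p≤q r≤s =
      ≤-trans (*-monoˡ-≤-nonNeg p {{nonNegative 0≤p}} r≤s)
              (*-monoʳ-≤-nonNeg s {{nonNegative 0≤s}} p≤q)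

    ∣-∣-sym : ∀ p q → ∣ p - q ∣ ≡ ∣ q - p ∣
    ∣-∣-sym p q = ≡.trans (≡.sym (∣-p∣≡∣p∣ (p - q))) (cong ∣_∣ (neg-sub p q))

    ∣-∣-trans : ∀ p q r → ∣ p - r ∣ ≤ ∣ p - q ∣ + ∣ q - r ∣
    ∣-∣-trans p q r = subst (_≤ ∣ p - q ∣ + ∣ q - r ∣) (cong ∣_∣ (≡.sym (sub-trans p q r))) (∣p+q∣≤∣p∣+∣q∣ (p - q) (q - r))

    p≤∣p∣ : ∀ p → p ≤ ∣ p ∣
    p≤∣p∣ p with ≤-total 0ℚ p
    ... | inj₁ 0≤p = ≤-reflexive (≡.sym (0≤p⇒∣p∣≡p 0≤p))
    ... | inj₂ p≤0 = ≤-trans p≤0 (0≤∣p∣ p)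

    abstract
      inv : ∀ p → 0ℚ < p → ℚ
      inv p 0<p = (1/ p) {{>-nonZero 0<p}}

      *-inv : ∀ p 0<p → p * inv p 0<p ≡ 1ℚ
      *-inv p 0<p = *-inverseʳ p {{>-nonZero 0<p}}

      inv-pos : ∀ p 0<p → 0ℚ < inv p 0<p
      inv-pos p 0<p = positive⁻¹ _ {{1/pos⇒pos p {{positive 0<p}}}}

    infix 4 _~_

    -- _~_ is a partial equivalence relation; x ~ x says that x is Cauchy.
    record _~_ (x y : ℕ → ℚ) : Set where
      constructor mk~
      field
        close : ∀ ε → 0ℚ < ε → ∃[ N ] ∀ m n → N ℕ.≤ m → N ℕ.≤ n → ∣ x m - y n ∣ < ε

    open _~_ public

    abstract
      ~-sym : ∀ {x y} → x ~ y → y ~ x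
      ~-sym {x} {y} h .close ε 0<ε with close h ε 0<ε
      ... | N , p = N , λ m n N≤m N≤n → subst (_< ε) (∣-∣-sym (x n) (y m)) (p n m N≤n N≤m)

      ~-trans : ∀ {x y z} → x ~ y → y ~ z → x ~ z
      ~-trans {x} {y} {z} h k .close ε 0<ε with close h (ε * ½) (*-pos 0<ε 0<½) | close k (ε * ½) (*-pos 0<ε 0<½)
      ... | N , p | M , q = N ℕ.⊔ M , λ m n m≥ n≥ →
        let l = N ℕ.⊔ M in
        subst (∣ x m - z n ∣ <_) (≡.sym (halves ε))
          (≤-<-trans (∣-∣-trans (x m) (y l) (z n))
            (+-mono-< (p m l (ℕ.≤-trans (ℕ.m≤m⊔n N M) m≥) (ℕ.m≤m⊔n N M))
                      (q l n (ℕ.m≤n⊔m N M) (ℕ.≤-trans (ℕ.m≤n⊔m N M) n≥))))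

      ~-resp : ∀ {x y z} → x ~ y → (∀ n → y n ≡ z n) → x ~ z
      ~-resp {x} h y≗z .close ε 0<ε with close h ε 0<ε
      ... | N , p = N , λ m n m≥ n≥ → subst (λ q → ∣ x m - q ∣ < ε) (y≗z n) (p m n m≥ n≥)

      ~-const : ∀ q → (λ _ → q) ~ (λ _ → q)
      ~-const q .close ε 0<ε = 0 , λ _ _ _ _ → subst (_< ε) (cong ∣_∣ (≡.sym (+-inverseʳ q))) 0<ε

      ~-+ : ∀ {x x′ y y′} → x ~ x′ → y ~ y′ → (λ n → x n + y n) ~ (λ n → x′ n + y′ n)
      ~-+ {x} {x′} {y} {y′} h k .close ε 0<ε with close h (ε * ½) (*-pos 0<ε 0<½) | close k (ε * ½) (*-pos 0<ε 0<½)
      ... | N , p | M , q = N ℕ.⊔ M , λ m n m≥ n≥ →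
        subst (∣ (x m + y m) - (x′ n + y′ n) ∣ <_) (≡.sym (halves ε))
          (≤-<-trans
            (subst (_≤ ∣ x m - x′ n ∣ + ∣ y m - y′ n ∣) (cong ∣_∣ (≡.sym (sub-+ (x m) (x′ n) (y m) (y′ n))))
              (∣p+q∣≤∣p∣+∣q∣ (x m - x′ n) (y m - y′ n)))
            (+-mono-< (p m n (ℕ.≤-trans (ℕ.m≤m⊔n N M) m≥) (ℕ.≤-trans (ℕ.m≤m⊔n N M) n≥))
                      (q m n (ℕ.≤-trans (ℕ.m≤n⊔m N M) m≥) (ℕ.≤-trans (ℕ.m≤n⊔m N M) n≥))))

      ~-neg : ∀ {x x′} → x ~ x′ → (λ n → - x n) ~ (λ n → - x′ n)
      ~-neg {x} {x′} h .close ε 0<ε with close h ε 0<ε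
      ... | N , p = N , λ m n m≥ n≥ →
        subst (_< ε) (≡.trans (∣-∣-sym (x m) (x′ n)) (cong ∣_∣ (≡.sym (sub-neg (x m) (x′ n))))) (p m n m≥ n≥)

      -- The left-hand sequence is eventually bounded.
      ~-bound : ∀ {x x′} → x ~ x′ → ∃[ B ] 0ℚ < B × ∃[ N ] ∀ m → N ℕ.≤ m → ∣ x m ∣ ≤ B
      ~-bound {x} {x′} h with close h 1ℚ 0<1
      ... | N , p = 1ℚ + ∣ x′ N ∣ , +-mono-<-≤ 0<1 (0≤∣p∣ (x′ N)) , N , λ m m≥ →
        ≤-trans (subst (_≤ ∣ x m - x′ N ∣ + ∣ x′ N ∣) (cong ∣_∣ (≡.sym (sub-add (x m) (x′ N))))
                   (∣p+q∣≤∣p∣+∣q∣ (x m - x′ N) (x′ N)))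
                (+-monoˡ-≤ ∣ x′ N ∣ (<⇒≤ (p m N m≥ ℕ.≤-refl)))

      scaled : ∀ {ε B b d} (0<B : 0ℚ < B) → ∣ b ∣ ≤ B → ∣ d ∣ < ε * inv B 0<B → ∣ b * d ∣ ≤ ε
      scaled {ε} {B} {b} {d} 0<B b≤ d< = begin
        ∣ b * d ∣         ≡⟨ ∣p*q∣≡∣p∣*∣q∣ b d ⟩
        ∣ b ∣ * ∣ d ∣     ≤⟨ *-mono (0≤∣p∣ b) (≤-trans (0≤∣p∣ d) (<⇒≤ d<)) b≤ (<⇒≤ d<) ⟩
        B * (ε * inv B 0<B) ≡⟨ solve 3 (λ B ε i → B :* (ε :* i) := ε :* (B :* i)) refl B ε (inv B 0<B) ⟩
        ε * (B * inv B 0<B) ≡⟨ cong (ε *_) (*-inv B 0<B) ⟩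
        ε * 1ℚ              ≡⟨ *-identityʳ ε ⟩
        ε                   ∎
        where open ≤-Reasoning
              open +-*-Solver

      quarters : ∀ {ε p q} → 0ℚ < ε → p ≤ ε * ½ * ½ → q ≤ ε * ½ * ½ → p + q < ε
      quarters {ε} {p} {q} 0<ε h k = begin-strict
        p + q                      ≤⟨ +-mono-≤ h k ⟩
        ε * ½ * ½ + ε * ½ * ½      ≡⟨ halves (ε * ½) ⟨
        ε * ½                      ≡⟨ +-identityʳ (ε * ½) ⟨
        ε * ½ + 0ℚ                 <⟨ +-monoʳ-< (ε * ½) (*-pos 0<ε 0<½) ⟩
        ε * ½ + ε * ½              ≡⟨ halves ε ⟨
        ε                          ∎
        where open ≤-Reasoning

      ~-*-bound : ∀ {ε B C} (p q r s : ℚ) (0<ε : 0ℚ < ε) (0<B : 0ℚ < B) (0<C : 0ℚ < C) →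
                  ∣ p ∣ ≤ B → ∣ s ∣ ≤ C →
                  ∣ r - s ∣ < ε * ½ * ½ * inv B 0<B → ∣ p - q ∣ < ε * ½ * ½ * inv C 0<C →
                  ∣ p * r - q * s ∣ < ε
      ~-*-bound p q r s 0<ε 0<B 0<C p≤ s≤ rs< pq< =
        ≤-<-trans
          (subst (_≤ ∣ p * (r - s) ∣ + ∣ s * (p - q) ∣) (cong ∣_∣ (≡.sym (sub-* p q r s)))
             (∣p+q∣≤∣p∣+∣q∣ (p * (r - s)) (s * (p - q))))
          (quarters 0<ε (scaled {b = p} {d = r - s} 0<B p≤ rs<) (scaled {b = s} {d = p - q} 0<C s≤ pq<))

      ~-* : ∀ {x x′ y y′} → x ~ x′ → y ~ y′ → (λ n → x n * y n) ~ (λ n → x′ n * y′ n)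
      ~-* {x} {x′} {y} {y′} h k .close ε 0<ε =
        let B , 0<B , N₁ , p = ~-bound h
            C , 0<C , N₂ , q = ~-bound (~-sym k)
            0<ε/4 = *-pos (*-pos 0<ε 0<½) 0<½
            N₃ , r = close k (ε * ½ * ½ * inv B 0<B) (*-pos 0<ε/4 (inv-pos B 0<B))
            N₄ , s = close h (ε * ½ * ½ * inv C 0<C) (*-pos 0<ε/4 (inv-pos C 0<C))
        in (N₁ ℕ.⊔ N₂) ℕ.⊔ (N₃ ℕ.⊔ N₄) , λ m n m≥ n≥ →
          ~-*-bound (x m) (x′ n) (y m) (y′ n) 0<ε 0<B 0<C
            (p m (ℕ.m⊔n≤o⇒m≤o N₁ N₂ (ℕ.m⊔n≤o⇒m≤o (N₁ ℕ.⊔ N₂) (N₃ ℕ.⊔ N₄) m≥)))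
            (q n (ℕ.m⊔n≤o⇒n≤o N₁ N₂ (ℕ.m⊔n≤o⇒m≤o (N₁ ℕ.⊔ N₂) (N₃ ℕ.⊔ N₄) n≥)))
            (r m n (ℕ.m⊔n≤o⇒m≤o N₃ N₄ (ℕ.m⊔n≤o⇒n≤o (N₁ ℕ.⊔ N₂) (N₃ ℕ.⊔ N₄) m≥))
                   (ℕ.m⊔n≤o⇒m≤o N₃ N₄ (ℕ.m⊔n≤o⇒n≤o (N₁ ℕ.⊔ N₂) (N₃ ℕ.⊔ N₄) n≥)))
            (s m n (ℕ.m⊔n≤o⇒n≤o N₃ N₄ (ℕ.m⊔n≤o⇒n≤o (N₁ ℕ.⊔ N₂) (N₃ ℕ.⊔ N₄) m≥))
                   (ℕ.m⊔n≤o⇒n≤o N₃ N₄ (ℕ.m⊔n≤o⇒n≤o (N₁ ℕ.⊔ N₂) (N₃ ℕ.⊔ N₄) n≥)))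

  open CauchySequences public

  module RealsAndComplexes where

    abstract
      inv-antitone : ∀ {p q} (0<p : 0ℚ < p) (0<q : 0ℚ < q) → q ≤ p → inv p 0<p ≤ inv q 0<q
      inv-antitone {p} {q} 0<p 0<q q≤p = begin
        inv p 0<p                       ≡⟨ *-identityʳ (inv p 0<p) ⟨
        inv p 0<p * 1ℚ                  ≡⟨ cong (inv p 0<p *_) (*-inv q 0<q) ⟨
        inv p 0<p * (q * inv q 0<q)     ≤⟨ *-mono (<⇒≤ (inv-pos p 0<p)) (*-nonNeg (<⇒≤ 0<p) (<⇒≤ (inv-pos q 0<q))) ≤-refl
                                             (*-monoʳ-≤-nonNeg (inv q 0<q) {{nonNegative (<⇒≤ (inv-pos q 0<q))}} q≤p) ⟩
        inv p 0<p * (p * inv q 0<q)     ≡⟨ *-assoc (inv p 0<p) p (inv q 0<q) ⟨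
        inv p 0<p * p * inv q 0<q       ≡⟨ cong (_* inv q 0<q) (≡.trans (*-comm (inv p 0<p) p) (*-inv p 0<p)) ⟩
        1ℚ * inv q 0<q                  ≡⟨ *-identityˡ (inv q 0<q) ⟩
        inv q 0<q                       ∎
        where open ≤-Reasoning

      inv-sub : ∀ {p q} (0<p : 0ℚ < p) (0<q : 0ℚ < q) →
                inv p 0<p - inv q 0<q ≡ (inv p 0<p * inv q 0<q) * (q - p)
      inv-sub {p} {q} 0<p 0<q = lemma (inv p 0<p) (inv q 0<q) p q (*-inv p 0<p) (*-inv q 0<q)
        where
        lemma : ∀ i j p q → p * i ≡ 1ℚ → q * j ≡ 1ℚ → i - j ≡ (i * j) * (q - p)
        lemma i j p q pi qj = ≡.sym (begin
          (i * j) * (q - p)         ≡⟨ solve 4 (λ i j p q → (i :* j) :* (q :- p) := i :* (q :* j) :- j :* (p :* i)) refl i j p q ⟩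
          i * (q * j) - j * (p * i) ≡⟨ cong₂ (λ u v → i * u - j * v) qj pi ⟩
          i * 1ℚ - j * 1ℚ           ≡⟨ cong₂ _-_ (*-identityʳ i) (*-identityʳ j) ⟩
          i - j                     ∎)
          where open ≡.≡-Reasoning
                open +-*-Solver

    ⊔-pos : ∀ {δ} → 0ℚ < δ → ∀ p → 0ℚ < p ⊔ δ
    ⊔-pos {δ} 0<δ p = <-≤-trans 0<δ (p≤q⊔p p δ)

    -- A sequence which is eventually at least δ is inverted by 1 / (x ⊔ δ).
    recip : ∀ {δ} → 0ℚ < δ → (ℕ → ℚ) → ℕ → ℚ
    recip {δ} 0<δ x n = inv (x n ⊔ δ) (⊔-pos 0<δ (x n))

    abstract
      recip-bound : ∀ {ε δ p q} (0<ε : 0ℚ < ε) (0<δ : 0ℚ < δ) (0<B : 0ℚ < inv δ 0<δ * inv δ 0<δ)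
                    (0<p : 0ℚ < p) (0<q : 0ℚ < q) → δ ≤ p → δ ≤ q →
                    ∣ q - p ∣ < ε * ½ * inv (inv δ 0<δ * inv δ 0<δ) 0<B →
                    ∣ inv p 0<p - inv q 0<q ∣ < ε
      recip-bound {ε} {δ} {p} {q} 0<ε 0<δ 0<B 0<p 0<q δ≤p δ≤q d< = begin-strict
        ∣ inv p 0<p - inv q 0<q ∣              ≡⟨ cong ∣_∣ (inv-sub 0<p 0<q) ⟩
        ∣ (inv p 0<p * inv q 0<q) * (q - p) ∣  ≤⟨ scaled {b = inv p 0<p * inv q 0<q} {d = q - p} 0<B b≤ d< ⟩
        ε * ½                                  ≡⟨ +-identityʳ (ε * ½) ⟨
        ε * ½ + 0ℚ                             <⟨ +-monoʳ-< (ε * ½) (*-pos 0<ε 0<½) ⟩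
        ε * ½ + ε * ½                          ≡⟨ halves ε ⟨
        ε                                      ∎
        where
        open ≤-Reasoning
        b≤ : ∣ inv p 0<p * inv q 0<q ∣ ≤ inv δ 0<δ * inv δ 0<δ
        b≤ = begin
          ∣ inv p 0<p * inv q 0<q ∣ ≡⟨ 0≤p⇒∣p∣≡p (<⇒≤ (*-pos (inv-pos p 0<p) (inv-pos q 0<q))) ⟩
          inv p 0<p * inv q 0<q     ≤⟨ *-mono (<⇒≤ (inv-pos p 0<p)) (<⇒≤ (inv-pos δ 0<δ))
                                         (inv-antitone 0<p 0<δ δ≤p) (inv-antitone 0<q 0<δ δ≤q) ⟩
          inv δ 0<δ * inv δ 0<δ     ∎

      ~-recip : ∀ {x δ} (0<δ : 0ℚ < δ) → x ~ x → ∃[ N ] (∀ n → N ℕ.≤ n → δ ≤ x n) →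
                recip 0<δ x ~ recip 0<δ x
      ~-recip {x} {δ} 0<δ h (N , p) .close ε 0<ε =
        let 0<B = *-pos (inv-pos δ 0<δ) (inv-pos δ 0<δ)
            M , q = close h (ε * ½ * inv (inv δ 0<δ * inv δ 0<δ) 0<B)
                      (*-pos (*-pos 0<ε 0<½) (inv-pos (inv δ 0<δ * inv δ 0<δ) 0<B))
            x⊔δ = λ n n≥ → ≡.sym (p≥q⇒p⊔q≡p (p n n≥))
        in N ℕ.⊔ M , λ m n m≥ n≥ →
          recip-bound 0<ε 0<δ 0<B (⊔-pos 0<δ (x m)) (⊔-pos 0<δ (x n)) (p≤q⊔p (x m) δ) (p≤q⊔p (x n) δ)
            (subst (_< ε * ½ * inv (inv δ 0<δ * inv δ 0<δ) 0<B)
              (≡.trans (∣-∣-sym (x m) (x n))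
                (cong₂ (λ u v → ∣ u - v ∣) (x⊔δ n (ℕ.m⊔n≤o⇒m≤o N M n≥)) (x⊔δ m (ℕ.m⊔n≤o⇒m≤o N M m≥))))
              (q m n (ℕ.m⊔n≤o⇒n≤o N M m≥) (ℕ.m⊔n≤o⇒n≤o N M n≥)))

      ~-eventually : ∀ {x y} → y ~ y → ∃[ N ] (∀ n → N ℕ.≤ n → x n ≡ y n) → x ~ y
      ~-eventually {x} {y} h (N , p) .close ε 0<ε with close h ε 0<ε
      ... | M , q = N ℕ.⊔ M , λ m n m≥ n≥ →
        subst (λ u → ∣ u - y n ∣ < ε) (≡.sym (p m (ℕ.m⊔n≤o⇒m≤o N M m≥)))
          (q m n (ℕ.m⊔n≤o⇒n≤o N M m≥) (ℕ.m⊔n≤o⇒n≤o N M n≥))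

      ~-*-recip : ∀ {x δ} (0<δ : 0ℚ < δ) → ∃[ N ] (∀ n → N ℕ.≤ n → δ ≤ x n) →
                  (λ n → x n * recip 0<δ x n) ~ (λ _ → 1ℚ)
      ~-*-recip {x} {δ} 0<δ (N , p) = ~-eventually (~-const 1ℚ) (N , λ n n≥ →
        ≡.trans (cong (_* recip 0<δ x n) (≡.sym (p≥q⇒p⊔q≡p (p n n≥)))) (*-inv _ (⊔-pos 0<δ (x n))))

    record ℝ : Set where
      constructor mkℝ
      field
        seq    : ℕ → ℚ
        cauchy : seq ~ seq

    open ℝ public

    infixl 6 _+ᴿ_
    infixl 7 _*ᴿ_

    fromℚ : ℚ → ℝ
    fromℚ q = mkℝ (λ _ → q) (~-const q)

    _+ᴿ_ _*ᴿ_ : ℝ → ℝ → ℝ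
    x +ᴿ y = mkℝ (λ n → seq x n + seq y n) (~-+ (cauchy x) (cauchy y))
    x *ᴿ y = mkℝ (λ n → seq x n * seq y n) (~-* (cauchy x) (cauchy y))

    -ᴿ_ : ℝ → ℝ
    -ᴿ x = mkℝ (λ n → - seq x n) (~-neg (cauchy x))

    record ℂ : Set where
      constructor mkℂ
      field
        re im : ℝ

    open ℂ public

    infix 4 _≈ᶜ_

    record _≈ᶜ_ (z w : ℂ) : Set where
      constructor mk≈
      field
        re≈ : seq (re z) ~ seq (re w)
        im≈ : seq (im z) ~ seq (im w)

    open _≈ᶜ_ public

    _+ᶜ_ _*ᶜ_ : ℂ → ℂ → ℂ
    z +ᶜ w = mkℂ (re z +ᴿ re w) (im z +ᴿ im w)
    z *ᶜ w = mkℂ (re z *ᴿ re w +ᴿ (-ᴿ (im z *ᴿ im w))) (re z *ᴿ im w +ᴿ im z *ᴿ re w)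

    -ᶜ_ : ℂ → ℂ
    -ᶜ z = mkℂ (-ᴿ re z) (-ᴿ im z)

    0ᶜ 1ᶜ : ℂ
    0ᶜ = mkℂ (fromℚ 0ℚ) (fromℚ 0ℚ)
    1ᶜ = mkℂ (fromℚ 1ℚ) (fromℚ 0ℚ)

    ℂ-pointwise : ∀ {z w} → (∀ n → seq (re z) n ≡ seq (re w) n) → (∀ n → seq (im z) n ≡ seq (im w) n) → z ≈ᶜ w
    ℂ-pointwise {z} p q = mk≈ (~-resp (cauchy (re z)) p) (~-resp (cauchy (im z)) q)

    ℂ-commutativeRing : CommutativeRing 0ℓ 0ℓ
    ℂ-commutativeRing = record
      { Carrier = ℂ ; _≈_ = _≈ᶜ_ ; _+_ = _+ᶜ_ ; _*_ = _*ᶜ_ ; -_ = -ᶜ_ ; 0# = 0ᶜ ; 1# = 1ᶜ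
      ; isCommutativeRing = record
        { isRing = record
          { +-isAbelianGroup = record
            { isGroup = record
              { isMonoid = record
                { isSemigroup = record
                  { isMagma = record
                    { isEquivalence = record
                      { refl = λ {z} → mk≈ (cauchy (re z)) (cauchy (im z))
                      ; sym = λ p → mk≈ (~-sym (re≈ p)) (~-sym (im≈ p))
                      ; trans = λ p q → mk≈ (~-trans (re≈ p) (re≈ q)) (~-trans (im≈ p) (im≈ q))
                      }
                    ; ∙-cong = λ p q → mk≈ (~-+ (re≈ p) (re≈ q)) (~-+ (im≈ p) (im≈ q))
                    }
                  ; assoc = λ u v w → ℂ-pointwise (λ n → +-assoc (seq (re u) n) _ _) (λ n → +-assoc (seq (im u) n) _ _)
                  }
                ; identity = (λ z → ℂ-pointwise (λ n → +-identityˡ _) (λ n → +-identityˡ _))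
                           , (λ z → ℂ-pointwise (λ n → +-identityʳ _) (λ n → +-identityʳ _))
                }
              ; inverse = (λ z → ℂ-pointwise (λ n → +-inverseˡ (seq (re z) n)) (λ n → +-inverseˡ (seq (im z) n)))
                        , (λ z → ℂ-pointwise (λ n → +-inverseʳ (seq (re z) n)) (λ n → +-inverseʳ (seq (im z) n)))
              ; ⁻¹-cong = λ p → mk≈ (~-neg (re≈ p)) (~-neg (im≈ p))
              }
            ; comm = λ z w → ℂ-pointwise (λ n → +-comm (seq (re z) n) _) (λ n → +-comm (seq (im z) n) _)
            }
          ; *-cong = λ p q → mk≈ (~-+ (~-* (re≈ p) (re≈ q)) (~-neg (~-* (im≈ p) (im≈ q))))
                                 (~-+ (~-* (re≈ p) (im≈ q)) (~-* (im≈ p) (re≈ q)))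
          ; *-assoc = λ z w v → ℂ-pointwise
              (λ n → solve 6 (λ a b c d e f → (a :* c :+ :- (b :* d)) :* e :+ :- ((a :* d :+ b :* c) :* f)
                                           := a :* (c :* e :+ :- (d :* f)) :+ :- (b :* (c :* f :+ d :* e))) refl
                     (seq (re z) n) (seq (im z) n) (seq (re w) n) (seq (im w) n) (seq (re v) n) (seq (im v) n))
              (λ n → solve 6 (λ a b c d e f → (a :* c :+ :- (b :* d)) :* f :+ (a :* d :+ b :* c) :* e
                                           := a :* (c :* f :+ d :* e) :+ b :* (c :* e :+ :- (d :* f))) refl
                     (seq (re z) n) (seq (im z) n) (seq (re w) n) (seq (im w) n) (seq (re v) n) (seq (im v) n))
          ; *-identity =
              (λ z → ℂ-pointwise
                (λ n → solve 2 (λ a b → con 1ℚ :* a :+ :- (con 0ℚ :* b) := a) refl (seq (re z) n) (seq (im z) n))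
                (λ n → solve 2 (λ a b → con 1ℚ :* b :+ con 0ℚ :* a := b) refl (seq (re z) n) (seq (im z) n)))
            , (λ z → ℂ-pointwise
                (λ n → solve 2 (λ a b → a :* con 1ℚ :+ :- (b :* con 0ℚ) := a) refl (seq (re z) n) (seq (im z) n))
                (λ n → solve 2 (λ a b → a :* con 0ℚ :+ b :* con 1ℚ := b) refl (seq (re z) n) (seq (im z) n)))
          ; distrib =
              (λ z w v → ℂ-pointwise
                (λ n → solve 6 (λ a b c d e f → a :* (c :+ e) :+ :- (b :* (d :+ f))
                                             := (a :* c :+ :- (b :* d)) :+ (a :* e :+ :- (b :* f))) refl
                     (seq (re z) n) (seq (im z) n) (seq (re w) n) (seq (im w) n) (seq (re v) n) (seq (im v) n))
                (λ n → solve 6 (λ a b c d e f → a :* (d :+ f) :+ b :* (c :+ e)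
                                             := (a :* d :+ b :* c) :+ (a :* f :+ b :* e)) refl
                     (seq (re z) n) (seq (im z) n) (seq (re w) n) (seq (im w) n) (seq (re v) n) (seq (im v) n)))
            , (λ z w v → ℂ-pointwise
                (λ n → solve 6 (λ a b c d e f → (c :+ e) :* a :+ :- ((d :+ f) :* b)
                                             := (c :* a :+ :- (d :* b)) :+ (e :* a :+ :- (f :* b))) refl
                     (seq (re z) n) (seq (im z) n) (seq (re w) n) (seq (im w) n) (seq (re v) n) (seq (im v) n))
                (λ n → solve 6 (λ a b c d e f → (c :+ e) :* b :+ (d :+ f) :* a
                                             := (c :* b :+ d :* a) :+ (e :* b :+ f :* a)) refl
                     (seq (re z) n) (seq (im z) n) (seq (re w) n) (seq (im w) n) (seq (re v) n) (seq (im v) n)))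
          }
        ; *-comm = λ z w → ℂ-pointwise
            (λ n → solve 4 (λ a b c d → a :* c :+ :- (b :* d) := c :* a :+ :- (d :* b)) refl
                     (seq (re z) n) (seq (im z) n) (seq (re w) n) (seq (im w) n))
            (λ n → solve 4 (λ a b c d → a :* d :+ b :* c := c :* b :+ d :* a) refl
                     (seq (re z) n) (seq (im z) n) (seq (re w) n) (seq (im w) n))
        }
      }
      where open +-*-Solver

  open RealsAndComplexes public

  module InvertibleComplexes where

    module ℂᴿ where
      open CommutativeRing ℂ-commutativeRing public
      open InvertibleElements ℂ-commutativeRing public
      open Algebra.Properties.Semiring.Sum semiring public using (sum)
      open Algebra.Properties.CommutativeSemiring.Exp commutativeSemiring public hiding (_^_)
      open Algebra.Properties.Ring ring public using (x∙y⁻¹≈ε⇒x≈y; x≈y⇒x∙y⁻¹≈ε)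

    ¼ : ℚ
    ¼ = ½ * ½

    0<¼ : 0ℚ < ¼
    0<¼ = positive⁻¹ ¼

    abstract
      square-nonNeg : ∀ p → 0ℚ ≤ p * p
      square-nonNeg p with ≤-total 0ℚ p
      ... | inj₁ 0≤p = *-nonNeg 0≤p 0≤p
      ... | inj₂ p≤0 = subst (0ℚ ≤_) (solve 1 (λ p → (:- p) :* (:- p) := p :* p) refl p)
                         (*-nonNeg (neg-antimono-≤ p≤0) (neg-antimono-≤ p≤0))
        where open +-*-Solver

      ≤-square : ∀ {p q} → 0ℚ ≤ p → p ≤ q → p * p ≤ q * q
      ≤-square 0≤p p≤q = *-mono 0≤p (≤-trans 0≤p p≤q) p≤q p≤q

      ≤-+ˡ : ∀ {p q r} → p ≤ q → 0ℚ ≤ r → p ≤ q + r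
      ≤-+ˡ {p} {q} {r} p≤q 0≤r = subst (_≤ q + r) (+-identityʳ p) (+-mono-≤ p≤q 0≤r)

      ≤-+ʳ : ∀ {p q r} → p ≤ q → 0ℚ ≤ r → p ≤ r + q
      ≤-+ʳ {p} {q} {r} p≤q 0≤r = subst (p ≤_) (+-comm q r) (≤-+ˡ p≤q 0≤r)

    normSq : ℂ → ℕ → ℚ
    normSq z n = seq (re z) n * seq (re z) n + seq (im z) n * seq (im z) n

    -- z⁻¹ = z̄ / ∣ z ∣²
    ℂ-invertible : ∀ z {δ} → 0ℚ < δ → ∃[ N ] (∀ n → N ℕ.≤ n → δ ≤ normSq z n) → ℂᴿ.Invertible z
    ℂ-invertible z {δ} 0<δ bound = mkℂ (re z *ᴿ r) (-ᴿ (im z *ᴿ r)) , mk≈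
      (~-sym (~-resp (~-sym (~-*-recip 0<δ bound)) (λ n → solve 3 (λ a b r →
        (a :* a :+ b :* b) :* r := a :* (a :* r) :+ :- (b :* :- (b :* r))) refl (seq (re z) n) (seq (im z) n) (seq r n))))
      (~-sym (~-resp (~-const 0ℚ) (λ n → solve 3 (λ a b r →
        con 0ℚ := a :* :- (b :* r) :+ b :* (a :* r)) refl (seq (re z) n) (seq (im z) n) (seq r n))))
      where
      open +-*-Solver
      r : ℝ
      r = mkℝ (recip 0<δ (normSq z)) (~-recip 0<δ (~-+ (~-* (cauchy (re z)) (cauchy (re z))) (~-* (cauchy (im z)) (cauchy (im z)))) bound)

    abstract
      -- A complex number whose real part is eventually at least ¼ is invertible.
      re-invertible : ∀ z N → (∀ n → N ℕ.≤ n → ¼ ≤ seq (re z) n) → ℂᴿ.Invertible z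
      re-invertible z N p = ℂ-invertible z (*-pos 0<¼ 0<¼) (N , λ n n≥ →
        ≤-+ˡ (≤-square (<⇒≤ 0<¼) (p n n≥)) (square-nonNeg (seq (im z) n)))

      sub-bound : ∀ p q → ½ ≤ p → ∣ p - q ∣ < ¼ → ¼ ≤ q
      sub-bound p q ½≤p d = subst (¼ ≤_) (cancel p q) (subst (_≤ p - (p - q)) {x = ½ - ¼} refl
        (+-mono-≤ {½} {p} { - ¼} { - (p - q)} ½≤p (neg-antimono-≤ (≤-trans (p≤∣p∣ (p - q)) (<⇒≤ d)))))
        where
        open +-*-Solver
        cancel : ∀ p q → p - (p - q) ≡ q
        cancel = solve 2 (λ p q → p :- (p :- q) := q) refl

      ½≤1- : ∀ p → p ≤ ½ → ½ ≤ 1ℚ - p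
      ½≤1- p p≤½ = subst (_≤ 1ℚ - p) {x = 1ℚ - ½} refl (+-monoʳ-≤ 1ℚ { - ½} { - p} (neg-antimono-≤ p≤½))

      sub-reflect : ∀ x y → y - x ≡ (1ℚ - x) - (1ℚ - y)
      sub-reflect = solve 2 (λ x y → y :- x := (con 1ℚ :- x) :- (con 1ℚ :- y)) refl
        where open +-*-Solver

      sub-bound′ : ∀ p q → p ≤ ½ → ∣ q - p ∣ < ¼ → ¼ ≤ 1ℚ - q
      sub-bound′ p q p≤½ d = sub-bound (1ℚ - p) (1ℚ - q) (½≤1- p p≤½)
        (subst (λ r → ∣ r ∣ < ¼) (sub-reflect p q) d)

      re-local : ∀ a → ℂᴿ.Invertible a ⊎ ℂᴿ.Invertible (1ᶜ ℂᴿ.- a)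
      re-local a = Sum.map left right (≤-total ½ (seq (re a) N))
        where
        N : ℕ
        N = proj₁ (close (cauchy (re a)) ¼ 0<¼)

        near : ∀ m n → N ℕ.≤ m → N ℕ.≤ n → ∣ seq (re a) m - seq (re a) n ∣ < ¼
        near = proj₂ (close (cauchy (re a)) ¼ 0<¼)

        left : ½ ≤ seq (re a) N → ℂᴿ.Invertible a
        left ½≤a = re-invertible a N (λ n n≥ → sub-bound (seq (re a) N) (seq (re a) n) ½≤a (near N n ℕ.≤-refl n≥))

        right : seq (re a) N ≤ ½ → ℂᴿ.Invertible (1ᶜ ℂᴿ.- a)
        right a≤½ = re-invertible (1ᶜ ℂᴿ.- a) N (λ n n≥ → sub-bound′ (seq (re a) N) (seq (re a) n) a≤½ (near n N n≥ ℕ.≤-refl))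

      ℂ-local : ∀ {z w} → ℂᴿ.Invertible (z ℂᴿ.+ w) → ℂᴿ.Invertible z ⊎ ℂᴿ.Invertible w
      ℂ-local {z} {w} (v , p) = Sum.map
        (ℂᴿ.invertible-factor {z} {v} ℂᴿ.refl)
        (ℂᴿ.invertible-factor {w} {v} (ℂᴿ.complement {z} {w} {v} p))
        (re-local (z ℂᴿ.* v))

      natural-re : ∀ n k → 0ℚ ≤ seq (re (ℂᴿ.sum {n} (λ _ → 1ᶜ))) k
      natural-re zero    k = ≤-refl
      natural-re (suc n) k = ≤-+ˡ (<⇒≤ 0<1) (natural-re n k)

      -- ℂ has characteristic zero.
      natural-invertible : ∀ n .{{_ : ℕ.NonZero n}} → ℂᴿ.Invertible (ℂᴿ.sum {n} (λ _ → 1ᶜ))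
      natural-invertible (suc n) = ℂ-invertible (ℂᴿ.sum {suc n} (λ _ → 1ᶜ)) (*-pos 0<1 0<1) (0 , λ k _ →
        ≤-+ˡ (≤-square (<⇒≤ 0<1) (≤-+ˡ ≤-refl (natural-re n k))) (square-nonNeg (seq (im (ℂᴿ.sum {suc n} (λ _ → 1ᶜ))) k)))

      1≉0 : ¬ 1ᶜ ≈ᶜ 0ᶜ
      1≉0 p = let N , q = close (re≈ p) ½ 0<½ in
        toWitnessFalse {a? = ∣ 1ℚ - 0ℚ ∣ <? ½} _ (q N N ℕ.≤-refl ℕ.≤-refl)

  open InvertibleComplexes public

  module TangentBisection where

    -- Q k s and P k s are the real and the imaginary part of (1 + i s) ^ k.
    Q P : ℕ → ℚ → ℚ
    Q zero    s = 1ℚ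
    Q (suc k) s = 1ℚ * Q k s + - (s * P k s)
    P zero    s = 0ℚ
    P (suc k) s = 1ℚ * P k s + s * Q k s

    -- For s > 0, Good c s says that c arctan s ≤ π, and Bad c s that c arctan s > π.
    Good Bad : ℕ → ℚ → Set
    Good c s = ∀ k → k ℕ.≤ c → 0ℚ ≤ P k s
    Bad  c s = ∃[ k ] k ℕ.≤ c × P k s < 0ℚ

    good? : ∀ c s → Good c s ⊎ Bad c s
    good? zero    s = inj₁ (λ { zero _ → ≤-refl })
    good? (suc c) s with good? c s
    ... | inj₂ (k , k≤c , p) = inj₂ (k , ℕ.m≤n⇒m≤1+n k≤c , p)
    ... | inj₁ g with 0ℚ ≤? P (suc c) s
    ...   | no  p = inj₂ (suc c , ℕ.≤-refl , ≰⇒> p)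
    ...   | yes p = inj₁ λ k k≤ → helper k (ℕ.m≤n⇒m<n∨m≡n k≤)
      where
      helper : ∀ k → k ℕ.< suc c ⊎ k ≡ suc c → 0ℚ ≤ P k s
      helper k (inj₁ k<) = g k (ℕ.≤-pred k<)
      helper k (inj₂ refl) = p

    abstract
      0≤q-p : ∀ {p q} → p ≤ q → 0ℚ ≤ q - p
      0≤q-p {p} {q} p≤q = subst (_≤ q - p) (+-inverseʳ p) (+-monoˡ-≤ (- p) p≤q)

      p≤q : ∀ {p q} → 0ℚ ≤ q - p → p ≤ q
      p≤q {p} {q} h = subst (p ≤_) (solve 2 (λ p q → p :+ (q :- p) := q) refl p q) (≤-+ˡ {p} ≤-refl h)
        where open +-*-Solver

      -- ∣ 1 + i s ∣ ^ (2 k) ≥ 1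
      norm-bound : ∀ k s → 1ℚ ≤ Q k s * Q k s + P k s * P k s
      norm-bound zero    s = ≤-refl
      norm-bound (suc k) s = subst (1ℚ ≤_) (eq s (Q k s) (P k s))
        (≤-+ˡ (norm-bound k s) (*-nonNeg (square-nonNeg s) (≤-trans (<⇒≤ 0<1) (norm-bound k s))))
        where
        open +-*-Solver
        eq : ∀ s q p → (q * q + p * p) + (s * s) * (q * q + p * p)
             ≡ (1ℚ * q + - (s * p)) * (1ℚ * q + - (s * p)) + (1ℚ * p + s * q) * (1ℚ * p + s * q)
        eq = solve 3 (λ s q p → (q :* q :+ p :* p) :+ (s :* s) :* (q :* q :+ p :* p)
             := (con 1ℚ :* q :+ :- (s :* p)) :* (con 1ℚ :* q :+ :- (s :* p)) :+ (con 1ℚ :* p :+ s :* q) :* (con 1ℚ :* p :+ s :* q)) refl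

      abs-cases : ∀ {p q} → q ≤ p → - q ≤ p → ∣ q ∣ ≤ p
      abs-cases {p} {q} h k with ∣p∣≡p∨∣p∣≡-p q
      ... | inj₁ e = subst (_≤ p) (≡.sym e) h
      ... | inj₂ e = subst (_≤ p) (≡.sym e) k

      -- P k s ≥ s ∣ Q k s ∣, because P (k - 1) s and P (k + 1) s are nonnegative.
      P≥s∣Q∣ : ∀ {s} → 0ℚ ≤ s → ∀ k → 0ℚ ≤ P k s → 0ℚ ≤ P (suc (suc k)) s → s * ∣ Q (suc k) s ∣ ≤ P (suc k) s
      P≥s∣Q∣ {s} 0≤s k h₀ h₂ = subst (_≤ P (suc k) s)
          (≡.trans (∣p*q∣≡∣p∣*∣q∣ s (Q (suc k) s)) (cong (_* ∣ Q (suc k) s ∣) (0≤p⇒∣p∣≡p 0≤s)))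
          (abs-cases
            (p≤q (subst (0ℚ ≤_) (eq₀ s (Q k s) (P k s)) (≤-+ˡ h₀ (*-nonNeg (square-nonNeg s) h₀))))
            (p≤q (subst (0ℚ ≤_) (eq₂ s (Q (suc k) s) (P (suc k) s)) h₂)))
        where
        open +-*-Solver
        eq₀ : ∀ s q p → p + (s * s) * p ≡ (1ℚ * p + s * q) - s * (1ℚ * q + - (s * p))
        eq₀ = solve 3 (λ s q p → p :+ (s :* s) :* p := (con 1ℚ :* p :+ s :* q) :- s :* (con 1ℚ :* q :+ :- (s :* p))) refl
        eq₂ : ∀ s q p → 1ℚ * p + s * q ≡ p - - (s * q)
        eq₂ = solve 3 (λ s q p → con 1ℚ :* p :+ s :* q := p :- :- (s :* q)) refl

      ½*½+½*½<1 : ½ * ½ + ½ * ½ < 1ℚ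
      ½*½+½*½<1 = toWitness {a? = (½ * ½ + ½ * ½) <? 1ℚ} _
    
      -- Hence P k s is bounded away from zero for 0 < k < c.
      P-bound : ∀ {c s s₀} → 0ℚ < s₀ → s₀ ≤ 1ℚ → s₀ ≤ s → Good c s →
                ∀ k → 0 ℕ.< k → k ℕ.< c → s₀ * ½ ≤ P k s
      P-bound {c} {s} {s₀} 0<s₀ s₀≤1 s₀≤s good (suc k) _ k<c with s₀ * ½ ≤? P (suc k) s
      ... | yes p = p
      ... | no ¬p = contradiction
              (≤-<-trans (norm-bound (suc k) s) (≤-<-trans (+-mono-≤ q²≤ (≤-square 0≤p p≤½)) ½*½+½*½<1)) (<-irrefl refl)
        where
        p<  : P (suc k) s < s₀ * ½
        p< = ≰⇒> ¬p
        0≤p : 0ℚ ≤ P (suc k) s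
        0≤p = good (suc k) (ℕ.<⇒≤ k<c)
        p≤½ : P (suc k) s ≤ ½
        p≤½ = ≤-trans (<⇒≤ p<) (subst (s₀ * ½ ≤_) (*-identityˡ ½) (*-monoʳ-≤-nonNeg ½ s₀≤1))
        ∣q∣<½ : ∣ Q (suc k) s ∣ < ½
        ∣q∣<½ = *-cancelˡ-<-nonNeg s₀ {{nonNegative (<⇒≤ 0<s₀)}}
          (≤-<-trans (*-monoʳ-≤-nonNeg ∣ Q (suc k) s ∣ {{∣-∣-nonNeg (Q (suc k) s)}} s₀≤s)
            (≤-<-trans (P≥s∣Q∣ (≤-trans (<⇒≤ 0<s₀) s₀≤s) k (good k (ℕ.≤-trans (ℕ.n≤1+n k) (ℕ.<⇒≤ k<c))) (good (suc (suc k)) k<c)) p<))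
        q²≤ : Q (suc k) s * Q (suc k) s ≤ ½ * ½
        q²≤ = subst (_≤ ½ * ½) sq (≤-square (0≤∣p∣ (Q (suc k) s)) (<⇒≤ ∣q∣<½))
          where
          sq : ∣ Q (suc k) s ∣ * ∣ Q (suc k) s ∣ ≡ Q (suc k) s * Q (suc k) s
          sq = ≡.trans (≡.sym (∣p*q∣≡∣p∣*∣q∣ (Q (suc k) s) (Q (suc k) s))) (0≤p⇒∣p∣≡p (square-nonNeg (Q (suc k) s)))

    ι : ℕ → ℚ
    ι zero    = 0ℚ
    ι (suc n) = 1ℚ + ι n

    abstract
      0≤ι : ∀ n → 0ℚ ≤ ι n
      0≤ι zero    = ≤-refl
      0≤ι (suc n) = ≤-+ˡ (<⇒≤ 0<1) (0≤ι n)

      ι-mono : ∀ {m n} → m ℕ.≤ n → ι m ≤ ι n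
      ι-mono {n = n} ℕ.z≤n = 0≤ι n
      ι-mono (ℕ.s≤s m≤n)   = +-monoʳ-≤ 1ℚ (ι-mono m≤n)

      ι≡/1 : ∀ n → ι n ≡ mkℚ (+ n) 0 (Coprimality.sym (1-coprimeTo n))
      ι≡/1 zero    = refl
      ι≡/1 (suc n) = ≡.trans (cong (λ q → 1ℚ + q) (ι≡/1 n))
        (≡.trans (cong (λ i → (+ 1 ℤ.+ i) / 1) (ℤ.*-identityʳ (+ n)))
                 (↥p/↧p≡p (mkℚ (+ suc n) 0 (Coprimality.sym (1-coprimeTo (suc n))))))

      archimedean : ∀ p → ∃[ n ] p ≤ ι n
      archimedean (mkℚ i d c) = ℤ.∣ i ∣ , subst (mkℚ i d c ≤_) (≡.sym (ι≡/1 ℤ.∣ i ∣))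
        (*≤* (ℤ.≤-trans (ℤ.≤-reflexive (ℤ.*-identityʳ i)) (ℤ.≤-trans (i≤∣i∣ i) (ℤ.≤-trans (ℤ.≤-reflexive (≡.sym (ℤ.*-identityʳ (+ ℤ.∣ i ∣))))
          (ℤ.*-monoˡ-≤-nonNeg (+ ℤ.∣ i ∣) (ℤ.+≤+ (ℕ.s≤s ℕ.z≤n)))))))
        where
        i≤∣i∣ : ∀ i → i ℤ.≤ + ℤ.∣ i ∣
        i≤∣i∣ (+ n)      = ℤ.≤-refl
        i≤∣i∣ (-[1+ n ]) = ℤ.-≤+

    -- Bisection for s = tan (π / c).
    module Bisection (c : ℕ) (3≤c : 3 ℕ.≤ c) where

      0<ιc : 0ℚ < ι c
      0<ιc = <-≤-trans 0<1 (≤-trans (≤-reflexive (≡.sym (+-identityʳ 1ℚ))) (ι-mono {1} (ℕ.≤-trans (ℕ.s≤s ℕ.z≤n) 3≤c)))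

      s₀ : ℚ
      s₀ = ½ * inv (ι c) 0<ιc

      abstract
        0<s₀ : 0ℚ < s₀
        0<s₀ = *-pos 0<½ (inv-pos (ι c) 0<ιc)

        s₀+s₀ : ∀ k → k ℕ.≤ c → ι k * (s₀ + s₀) ≤ 1ℚ
        s₀+s₀ k k≤c = subst (ι k * (s₀ + s₀) ≤_) eq
          (*-monoʳ-≤-nonNeg (s₀ + s₀) {{nonNegative (≤-+ˡ (<⇒≤ 0<s₀) (<⇒≤ 0<s₀))}} (ι-mono k≤c))
          where
          eq : ι c * (s₀ + s₀) ≡ 1ℚ
          eq = ≡.trans (cong (ι c *_) (≡.trans (cong₂ _+_ (*-comm ½ (inv (ι c) 0<ιc)) (*-comm ½ (inv (ι c) 0<ιc))) (≡.sym (halves (inv (ι c) 0<ιc)))))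
                 (*-inv (ι c) 0<ιc)

        s₀≤1 : s₀ ≤ 1ℚ
        s₀≤1 = ≤-trans (≤-+ˡ ≤-refl (<⇒≤ 0<s₀)) (subst (_≤ 1ℚ)
          (≡.trans (cong (_* (s₀ + s₀)) (+-identityʳ 1ℚ)) (*-identityˡ (s₀ + s₀)))
          (s₀+s₀ 1 (ℕ.≤-trans (ℕ.s≤s ℕ.z≤n) 3≤c)))

        scale≤ : ∀ {p q} → p ≤ 1ℚ → 0ℚ ≤ q → p * q ≤ q
        scale≤ {p} {q} p≤1 0≤q = subst (p * q ≤_) (*-identityˡ q) (*-monoʳ-≤-nonNeg q {{nonNegative 0≤q}} p≤1)

        initial : ∀ k → k ℕ.≤ c → 0ℚ ≤ P k s₀ × 0ℚ ≤ Q k s₀ × P k s₀ ≤ ι k * (s₀ + s₀) * Q k s₀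
        initial zero    _    = ≤-refl , <⇒≤ 0<1 , ≤-reflexive (solve 1 (λ s → con 0ℚ := con 0ℚ :* (s :+ s) :* con 1ℚ) refl s₀)
          where open +-*-Solver
        initial (suc k) k<c = 0≤P′ , 0≤Q′ , p≤q (subst (0ℚ ≤_) (eq s₀ (Q k s₀) (P k s₀) (ι k)) (≤-+ˡ
            (0≤q-p h)
            (*-nonNeg (<⇒≤ 0<s₀) (0≤q-p (≤-trans (scale≤ (s₀+s₀ (suc k) k<c) 0≤P) P≤Q)))))
          where
          open +-*-Solver
          ih : 0ℚ ≤ P k s₀ × 0ℚ ≤ Q k s₀ × P k s₀ ≤ ι k * (s₀ + s₀) * Q k s₀
          ih = initial k (ℕ.≤-trans (ℕ.n≤1+n k) k<c)
          0≤P : 0ℚ ≤ P k s₀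
          0≤P = proj₁ ih
          0≤Q : 0ℚ ≤ Q k s₀
          0≤Q = proj₁ (proj₂ ih)
          h : P k s₀ ≤ ι k * (s₀ + s₀) * Q k s₀
          h = proj₂ (proj₂ ih)
          P≤Q : P k s₀ ≤ Q k s₀
          P≤Q = ≤-trans h (scale≤ (s₀+s₀ k (ℕ.≤-trans (ℕ.n≤1+n k) k<c)) 0≤Q)
          0≤P′ : 0ℚ ≤ P (suc k) s₀
          0≤P′ = ≤-+ˡ (*-nonNeg (<⇒≤ 0<1) 0≤P) (*-nonNeg (<⇒≤ 0<s₀) 0≤Q)
          0≤Q′ : 0ℚ ≤ Q (suc k) s₀
          0≤Q′ = subst (λ q → 0ℚ ≤ q - s₀ * P k s₀) (≡.sym (*-identityˡ (Q k s₀))) (0≤q-p (≤-trans (scale≤ s₀≤1 0≤P) P≤Q))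
          eq : ∀ s q p i → (i * (s + s) * q - p) + s * (q - (1ℚ + i) * (s + s) * p)
                         ≡ (1ℚ + i) * (s + s) * (1ℚ * q + - (s * p)) - (1ℚ * p + s * q)
          eq = solve 4 (λ s q p i → (i :* (s :+ s) :* q :- p) :+ s :* (q :- (con 1ℚ :+ i) :* (s :+ s) :* p)
                 := (con 1ℚ :+ i) :* (s :+ s) :* (con 1ℚ :* q :+ :- (s :* p)) :- (con 1ℚ :* p :+ s :* q)) refl

        2-bad : Bad c (1ℚ + 1ℚ)
        2-bad = 3 , 3≤c , toWitness {a? = P 3 (1ℚ + 1ℚ) <? 0ℚ} _
      
      record Bracket : Set where
        field
          lo hi : ℚ
          s₀≤lo : s₀ ≤ lo
          lo≤hi : lo ≤ hi
          good  : Good c lo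
          bad   : Bad c hi

      open Bracket

      mid : Bracket → ℚ
      mid b = (lo b + hi b) * ½

      abstract
        lo≤mid : ∀ b → lo b ≤ mid b
        lo≤mid b = p≤q (subst (0ℚ ≤_) (solve 2 (λ l h → (h :- l) :* con ½ := (l :+ h) :* con ½ :- l) refl (lo b) (hi b))
          (*-nonNeg (0≤q-p (lo≤hi b)) (<⇒≤ 0<½)))
          where open +-*-Solver

        mid≤hi : ∀ b → mid b ≤ hi b
        mid≤hi b = p≤q (subst (0ℚ ≤_) (solve 2 (λ l h → (h :- l) :* con ½ := h :- (l :+ h) :* con ½) refl (lo b) (hi b))
          (*-nonNeg (0≤q-p (lo≤hi b)) (<⇒≤ 0<½)))
          where open +-*-Solver

      halve : ∀ b → Good c (mid b) ⊎ Bad c (mid b) → Bracket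
      halve b (inj₁ g) = record { lo = mid b ; hi = hi b ; s₀≤lo = ≤-trans (s₀≤lo b) (lo≤mid b) ; lo≤hi = mid≤hi b ; good = g ; bad = bad b }
      halve b (inj₂ g) = record { lo = lo b ; hi = mid b ; s₀≤lo = s₀≤lo b ; lo≤hi = lo≤mid b ; good = good b ; bad = g }

      bracket : ℕ → Bracket
      bracket zero    = record
        { lo = s₀ ; hi = 1ℚ + 1ℚ ; s₀≤lo = ≤-refl ; lo≤hi = ≤-+ˡ s₀≤1 (<⇒≤ 0<1)
        ; good = λ k k≤c → proj₁ (initial k k≤c) ; bad = 2-bad }
      bracket (suc n) = halve (bracket n) (good? c (mid (bracket n)))

      los his : ℕ → ℚ
      los n = lo (bracket n)
      his n = hi (bracket n)

      abstract
        lo-step : ∀ b d → lo b ≤ lo (halve b d)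
        lo-step b (inj₁ _) = lo≤mid b
        lo-step b (inj₂ _) = ≤-refl

        hi-step : ∀ b d → hi (halve b d) ≤ hi b
        hi-step b (inj₁ _) = ≤-refl
        hi-step b (inj₂ _) = mid≤hi b

        width-step : ∀ b d → hi (halve b d) - lo (halve b d) ≡ (hi b - lo b) * ½
        width-step b (inj₁ _) = solve 2 (λ l h → h :- (l :+ h) :* con ½ := (h :- l) :* con ½) refl (lo b) (hi b)
          where open +-*-Solver
        width-step b (inj₂ _) = solve 2 (λ l h → (l :+ h) :* con ½ :- l := (h :- l) :* con ½) refl (lo b) (hi b)
          where open +-*-Solver

        lo-mono : ∀ {m n} → m ℕ.≤′ n → los m ≤ los n
        lo-mono (ℕ.≤′-reflexive refl)   = ≤-refl
        lo-mono (ℕ.≤′-step {n} m≤n) = ≤-trans (lo-mono m≤n) (lo-step (bracket n) (good? c (mid (bracket n))))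

        hi-mono : ∀ {m n} → m ℕ.≤′ n → his n ≤ his m
        hi-mono (ℕ.≤′-reflexive refl)   = ≤-refl
        hi-mono (ℕ.≤′-step {n} m≤n) = ≤-trans (hi-step (bracket n) (good? c (mid (bracket n)))) (hi-mono m≤n)

        lo≤hi-all : ∀ m n → los m ≤ his n
        lo≤hi-all m n = ≤-trans (lo-mono (ℕ.≤⇒≤′ (ℕ.m≤m⊔n m n)))
          (≤-trans (lo≤hi (bracket (m ℕ.⊔ n))) (hi-mono (ℕ.≤⇒≤′ (ℕ.m≤n⊔m m n))))

        -- The width is 2 - s₀ divided by 2 ^ n, hence at most 2 / (n + 1).
        width : ∀ n → (his n - los n) * ι (suc n) ≤ 1ℚ + 1ℚ
        width zero    = p≤q (subst (0ℚ ≤_) (eq s₀) (<⇒≤ 0<s₀))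
          where
          open +-*-Solver
          eq : ∀ s → s ≡ (1ℚ + 1ℚ) - ((1ℚ + 1ℚ) - s) * (1ℚ + 0ℚ)
          eq = solve 1 (λ s → s := (con 1ℚ :+ con 1ℚ) :- ((con 1ℚ :+ con 1ℚ) :- s) :* (con 1ℚ :+ con 0ℚ)) refl
        width (suc n) = subst (λ w → w * ι (suc (suc n)) ≤ 1ℚ + 1ℚ) (≡.sym (width-step (bracket n) (good? c (mid (bracket n)))))
          (≤-trans (p≤q (subst (0ℚ ≤_) (eq (his n - los n) (ι n)) (*-nonNeg 0<½*w (0≤ι n)))) (width n))
          where
          open +-*-Solver
          0<½*w : 0ℚ ≤ (his n - los n) * ½
          0<½*w = *-nonNeg (0≤q-p (lo≤hi (bracket n))) (<⇒≤ 0<½)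
          eq : ∀ w i → (w * ½) * i ≡ w * (1ℚ + i) - (w * ½) * (1ℚ + (1ℚ + i))
          eq = solve 2 (λ w i → (w :* con ½) :* i := w :* (con 1ℚ :+ i) :- (w :* con ½) :* (con 1ℚ :+ (con 1ℚ :+ i))) refl

        width< : ∀ ε → 0ℚ < ε → ∃[ n ] his n - los n < ε
        width< ε 0<ε = n , *-cancelʳ-<-nonNeg (ι (suc n)) {{nonNegative (0≤ι (suc n))}} (≤-<-trans (width n)
          (subst (_< ε * ι (suc n)) 2≡ (*-monoʳ-<-pos ε {{positive 0<ε}} x<)))
          where
          x : ℚ
          x = (1ℚ + 1ℚ) * inv ε 0<ε
          n : ℕ
          n = proj₁ (archimedean x)
          x< : x < ι (suc n)
          x< = subst (_< ι (suc n)) (+-identityˡ x) (+-mono-<-≤ 0<1 (proj₂ (archimedean x)))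
          2≡ : ε * x ≡ 1ℚ + 1ℚ
          2≡ = ≡.trans (exchange ε (1ℚ + 1ℚ) (inv ε 0<ε)) (≡.trans (cong ((1ℚ + 1ℚ) *_) (*-inv ε 0<ε)) (*-identityʳ (1ℚ + 1ℚ)))
            where
            open +-*-Solver
            exchange : ∀ a b c → a * (b * c) ≡ b * (a * c)
            exchange = solve 3 (λ a b c → a :* (b :* c) := b :* (a :* c)) refl

        lo~hi : los ~ his
        lo~hi .close ε 0<ε = let N , w< = width< ε 0<ε in N , λ m n m≥ n≥ →
          ≤-<-trans (≤-reflexive (≡.trans (∣-∣-sym (los m) (his n)) (0≤p⇒∣p∣≡p (0≤q-p (lo≤hi-all m n)))))
            (≤-<-trans (+-mono-≤ (hi-mono (ℕ.≤⇒≤′ n≥)) (neg-antimono-≤ (lo-mono (ℕ.≤⇒≤′ m≥)))) w<)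

  open TangentBisection public

  module PrimitiveRoots where

    module PrimitiveRootOfUnity (c : ℕ) (3≤c : 3 ℕ.≤ c) where
      open Bisection c 3≤c
      open Bracket

      β : ℚ
      β = s₀ * ½

      abstract
        0<β : 0ℚ < β
        0<β = *-pos 0<s₀ 0<½

        los~los : los ~ los
        los~los = ~-trans lo~hi (~-sym lo~hi)

        los-bound : ∀ k → 0 ℕ.< k → k ℕ.< c → ∀ n → β ≤ P k (los n)
        los-bound k 0<k k<c n = P-bound 0<s₀ s₀≤1 (s₀≤lo (bracket n)) (good (bracket n)) k 0<k k<c

        QP-~ : ∀ k → (λ n → Q k (los n)) ~ (λ n → Q k (his n)) × (λ n → P k (los n)) ~ (λ n → P k (his n))
        QP-~ zero    = ~-const 1ℚ , ~-const 0ℚ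
        QP-~ (suc k) = let q , p = QP-~ k in
            ~-+ (~-* (~-const 1ℚ) q) (~-neg (~-* lo~hi p))
          , ~-+ (~-* (~-const 1ℚ) p) (~-* lo~hi q)

        P-uniform : ∀ ε → 0ℚ < ε → ∀ d → ∃[ N ] (∀ k n → k ℕ.≤ d → N ℕ.≤ n → ∣ P k (los n) - P k (his n) ∣ < ε)
        P-uniform ε 0<ε zero    = 0 , λ { zero n _ _ → 0<ε }
        P-uniform ε 0<ε (suc d) = let N , p = P-uniform ε 0<ε d
                                      M , q = close (proj₂ (QP-~ (suc d))) ε 0<ε
          in N ℕ.⊔ M , λ k n k≤ n≥ → helper N M p q k n n≥ (ℕ.m≤n⇒m<n∨m≡n k≤)
          where
          helper : ∀ N M → (∀ k n → k ℕ.≤ d → N ℕ.≤ n → ∣ P k (los n) - P k (his n) ∣ < ε) →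
                   (∀ m n → M ℕ.≤ m → M ℕ.≤ n → ∣ P (suc d) (los m) - P (suc d) (his n) ∣ < ε) →
                   ∀ k n → N ℕ.⊔ M ℕ.≤ n → k ℕ.< suc d ⊎ k ≡ suc d → ∣ P k (los n) - P k (his n) ∣ < ε
          helper N M p q k n n≥ (inj₁ k<)   = p k n (ℕ.≤-pred k<) (ℕ.m⊔n≤o⇒m≤o N M n≥)
          helper N M p q k n n≥ (inj₂ refl) = q n n (ℕ.m⊔n≤o⇒n≤o N M n≥) (ℕ.m⊔n≤o⇒n≤o N M n≥)

        lo<hi+ε : ∀ {p q ε} → ∣ p - q ∣ < ε → q < 0ℚ → p < ε
        lo<hi+ε {p} {q} {ε} d q<0 = subst (_< ε) (≡.sym (sub-add p q)) (subst ((p - q) + q <_) (+-identityʳ ε)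
          (+-mono-< (≤-<-trans (p≤∣p∣ (p - q)) d) q<0))

        P-limit : (λ n → P c (los n)) ~ (λ _ → 0ℚ)
        P-limit .close ε 0<ε = let N , p = P-uniform ε 0<ε c
                                   M , q = P-uniform β 0<β c
          in N ℕ.⊔ M , λ m _ m≥ _ →
            subst (_< ε) (≡.sym (≡.trans (cong ∣_∣ (+-identityʳ (P c (los m)))) (0≤p⇒∣p∣≡p (good (bracket m) c ℕ.≤-refl))))
              (helper m (λ k k≤c → p k m k≤c (ℕ.m⊔n≤o⇒m≤o N M m≥)) (λ k k≤c → q k m k≤c (ℕ.m⊔n≤o⇒n≤o N M m≥)) (bad (bracket m)))
          where
          helper : ∀ m → (∀ k → k ℕ.≤ c → ∣ P k (los m) - P k (his m) ∣ < ε) →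
                   (∀ k → k ℕ.≤ c → ∣ P k (los m) - P k (his m) ∣ < β) → Bad c (his m) → P c (los m) < ε
          helper m p q (zero  , k≤c , P<0) = contradiction P<0 (<-irrefl refl)
          helper m p q (suc k , k≤c , P<0) with ℕ.m≤n⇒m<n∨m≡n k≤c
          ... | inj₁ k<c  = contradiction (<-≤-trans (lo<hi+ε (q (suc k) k≤c) P<0) (los-bound (suc k) (ℕ.s≤s ℕ.z≤n) k<c m)) (<-irrefl refl)
          ... | inj₂ refl = lo<hi+ε (p (suc k) k≤c) P<0

      s : ℝ
      s = mkℝ los los~los

      z z̄ : ℂ
      z = mkℂ (fromℚ 1ℚ) s
      z̄ = mkℂ (fromℚ 1ℚ) (-ᴿ s)

      abstract
        z^-seq : ∀ k n → seq (re (z ℂᴿ.^ k)) n ≡ Q k (los n) × seq (im (z ℂᴿ.^ k)) n ≡ P k (los n)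
        z^-seq zero    n = refl , refl
        z^-seq (suc k) n = let q , p = z^-seq k n in
            cong₂ (λ q p → 1ℚ * q + - (los n * p)) q p
          , cong₂ (λ q p → 1ℚ * p + los n * q) q p

        z̄^-seq : ∀ k n → seq (re (z̄ ℂᴿ.^ k)) n ≡ Q k (los n) × seq (im (z̄ ℂᴿ.^ k)) n ≡ - P k (los n)
        z̄^-seq zero    n = refl , refl
        z̄^-seq (suc k) n = let q , p = z̄^-seq k n in
            ≡.trans (cong₂ (λ q p → 1ℚ * q + - ((- los n) * p)) q p) (eq₁ (los n) (Q k (los n)) (P k (los n)))
          , ≡.trans (cong₂ (λ q p → 1ℚ * p + (- los n) * q) q p) (eq₂ (los n) (Q k (los n)) (P k (los n)))
          where
          open +-*-Solver
          eq₁ : ∀ s q p → 1ℚ * q + - ((- s) * (- p)) ≡ 1ℚ * q + - (s * p)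
          eq₁ = solve 3 (λ s q p → con 1ℚ :* q :+ :- ((:- s) :* (:- p)) := con 1ℚ :* q :+ :- (s :* p)) refl
          eq₂ : ∀ s q p → 1ℚ * (- p) + (- s) * q ≡ - (1ℚ * p + s * q)
          eq₂ = solve 3 (λ s q p → con 1ℚ :* (:- p) :+ (:- s) :* q := :- (con 1ℚ :* p :+ s :* q)) refl

        ~-respˡ : ∀ {x y z} → x ~ y → (∀ n → x n ≡ z n) → z ~ y
        ~-respˡ p q = ~-sym (~-resp (~-sym p) q)

        z^c≈z̄^c : z ℂᴿ.^ c ℂᴿ.≈ z̄ ℂᴿ.^ c
        z^c≈z̄^c = mk≈
          (~-resp (cauchy (re (z ℂᴿ.^ c))) (λ n → ≡.trans (proj₁ (z^-seq c n)) (≡.sym (proj₁ (z̄^-seq c n)))))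
          (~-trans (~-respˡ P-limit (λ n → ≡.sym (proj₂ (z^-seq c n))))
            (~-resp (~-sym (~-neg P-limit)) (λ n → ≡.sym (proj₂ (z̄^-seq c n)))))

        z̄-invertible : ℂᴿ.Invertible z̄
        z̄-invertible = ℂ-invertible z̄ 0<1 (0 , λ n _ → ≤-+ˡ ≤-refl (square-nonNeg (- los n)))

        difference : ∀ k → 0 ℕ.< k → k ℕ.< c → ℂᴿ.Invertible (z ℂᴿ.^ k ℂᴿ.- z̄ ℂᴿ.^ k)
        difference k 0<k k<c = ℂ-invertible (z ℂᴿ.^ k ℂᴿ.- z̄ ℂᴿ.^ k) (*-pos 0<β 0<β) (0 , λ n _ →
          ≤-+ʳ (≤-square (<⇒≤ 0<β) (subst (β ≤_) (≡.sym (≡.trans (cong₂ (λ x y → x + - y) (proj₂ (z^-seq k n)) (proj₂ (z̄^-seq k n)))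
                                                     (double (P k (los n)))))
                             (≤-+ˡ (los-bound k 0<k k<c n) (≤-trans (<⇒≤ 0<β) (los-bound k 0<k k<c n)))))
               (square-nonNeg (seq (re (z ℂᴿ.^ k ℂᴿ.- z̄ ℂᴿ.^ k)) n)))
          where
          open +-*-Solver
          double : ∀ p → p + - - p ≡ p + p
          double = solve 1 (λ p → p :+ :- :- p := p :+ p) refl

      -- (1 + i s) / (1 - i s) is a primitive c-th root of unity.
      u : ℂ
      u = z ℂᴿ.* ℂᴿ.inverse z̄-invertible

      abstract
        u^ : ∀ k → u ℂᴿ.^ k ℂᴿ.* z̄ ℂᴿ.^ k ℂᴿ.≈ z ℂᴿ.^ k
        u^ k = begin
          u ℂᴿ.^ k ℂᴿ.* z̄ ℂᴿ.^ k               ≈⟨ ℂᴿ.^-distrib-* u z̄ k ⟨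
          (u ℂᴿ.* z̄) ℂᴿ.^ k                    ≈⟨ ℂᴿ.^-congˡ k (ℂᴿ.*-assoc z z̄⁻¹ z̄) ⟩
          (z ℂᴿ.* (z̄⁻¹ ℂᴿ.* z̄)) ℂᴿ.^ k         ≈⟨ ℂᴿ.^-congˡ k (ℂᴿ.*-congˡ {z} (ℂᴿ.trans (ℂᴿ.*-comm z̄⁻¹ z̄) (proj₂ z̄-invertible))) ⟩
          (z ℂᴿ.* 1ᶜ) ℂᴿ.^ k                   ≈⟨ ℂᴿ.^-congˡ k (ℂᴿ.*-identityʳ z) ⟩
          z ℂᴿ.^ k                             ∎
          where
          open Relation.Binary.Reasoning.Setoid ℂᴿ.setoid
          z̄⁻¹ : ℂ
          z̄⁻¹ = ℂᴿ.inverse z̄-invertible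

        u^-1 : ∀ k → (u ℂᴿ.^ k ℂᴿ.- 1ᶜ) ℂᴿ.* z̄ ℂᴿ.^ k ℂᴿ.≈ z ℂᴿ.^ k ℂᴿ.- z̄ ℂᴿ.^ k
        u^-1 k = ℂᴿ.trans (ℂᴿ.sub-1-* (u ℂᴿ.^ k) (z̄ ℂᴿ.^ k)) (ℂᴿ.+-congʳ (u^ k))

        u-primitive : ∀ k → 0 ℕ.< k → k ℕ.< c → ℂᴿ.Invertible (u ℂᴿ.^ k ℂᴿ.- 1ᶜ)
        u-primitive k 0<k k<c = ℂᴿ.invertible-factor (u^-1 k) (difference k 0<k k<c)

        u^c≈1 : u ℂᴿ.^ c ℂᴿ.≈ 1ᶜ
        u^c≈1 = ℂᴿ.x∙y⁻¹≈ε⇒x≈y (u ℂᴿ.^ c) 1ᶜ (ℂᴿ.invertible-cancel (ℂᴿ.invertible-^ c z̄-invertible)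
          (ℂᴿ.trans (ℂᴿ.*-comm (z̄ ℂᴿ.^ c) (u ℂᴿ.^ c ℂᴿ.- 1ᶜ))
            (ℂᴿ.trans (u^-1 c) (ℂᴿ.x≈y⇒x∙y⁻¹≈ε z^c≈z̄^c))))

    abstract
      -- The cube of a primitive 3 c-th root of unity.
      primitiveRoot : ∀ c → .{{_ : ℕ.NonZero c}} →
        ∃[ ζ ] ζ ℂᴿ.^ c ℂᴿ.≈ 1ᶜ × (∀ k → 0 ℕ.< k → k ℕ.< c → ℂᴿ.Invertible (ζ ℂᴿ.^ k ℂᴿ.- 1ᶜ))
      primitiveRoot c@(suc _) = u ℂᴿ.^ 3
        , ℂᴿ.trans (ℂᴿ.^-assocʳ u 3 c) u^c≈1
        , λ k 0<k k<c → ℂᴿ.invertible-resp (ℂᴿ.+-congʳ (ℂᴿ.sym (ℂᴿ.^-assocʳ u 3 k)))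
            (u-primitive (3 ℕ.* k) (ℕ.*-monoʳ-< 3 0<k) (ℕ.*-monoʳ-< 3 k<c))
        where open PrimitiveRootOfUnity (3 ℕ.* c) (ℕ.*-monoʳ-≤ 3 {1} {c} (ℕ.s≤s ℕ.z≤n))

  open PrimitiveRoots public

open ComplexNumbers public
  using (ℝ; mkℝ; seq; cauchy; ℂ; mkℂ; re; im; _≈ᶜ_; _+ᶜ_; _*ᶜ_; -ᶜ_; 0ᶜ; 1ᶜ; fromℚ; ℂ-commutativeRing; module ℂᴿ)

module ℂ[[X]] where
  open PowerSeries ℂ-commutativeRing public
  open CommutativeRing commutativeRing public using (_-_; 1#)
  open InvertibleElements commutativeRing public using (Invertible; _^ℤ_; product; _^_)

-- The function whose residue is taken is rational, so its Laurent expansion at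
-- z = 1 is a quotient of power series in X, where z = 1 + X.
module _ (t : ℤ) {n : ℕ} (a : Vector ℕ n) (a≢0 : ∀ i → ℕ.NonZero (a i)) where
  open ℂ[[X]]

  expansionAt1 : LaurentExpansion ((1+X , invertible-1+X) ^ℤ (t ℤ.- ℤ.1ℤ)) (product (λ i → 1+X ^ a i - 1#))
  expansionAt1 = laurentExpansion a (λ i → ComplexNumbers.natural-invertible (a i) {{a≢0 i}})
                   ((1+X , invertible-1+X) ^ℤ (t ℤ.- ℤ.1ℤ))

  R′ : ℂ
  R′ = residue expansionAt1

open ℂᴿ using (_≈_; _+_; _*_; _-_; 1#; _^_; _^ℤ_; sum; product; Invertible; inverse)

-- The apartness ∣ x - y ∣ > 0, which is stronger than ¬ x ≈ y.
infix 4 _#_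

_#_ : ℂ → ℂ → Set
x # y = Invertible (x - y)

#⇒≉ : ∀ {x y} → x # y → ¬ x ≈ y
#⇒≉ {x} {y} (d , p) x≈y = ComplexNumbers.1≉0 (ℂᴿ.trans (ℂᴿ.sym p)
  (ℂᴿ.trans (ℂᴿ.*-congʳ {d} (ℂᴿ.x≈y⇒x∙y⁻¹≈ε x≈y)) (ℂᴿ.zeroˡ d)))

-- The solutions of x ^ c = 1, x ≠ 1 in ℂ, each listed once.
record NontrivialRootsOfUnity (c : ℕ) : Set where
  field
    size     : ℕ
    root     : Fin size → ℂ
    root^c≈1 : ∀ i → root i ^ c ≈ 1#
    root#1   : ∀ i → root i # 1#
    distinct : ∀ {i j} → i ≢ j → root i # root j
    complete : ∀ x → x ^ c ≈ 1# → ¬ x ≈ 1# → ∃[ i ] x ≈ root i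

nontrivialRootsOfUnity : ∀ c .{{_ : ℕ.NonZero c}} → NontrivialRootsOfUnity c
nontrivialRootsOfUnity (suc n) = record
  { size     = n
  ; root     = λ i → ζ ^ suc (toℕ i)
  ; root^c≈1 = λ i → ℂᴿ.root-power ζ (suc n) (suc (toℕ i)) ζ^c≈1
  ; root#1   = λ i → isPrimitive (suc (toℕ i)) ℕ.z<s (ℕ.s<s (Fin.toℕ<n i))
  ; distinct = λ {i} {j} i≢j → powers-# (ℕ.s<s (Fin.toℕ<n i)) (ℕ.s<s (Fin.toℕ<n j))
                 (λ eq → i≢j (Fin.toℕ-injective (ℕ.suc-injective eq)))
  ; complete = λ x x^c≈1 x≉1 → nontrivial x≉1 (complete x x^c≈1)
  }
  where
  ζ : ℂ
  ζ = proj₁ (ComplexNumbers.primitiveRoot (suc n))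

  ζ^c≈1 : ζ ^ suc n ≈ 1#
  ζ^c≈1 = proj₁ (proj₂ (ComplexNumbers.primitiveRoot (suc n)))

  isPrimitive : ∀ k → 0 ℕ.< k → k ℕ.< suc n → ζ ^ k # 1#
  isPrimitive = proj₂ (proj₂ (ComplexNumbers.primitiveRoot (suc n)))

  open ℂᴿ.PrimitiveRoot ComplexNumbers.ℂ-local n ζ (ComplexNumbers.natural-invertible (suc n)) ζ^c≈1 isPrimitive

  nontrivial : ∀ {x} → ¬ x ≈ 1# → ∃[ k ] x ≈ ζ ^ toℕ {suc n} k → ∃[ i ] x ≈ ζ ^ suc (toℕ {n} i)
  nontrivial x≉1 (zero  , x≈1) = contradiction x≈1 x≉1
  nontrivial x≉1 (suc i , x≈ζ) = i , x≈ζ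

module FourierDedekind (c : ℕ) .{{_ : ℕ.NonZero c}} where
  open NontrivialRootsOfUnity (nontrivialRootsOfUnity c) public

  root± : Fin size → ∃ Invertible
  root± k = root k , ℂᴿ.root-invertible (root k) c (root^c≈1 k)

  -- Coprimality makes the denominators invertible.
  denominator# : ∀ {m} (cs : Vector ℤ m) → (∀ i → ℤ.Coprime (cs i) (+ c)) →
                 ∀ k → Invertible (product (λ i → root± k ^ℤ cs i - 1#))
  denominator# cs coprime k = ℂᴿ.invertible-product (λ i → root± k ^ℤ cs i - 1#)
    (λ i → ℂᴿ.root-coprimeℤ (root± k) c (cs i) (root^c≈1 k) (root#1 k) (coprime i))

σ : (t : ℤ) {m : ℕ} (cs : Vector ℤ m) (c : ℕ) .{{_ : ℕ.NonZero c}} →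
    (∀ i → ℤ.Coprime (cs i) (+ c)) → ℂ
σ t cs c coprime = mkℂ (fromℚ (+ 1 ℚ./ c)) (fromℚ ℚ.0ℚ)
                 * sum (λ k → root± k ^ℤ t * inverse (denominator# cs coprime k))
  where open FourierDedekind c

{-# OPTIONS --safe #-}

-- Write z ^ aⱼ - 1 = (z - 1) Hⱼ(z).  Orthogonality of the roots λ of z ^ aⱼ = 1 gives the simple
-- fractions 1 / Hⱼ(z) = qⱼ + ∑ wⱼ(λ) / (z - λ), λ ≠ 1, with wⱼ(λ) = λ (λ - 1) / aⱼ, and multiplying
-- them out by 1 / ((z - λ) (z - μ)) = (1 / (z - λ) - 1 / (z - μ)) / (λ - μ) yields
-- 1 / ∏ Hⱼ(z) = q + ∑ⱼ ∑ W(λ) / (z - λ) with W(λ) = wⱼ(λ) / ∏ᵢ≠ⱼ Hᵢ(λ).  Expanded at z = ∞, the left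
-- side vanishes to order M = ∑ (aⱼ - 1), so ∑ W(λ) λˢ = 0 for s < M - 1.  Hence zˢ / ∏ Hⱼ(z) is
-- a polynomial of degree at most s - M plus ∑ W(λ) λˢ / (z - λ), and for s = t - 1 < M + n - 1 only
-- the latter contributes to the coefficient of (z - 1)ⁿ⁻¹.  That coefficient is R′, and
-- the contribution of λ is -λᵗ / (aⱼ ∏ᵢ≠ⱼ (λ ^ aᵢ - 1)).

module Submission where

open import Algebra.Bundles using (CommutativeRing)
open import Algebra.Morphism.Structures using (IsRingHomomorphism)
open import Defs
open import Data.Fin.Base using (Fin; zero; suc; punchIn; toℕ)
import Data.Fin.Properties as Fin
open import Data.Fin.Properties using (punchInᵢ≢i)
open import Data.Integer.Base as ℤ using (ℤ; +_; 0ℤ; _<_; +<+)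
import Data.Integer.Properties as ℤ
open import Data.Nat.Base as ℕ using (ℕ; zero; suc; NonZero)
open import Data.Nat.Coprimality using (Coprime)
import Data.Nat.Properties as ℕ
open import Data.Product.Base using (∃-syntax; _,_; proj₁; proj₂)
open import Data.Rational.Base as ℚ using (ℚ; 0ℚ; 1ℚ)
import Data.Rational.Properties as ℚ
open import Data.Rational.Unnormalised.Base as ℚᵘ using (mkℚᵘ; *≡*)
import Data.Rational.Unnormalised.Properties as ℚᵘ
open import Data.Vec.Functional using (Vector; foldr; removeAt)
open import Function.Base using (_∘_)
import Level
open import Relation.Binary.PropositionalEquality as ≡ using (_≡_; _≢_)
open import Relation.Nullary using (Dec; yes; no; contradiction)
import Algebra.Properties.CommutativeMonoid.Sum
import Algebra.Properties.CommutativeSemiring.Exp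
import Algebra.Properties.Ring
import Algebra.Properties.Semiring.Sum
import Algebra.Solver.Ring.NaturalCoefficients.Default
import Relation.Binary.Reasoning.Setoid

-- By coprimality the factors z ^ aⱼ - 1 have only the root 1 in common. Splitting off z - 1
-- therefore leaves a product with simple zeros, and the multiple pole at 1 is left to an expansion
-- in X = z - 1. Inverses are explicit data, so the argument is algebraic throughout: in an
-- arbitrary commutative ring 1 / (z - λ) is an element r with z r = 1 + λ r, and neither rational
-- functions nor contours appear. The same decomposition is needed at z = 1 + X and at z = ∞, where
-- z = 1 / X is not a power series. For this reason z is a ratio x / y and all identities are
-- homogeneous in x and y: (1 + X, 1) gives the expansion at 1, (1, X) the one at ∞, and (λ, 1) the
-- values at a root λ. The lower bound on t makes z ^ (t - 1) a polynomial, so that 0 is not a pole;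
-- the upper bound plays the part of a vanishing residue at ∞.

module PartialFractions {c ℓ} (R : CommutativeRing c ℓ) where

  open CommutativeRing R hiding (zero)
  open InvertibleElements R
  open Algebra.Properties.Ring ring using (+-cancelʳ; [y-z]x≈yx-zx)
  open Algebra.Properties.CommutativeSemiring.Exp commutativeSemiring using (^-homo-*; ^-distrib-*)
  open Algebra.Properties.Semiring.Sum semiring
    using (sum; sum-cong-≋; *-distribˡ-sum; *-distribʳ-sum; ∑-comm; ∑-distrib-+; sum-replicate-zero)
  open Algebra.Properties.CommutativeMonoid.Sum *-commutativeMonoid
    using () renaming (sum-cong-≋ to product-cong; ∑-distrib-+ to product-distrib-*; sum-replicate to product-replicate)
  open Algebra.Solver.Ring.NaturalCoefficients.Default commutativeSemiring
    using (solve; _:+_; _:*_; _:=_)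
  open Relation.Binary.Reasoning.Setoid setoid

  -- Partial fractions of a product of blocks with simple poles

  divide : ∀ {x y z} (p : Invertible x) → x * y ≈ z → y ≈ z * inverse p
  divide {x} {y} {z} (x⁻¹ , p) xy≈z = begin
    y                ≈⟨ *-identityʳ y ⟨
    y * 1#           ≈⟨ *-congˡ p ⟨
    y * (x * x⁻¹)    ≈⟨ solve 3 (λ x y i → y :* (x :* i) := x :* y :* i) refl x y x⁻¹ ⟩
    x * y * x⁻¹      ≈⟨ *-congʳ xy≈z ⟩
    z * x⁻¹          ∎

  Family : ∀ {n} → (Fin n → ℕ) → Set c
  Family m = ∀ j → Fin (m j) → Carrier

  sum₂ : ∀ {n} {m : Fin n → ℕ} → Family m → Carrier
  sum₂ f = sum (λ j → sum (f j))

  sum₂-cong : ∀ {n} {m : Fin n → ℕ} {f g : Family m} → (∀ j k → f j k ≈ g j k) → sum₂ f ≈ sum₂ g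
  sum₂-cong p = sum-cong-≋ (λ j → sum-cong-≋ (p j))

  sum₂-zero : ∀ {n} {m : Fin n → ℕ} {f : Family m} → (∀ j k → f j k ≈ 0#) → sum₂ f ≈ 0#
  sum₂-zero {n} {m} p = trans (sum-cong-≋ (λ j → trans (sum-cong-≋ (p j)) (sum-replicate-zero (m j)))) (sum-replicate-zero n)

  *-distribˡ-sum₂ : ∀ {n} {m : Fin n → ℕ} x (f : Family m) → x * sum₂ f ≈ sum₂ (λ j k → x * f j k)
  *-distribˡ-sum₂ x f = trans (*-distribˡ-sum x (λ j → sum (f j))) (sum-cong-≋ (λ j → *-distribˡ-sum x (f j)))

  sum₂-+ : ∀ {n} {m : Fin n → ℕ} (f g : Family m) → sum₂ (λ j k → f j k + g j k) ≈ sum₂ f + sum₂ g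
  sum₂-+ f g = trans (sum-cong-≋ (λ j → ∑-distrib-+ (f j) (g j))) (∑-distrib-+ (λ j → sum (f j)) (λ j → sum (g j)))

  sum-sum₂-comm : ∀ {l n} {m : Fin n → ℕ} (f : Fin l → Family m) →
                  sum₂ (λ j k → sum (λ i → f i j k)) ≈ sum (λ i → sum₂ (f i))
  sum-sum₂-comm {l} {n} {m} f = trans
    (sum-cong-≋ (λ j → ∑-comm {m j} {l} (λ k i → f i j k)))
    (∑-comm {n} {l} (λ j i → sum (f i j)))

  -- With κ i k = 1 / (z - λ i k) and δ i k j l = 1 / (λ i k - λ j l), this is the
  -- partial fraction decomposition of κ i k * κ j l.
  ArnoldRelation : ∀ {n} {m : Fin n → ℕ} → (∀ i → Fin (m i) → Family m) → ∀ i j → Family m → Set ℓ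
  ArnoldRelation δ i j κ = ∀ k l → κ i k * κ j l ≈ δ i k j l * κ i k + δ j l i k * κ j l

  -- One factor of the product, as a function of its poles. The argument `κ` plays the part of the
  -- point z: evaluation at the root λ j k is the substitution of `δ j k` for `κ`.
  block : ∀ {n} {m : Fin n → ℕ} → (Fin n → Carrier) → Family m → Family m → Fin n → Carrier
  block q w κ j = q j + sum (λ k → w j k * κ j k)

  cofactor : ∀ {n} {m : Fin (suc n) → ℕ} → (Fin (suc n) → Carrier) → Family m →
             (∀ j → Fin (m j) → Family m) → Family m
  cofactor q w δ j k = product (λ i → block q w (δ j k) (punchIn j i))

  -- In κ k * κ′ the coefficient `d k` of κ′ is κ k evaluated at the pole of κ′. Summation over k
  -- thus leaves, at that pole, the value of the whole block.
  block-pole : ∀ {m} q (w κ δ d : Fin m → Carrier) κ′ →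
    (∀ k → κ k * κ′ ≈ δ k * κ k + d k * κ′) →
    (q + sum (λ k → w k * κ k)) * κ′ ≈
      (q + sum (λ k → w k * d k)) * κ′ + sum (λ k → w k * κ k * δ k)
  block-pole q w κ δ d κ′ p = begin
    (q + sum (λ k → w k * κ k)) * κ′
      ≈⟨ distribʳ κ′ q _ ⟩
    q * κ′ + sum (λ k → w k * κ k) * κ′
      ≈⟨ +-congˡ (*-distribʳ-sum κ′ (λ k → w k * κ k)) ⟩
    q * κ′ + sum (λ k → w k * κ k * κ′)
      ≈⟨ +-congˡ (sum-cong-≋ (λ k → trans (*-assoc _ _ _) (trans (*-congˡ (p k))
           (solve 5 (λ w δ κ d κ′ → w :* (δ :* κ :+ d :* κ′) := w :* d :* κ′ :+ w :* κ :* δ) refl (w k) (δ k) (κ k) (d k) κ′)))) ⟩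
    q * κ′ + sum (λ k → w k * d k * κ′ + w k * κ k * δ k)
      ≈⟨ +-congˡ (∑-distrib-+ (λ k → w k * d k * κ′) (λ k → w k * κ k * δ k)) ⟩
    q * κ′ + (sum (λ k → w k * d k * κ′) + sum (λ k → w k * κ k * δ k))
      ≈⟨ +-assoc _ _ _ ⟨
    q * κ′ + sum (λ k → w k * d k * κ′) + sum (λ k → w k * κ k * δ k)
      ≈⟨ +-congʳ (+-congˡ (*-distribʳ-sum κ′ (λ k → w k * d k))) ⟨
    q * κ′ + sum (λ k → w k * d k) * κ′ + sum (λ k → w k * κ k * δ k)
      ≈⟨ +-congʳ (distribʳ κ′ q _) ⟨
    (q + sum (λ k → w k * d k)) * κ′ + sum (λ k → w k * κ k * δ k)
      ∎

  -- Induction on the number of blocks. Multiplying the expansion of the tail by the head block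
  -- splits each product of two poles: the part at a tail pole completes its cofactor, while the
  -- parts at a head pole add up to the tail expansion evaluated there, which the induction
  -- hypothesis turns back into a product. This second use is why the relation is also demanded of
  -- the families `δ h k`.
  partialFractions : ∀ {n} {m : Fin (suc n) → ℕ} (q : Fin (suc n) → Carrier) (w : Family m)
    (δ : ∀ j → Fin (m j) → Family m) →
    (∀ h k i j → h ≢ i → h ≢ j → i ≢ j → ArnoldRelation δ i j (δ h k)) →
    ∀ κ → (∀ i j → i ≢ j → ArnoldRelation δ i j κ) →
    product (block q w κ) ≈ product q + sum₂ (λ j k → w j k * cofactor q w δ j k * κ j k)
  partialFractions {zero} {m} q w δ _ κ _ = begin
    (q zero + sum (λ k → w zero k * κ zero k)) * 1#
      ≈⟨ *-identityʳ _ ⟩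
    q zero + sum (λ k → w zero k * κ zero k)
      ≈⟨ +-cong (*-identityʳ _) (trans (+-identityʳ _) (sum-cong-≋ {m zero} (λ k → *-congʳ (*-identityʳ _)))) ⟨
    q zero * 1# + (sum (λ k → w zero k * 1# * κ zero k) + 0#)
      ∎
  partialFractions {suc n} {m} q w δ arnold κ arnold-κ = begin
    u κ * product (block q′ w′ κ′)
      ≈⟨ *-congˡ (tail-fractions κ′ (λ i j i≢j → arnold-κ (suc i) (suc j) (i≢j ∘ Fin.suc-injective))) ⟩
    u κ * (Q + sum₂ (λ j k → W j k * κ′ j k))
      ≈⟨ distribˡ (u κ) Q _ ⟩
    u κ * Q + u κ * sum₂ (λ j k → W j k * κ′ j k)
      ≈⟨ +-congˡ (*-distribˡ-sum₂ (u κ) (λ j k → W j k * κ′ j k)) ⟩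
    u κ * Q + sum₂ (λ j k → u κ * (W j k * κ′ j k))
      ≈⟨ +-congˡ (sum₂-cong (λ j k → pole j k)) ⟩
    u κ * Q + sum₂ (λ j k → new j k + sum (λ i → w₀κ₀ i * (W j k * δ zero i (suc j) k)))
      ≈⟨ +-congˡ (sum₂-+ new (λ j k → sum (λ i → w₀κ₀ i * (W j k * δ zero i (suc j) k)))) ⟩
    u κ * Q + (sum₂ new + sum₂ (λ j k → sum (λ i → w₀κ₀ i * (W j k * δ zero i (suc j) k))))
      ≈⟨ +-congˡ (+-congˡ (sum-sum₂-comm (λ i j k → w₀κ₀ i * (W j k * δ zero i (suc j) k)))) ⟩
    u κ * Q + (sum₂ new + sum (λ i → sum₂ (λ j k → w₀κ₀ i * (W j k * δ zero i (suc j) k))))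
      ≈⟨ +-congˡ (+-congˡ (sum-cong-≋ (λ i → *-distribˡ-sum₂ (w₀κ₀ i) (λ j k → W j k * δ zero i (suc j) k)))) ⟨
    u κ * Q + (sum₂ new + sum (λ i → w₀κ₀ i * V i))
      ≈⟨ +-congʳ (trans (distribʳ Q (q zero) _) (+-congˡ (*-distribʳ-sum Q w₀κ₀))) ⟩
    q zero * Q + sum (λ i → w₀κ₀ i * Q) + (sum₂ new + sum (λ i → w₀κ₀ i * V i))
      ≈⟨ solve 4 (λ a b c d → a :+ b :+ (c :+ d) := a :+ ((b :+ d) :+ c)) refl _ _ _ _ ⟩
    q zero * Q + ((sum (λ i → w₀κ₀ i * Q) + sum (λ i → w₀κ₀ i * V i)) + sum₂ new)
      ≈⟨ +-congˡ (+-congʳ (trans (sum-cong-≋ first) (∑-distrib-+ (λ i → w₀κ₀ i * Q) (λ i → w₀κ₀ i * V i)))) ⟨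
    q zero * Q + (sum (λ i → w zero i * cofactor q w δ zero i * κ zero i) + sum₂ new)
      ∎
    where
    m′ : Fin (suc n) → ℕ
    m′ j = m (suc j)

    q′ : Fin (suc n) → Carrier
    q′ j = q (suc j)

    w′ κ′ : Family m′
    w′ j = w (suc j)
    κ′ j = κ (suc j)

    δ′ : ∀ j → Fin (m′ j) → Family m′
    δ′ j k i = δ (suc j) k (suc i)

    Q : Carrier
    Q = product q′

    u : Family m → Carrier
    u κ = block q w κ zero

    W new : Family m′
    W j k   = w′ j k * cofactor q′ w′ δ′ j k
    new j k = w′ j k * (u (δ (suc j) k) * cofactor q′ w′ δ′ j k) * κ′ j k

    w₀κ₀ V : Fin (m zero) → Carrier
    w₀κ₀ i = w zero i * κ zero i
    V i    = sum₂ (λ j k → W j k * δ zero i (suc j) k)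

    tail-fractions : ∀ κ → (∀ i j → i ≢ j → ArnoldRelation δ′ i j κ) →
      product (block q′ w′ κ) ≈ Q + sum₂ (λ j k → W j k * κ j k)
    tail-fractions = partialFractions q′ w′ δ′ (λ h k i j h≢i h≢j i≢j →
      arnold (suc h) k (suc i) (suc j) (h≢i ∘ Fin.suc-injective) (h≢j ∘ Fin.suc-injective) (i≢j ∘ Fin.suc-injective))

    pole : ∀ j k → u κ * (W j k * κ′ j k) ≈ new j k + sum (λ i → w₀κ₀ i * (W j k * δ zero i (suc j) k))
    pole j k = begin
      u κ * (W j k * κ′ j k)
        ≈⟨ solve 3 (λ u W κ → u :* (W :* κ) := W :* (u :* κ)) refl (u κ) (W j k) (κ′ j k) ⟩
      W j k * (u κ * κ′ j k)
        ≈⟨ *-congˡ (block-pole (q zero) (w zero) (κ zero) (λ i → δ zero i (suc j) k) (δ (suc j) k zero) (κ′ j k)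
             (λ i → arnold-κ zero (suc j) (λ ()) i k)) ⟩
      W j k * (u (δ (suc j) k) * κ′ j k + sum (λ i → w₀κ₀ i * δ zero i (suc j) k))
        ≈⟨ distribˡ (W j k) _ _ ⟩
      W j k * (u (δ (suc j) k) * κ′ j k) + W j k * sum (λ i → w₀κ₀ i * δ zero i (suc j) k)
        ≈⟨ +-cong
             (solve 4 (λ w c u κ → w :* c :* (u :* κ) := w :* (u :* c) :* κ) refl (w′ j k) (cofactor q′ w′ δ′ j k) (u (δ (suc j) k)) (κ′ j k))
             (trans (*-distribˡ-sum (W j k) (λ i → w₀κ₀ i * δ zero i (suc j) k))
               (sum-cong-≋ (λ i → solve 3 (λ W a d → W :* (a :* d) := a :* (W :* d)) refl (W j k) (w₀κ₀ i) (δ zero i (suc j) k)))) ⟩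
      new j k + sum (λ i → w₀κ₀ i * (W j k * δ zero i (suc j) k))
        ∎

    first : ∀ i → w zero i * cofactor q w δ zero i * κ zero i ≈ w₀κ₀ i * Q + w₀κ₀ i * V i
    first i = begin
      w zero i * cofactor q w δ zero i * κ zero i
        ≈⟨ *-congʳ (*-congˡ (tail-fractions (λ j → δ zero i (suc j)) (λ a b a≢b →
             arnold zero i (suc a) (suc b) (λ ()) (λ ()) (a≢b ∘ Fin.suc-injective)))) ⟩
      w zero i * (Q + V i) * κ zero i
        ≈⟨ solve 4 (λ w Q V κ → w :* (Q :+ V) :* κ := w :* κ :* Q :+ w :* κ :* V) refl (w zero i) Q (V i) (κ zero i) ⟩
      w₀κ₀ i * Q + w₀κ₀ i * V i
        ∎

  -- With r = 1 / (x - λ y), the element y r is 1 / (z - λ) at z = x / y. The relation between `κ`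
  -- and y r is an equation so that `δ h k` itself can serve as `κ` at the point (λ, 1).
  resolvent-arnold : ∀ {n} {m : Fin n → ℕ} (root : Family m) (δ : ∀ j → Fin (m j) → Family m) i j →
    (∀ k l → root i k * δ i k j l ≈ 1# + root j l * δ i k j l) →
    (∀ k l → root j l * δ j l i k ≈ 1# + root i k * δ j l i k) →
    ∀ x y (r κ : Family m) →
    (∀ k → x * r i k ≈ 1# + root i k * (y * r i k)) →
    (∀ l → x * r j l ≈ 1# + root j l * (y * r j l)) →
    (∀ i k → κ i k ≈ y * r i k) →
    ArnoldRelation δ i j κ
  resolvent-arnold root δ i j δ-inverse δ-inverse′ x y r κ r-inverse r-inverse′ κ≈yr k l =
    -- The extra summand allows 1 + q d to be replaced by p d without subtraction, which the
    -- semiring solver cannot handle.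
    +-cancelʳ (q * d * (a * b)) _ _ (begin
      a * b + q * d * (a * b)
        ≈⟨ trans (+-congʳ (sym (*-identityˡ _))) (sym (distribʳ (a * b) 1# (q * d))) ⟩
      (1# + q * d) * (a * b)
        ≈⟨ *-congʳ (δ-inverse k l) ⟨
      p * d * (a * b)
        ≈⟨ trans (+-congʳ (trans (*-congʳ antisym) (zeroˡ b))) (+-identityˡ _) ⟨
      (d + d′) * b + p * d * (a * b)
        ≈⟨ solve 6 (λ d d′ p q a b → (d :+ d′) :* b :+ p :* d :* (a :* b) := d :* (b :+ p :* (a :* b)) :+ d′ :* b) refl d d′ p q a b ⟩
      d * (b + p * (a * b)) + d′ * b
        ≈⟨ +-congʳ (*-congˡ cross) ⟨
      d * (a + q * (a * b)) + d′ * b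
        ≈⟨ solve 6 (λ d d′ p q a b → d :* (a :+ q :* (a :* b)) :+ d′ :* b := d :* a :+ d′ :* b :+ q :* d :* (a :* b)) refl d d′ p q a b ⟩
      d * a + d′ * b + q * d * (a * b)
        ∎)
    where
    p = root i k
    q = root j l
    a = κ i k
    b = κ j l
    d = δ i k j l
    d′ = δ j l i k

    -- The two inverses are given independently, so d′ = - d has to come from their defining
    -- equations.
    antisym : d + d′ ≈ 0#
    antisym = +-cancelʳ (q * d * d′ + p * d′ * d) _ _ (begin
      d + d′ + (q * d * d′ + p * d′ * d)
        ≈⟨ solve 4 (λ d d′ p q → d :+ d′ :+ (q :* d :* d′ :+ p :* d′ :* d) := (d′ :+ q :* d :* d′) :+ (d :+ p :* d′ :* d)) refl d d′ p q ⟩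
      d′ + q * d * d′ + (d + p * d′ * d)
        ≈⟨ +-cong (unfold d′ (q * d)) (unfold d (p * d′)) ⟨
      (1# + q * d) * d′ + (1# + p * d′) * d
        ≈⟨ +-cong (*-congʳ (δ-inverse k l)) (*-congʳ (δ-inverse′ k l)) ⟨
      p * d * d′ + q * d′ * d
        ≈⟨ solve 4 (λ d d′ p q → p :* d :* d′ :+ q :* d′ :* d := q :* d :* d′ :+ p :* d′ :* d) refl d d′ p q ⟩
      q * d * d′ + p * d′ * d
        ≈⟨ +-identityˡ _ ⟨
      0# + (q * d * d′ + p * d′ * d)
        ∎)
      where
      unfold : ∀ e f → (1# + f) * e ≈ e + f * e
      unfold e f = trans (distribʳ e 1# f) (+-congʳ (*-identityˡ e))

    -- This is a - b = (p - q) a b without subtraction: expanding either resolvent equation in (y r)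
    -- (x r′) gives one of the two sides.
    cross : a + q * (a * b) ≈ b + p * (a * b)
    cross = begin
      a + q * (a * b)
        ≈⟨ +-cong (κ≈yr i k) (*-congˡ (*-cong (κ≈yr i k) (κ≈yr j l))) ⟩
      y * r i k + q * (y * r i k * (y * r j l))
        ≈⟨ solve 4 (λ y s t q → y :* s :+ q :* (y :* s :* (y :* t)) := y :* s :+ y :* s :* (q :* (y :* t))) refl y (r i k) (r j l) q ⟩
      y * r i k + y * r i k * (q * (y * r j l))
        ≈⟨ trans (+-congʳ (sym (*-identityʳ _))) (sym (distribˡ (y * r i k) 1# _)) ⟩
      y * r i k * (1# + q * (y * r j l))
        ≈⟨ *-congˡ (r-inverse′ l) ⟨
      y * r i k * (x * r j l)
        ≈⟨ solve 4 (λ y s t x → y :* s :* (x :* t) := y :* t :* (x :* s)) refl y (r i k) (r j l) x ⟩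
      y * r j l * (x * r i k)
        ≈⟨ *-congˡ (r-inverse k) ⟩
      y * r j l * (1# + p * (y * r i k))
        ≈⟨ trans (distribˡ (y * r j l) 1# _) (+-congʳ (*-identityʳ _)) ⟩
      y * r j l + y * r j l * (p * (y * r i k))
        ≈⟨ solve 4 (λ y s t p → y :* t :+ y :* t :* (p :* (y :* s)) := y :* t :+ p :* (y :* s :* (y :* t))) refl y (r i k) (r j l) p ⟩
      y * r j l + p * (y * r i k * (y * r j l))
        ≈⟨ +-cong (κ≈yr j l) (*-congˡ (*-cong (κ≈yr i k) (κ≈yr j l))) ⟨
      b + p * (a * b)
        ∎

  -- Homogeneous geometric sums and the separation of roots

  -- The sum of x ^ i * y ^ (n - i), that is (x ^ (n + 1) - y ^ (n + 1)) / (x - y). With n = aⱼ - 1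
  -- it is Hⱼ(z) at (z, 1), and X ^ n * Hⱼ(1 / X) at (1, X).
  homogeneous : ℕ → Carrier → Carrier → Carrier
  homogeneous zero    x y = 1#
  homogeneous (suc n) x y = x * homogeneous n x y + y ^ suc n

  homogeneous-* : ∀ n x y → x * homogeneous n x y + y ^ suc n ≈ x ^ suc n + y * homogeneous n x y
  homogeneous-* zero    x y = refl
  homogeneous-* (suc n) x y = begin
    x * (x * homogeneous n x y + y ^ suc n) + y * y ^ suc n
      ≈⟨ +-congʳ (*-congˡ (homogeneous-* n x y)) ⟩
    x * (x ^ suc n + y * homogeneous n x y) + y * y ^ suc n
      ≈⟨ solve 5 (λ x y a h b → x :* (a :+ y :* h) :+ y :* b := x :* a :+ y :* (x :* h :+ b)) refl x y (x ^ suc n) (homogeneous n x y) (y ^ suc n) ⟩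
    x * x ^ suc n + y * (x * homogeneous n x y + y ^ suc n)
      ∎

  homogeneous-sub : ∀ n x y → x ^ suc n - y ^ suc n ≈ (x - y) * homogeneous n x y
  homogeneous-sub n x y = trans (move (x ^ suc n) (y ^ suc n) (x * h) (y * h) (sym (homogeneous-* n x y))) (sym ([y-z]x≈yx-zx h x y))
    where
    h = homogeneous n x y

    move : ∀ a b c d → a + d ≈ c + b → a - b ≈ c - d
    move a b c d p = +-cancelʳ (d + b) _ _ (begin
      (a - b) + (d + b)      ≈⟨ solve 4 (λ a nb d b → a :+ nb :+ (d :+ b) := (a :+ d) :+ (b :+ nb)) refl a (- b) d b ⟩
      (a + d) + (b - b)      ≈⟨ +-cong p (trans (-‿inverseʳ b) (sym (-‿inverseʳ d))) ⟩
      (c + b) + (d - d)      ≈⟨ solve 4 (λ c b d nd → c :+ b :+ (d :+ nd) := (c :+ nd) :+ (d :+ b)) refl c b d (- d) ⟩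
      (c - d) + (d + b)      ∎)

  homogeneous-1 : ∀ n x → x ^ suc n - 1# ≈ (x - 1#) * homogeneous n x 1#
  homogeneous-1 n x = trans (+-congˡ (-‿cong (sym (1^ (suc n))))) (homogeneous-sub n x 1#)

  -- The difference x - y divides x ^ d - y ^ d, which equals x ^ d - 1.
  roots-apart : ∀ {x y} d .{{_ : ℕ.NonZero d}} → Invertible (x ^ d - 1#) → y ^ d ≈ 1# → Invertible (x - y)
  roots-apart {x} {y} (suc d) p y^d≈1 = invertible-factor
    (trans (sym (homogeneous-sub d x y)) (+-congˡ (-‿cong y^d≈1))) p

  inverse-sub : ∀ {x y d} → (x - y) * d ≈ 1# → x * d ≈ 1# + y * d
  inverse-sub {x} {y} {d} p = begin
    x * d                      ≈⟨ trans (+-congˡ (-‿inverseˡ (y * d))) (+-identityʳ _) ⟨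
    x * d + (- (y * d) + y * d)  ≈⟨ +-assoc _ _ _ ⟨
    x * d - y * d + y * d      ≈⟨ +-congʳ (trans (sym ([y-z]x≈yx-zx d x y)) p) ⟩
    1# + y * d                 ∎

  separation : ∀ {n} {m : Fin n → ℕ} (root : Family m) →
    (∀ i j → i ≢ j → ∀ k l → Invertible (root i k - root j l)) →
    ∃[ δ ] ∀ i j → i ≢ j → ∀ k l → root i k * δ i k j l ≈ 1# + root j l * δ i k j l
  separation {n} {m} root apart = (λ i k j l → choice i j k l (i Fin.≟ j)) , λ i j i≢j k l → choice-inverse i j k l (i Fin.≟ j) i≢j
    where
    choice : ∀ i j → Fin (m i) → Fin (m j) → Dec (i ≡ j) → Carrier
    -- Default for two roots of one block; a cofactor pairs a root only with the roots of other
    -- blocks.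
    choice i j k l (yes _)  = 0#
    choice i j k l (no i≢j) = inverse (apart i j i≢j k l)

    choice-inverse : ∀ i j k l d → i ≢ j → root i k * choice i j k l d ≈ 1# + root j l * choice i j k l d
    choice-inverse i j k l (yes i≡j) i≢j = contradiction i≡j i≢j
    choice-inverse i j k l (no i≢j)  _   = inverse-sub (proj₂ (apart i j i≢j k l))

  -- Partial fractions of a single block

  -- For m > 0 the roots and 1 add up to zero and the term vanishes; for m = 0 it is 1, the whole
  -- block. One formula thus covers aⱼ = 1 without a case distinction.
  constantTerm : ∀ {m} → Carrier → (Fin m → Carrier) → Carrier
  constantTerm α root = α * (1# + sum root)

  -- The residue 1 / H′(λ) of 1 / H at λ, where H = (z ^ (m + 1) - 1) / (z - 1): here H′(λ) = (m +
  -- 1) * λ ^ m / (λ - 1), with λ ^ m = 1 / λ and α = 1 / (m + 1).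
  weight : ∀ {m} → Carrier → (Fin m → Carrier) → Fin m → Carrier
  weight α root k = α * (root k * (root k - 1#))

  -- y ^ m / homogeneous m x y is constantTerm α root + ∑ₖ weight α root k * y / (x - root k * y).
  module RootBlock {m : ℕ} (root : Fin m → Carrier) (α : Carrier)
    (α-inverse : α * sum {suc m} (λ _ → 1#) ≈ 1#)
    (root^m≈1 : ∀ k → root k ^ suc m ≈ 1#)
    (power-sum : ∀ j → 0 ℕ.< j → j ℕ.< suc m → 1# + sum (λ k → root k ^ j) ≈ 0#) where

    module _ (x y : Carrier) where

      private
        -- The sum of λ ^ b * homogeneous n x (λ y) over all (m + 1)-st roots of unity λ; the first
        -- summand belongs to λ = 1.
        total : ℕ → ℕ → Carrier
        total b n = homogeneous n x y + sum (λ k → root k ^ b * homogeneous n x (root k * y))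

        total-zero : ∀ b → total b 0 ≈ 1# + sum (λ k → root k ^ b)
        total-zero b = +-congˡ (sum-cong-≋ (λ k → *-identityʳ (root k ^ b)))

        total-suc : ∀ b n → total b (suc n) ≈ x * total b n + y ^ suc n * (1# + sum (λ k → root k ^ (b ℕ.+ suc n)))
        total-suc b n = begin
          x * h + y ^ suc n + sum (λ k → root k ^ b * (x * hₖ k + (root k * y) ^ suc n))
            ≈⟨ +-congˡ (trans (sum-cong-≋ split) (∑-distrib-+ (λ k → x * (root k ^ b * hₖ k)) (λ k → y ^ suc n * root k ^ (b ℕ.+ suc n)))) ⟩
          x * h + y ^ suc n + (sum (λ k → x * (root k ^ b * hₖ k)) + sum (λ k → y ^ suc n * root k ^ (b ℕ.+ suc n)))
            ≈⟨ +-congˡ (+-cong (*-distribˡ-sum x (λ k → root k ^ b * hₖ k)) (*-distribˡ-sum (y ^ suc n) (λ k → root k ^ (b ℕ.+ suc n)))) ⟨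
          x * h + y ^ suc n + (x * sum (λ k → root k ^ b * hₖ k) + y ^ suc n * sum (λ k → root k ^ (b ℕ.+ suc n)))
            ≈⟨ +-congʳ (+-congˡ (*-identityʳ (y ^ suc n))) ⟨
          x * h + y ^ suc n * 1# + (x * sum (λ k → root k ^ b * hₖ k) + y ^ suc n * sum (λ k → root k ^ (b ℕ.+ suc n)))
            ≈⟨ solve 6 (λ x h b o s t → x :* h :+ b :* o :+ (x :* s :+ b :* t) := x :* (h :+ s) :+ b :* (o :+ t)) refl x h (y ^ suc n) 1# _ _ ⟩
          x * total b n + y ^ suc n * (1# + sum (λ k → root k ^ (b ℕ.+ suc n)))
            ∎
          where
          h = homogeneous n x y

          hₖ : Fin m → Carrier
          hₖ k = homogeneous n x (root k * y)

          split : ∀ k → root k ^ b * (x * hₖ k + (root k * y) ^ suc n) ≈ x * (root k ^ b * hₖ k) + y ^ suc n * root k ^ (b ℕ.+ suc n)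
          split k = begin
            root k ^ b * (x * hₖ k + (root k * y) ^ suc n)
              ≈⟨ *-congˡ (+-congˡ (^-distrib-* (root k) y (suc n))) ⟩
            root k ^ b * (x * hₖ k + root k ^ suc n * y ^ suc n)
              ≈⟨ solve 5 (λ b x h r y → b :* (x :* h :+ r :* y) := x :* (b :* h) :+ y :* (b :* r)) refl _ x (hₖ k) _ _ ⟩
            x * (root k ^ b * hₖ k) + y ^ suc n * (root k ^ b * root k ^ suc n)
              ≈⟨ +-congˡ (*-congˡ (^-homo-* (root k) b (suc n))) ⟨
            x * (root k ^ b * hₖ k) + y ^ suc n * root k ^ (b ℕ.+ suc n)
              ∎

        -- The coefficients with respect to y are the power sums of exponents b to b + n, and all of
        -- these lie strictly between 0 and m + 1.
        total-vanishes : ∀ b n → 0 ℕ.< b → b ℕ.+ n ℕ.< suc m → total b n ≈ 0#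
        total-vanishes b zero 0<b b<m = trans (total-zero b) (power-sum b 0<b (≡.subst (ℕ._< suc m) (ℕ.+-identityʳ b) b<m))
        total-vanishes b (suc n) 0<b b+n<m = begin
          total b (suc n)
            ≈⟨ total-suc b n ⟩
          x * total b n + y ^ suc n * (1# + sum (λ k → root k ^ (b ℕ.+ suc n)))
            ≈⟨ +-cong (*-congˡ (total-vanishes b n 0<b (ℕ.≤-<-trans (ℕ.+-monoʳ-≤ b (ℕ.n≤1+n n)) b+n<m)))
                      (*-congˡ (power-sum (b ℕ.+ suc n) (ℕ.<-≤-trans 0<b (ℕ.m≤m+n b (suc n))) b+n<m)) ⟩
          x * 0# + y ^ suc n * 0#
            ≈⟨ +-cong (zeroʳ x) (zeroʳ _) ⟩
          0# + 0#
            ≈⟨ +-identityʳ 0# ⟩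
          0#
            ∎

        full-power-sum : ∀ n → suc n ≡ suc m → 1# + sum (λ k → root k ^ suc n) ≈ sum {suc m} (λ _ → 1#)
        full-power-sum n ≡.refl = +-congˡ (sum-cong-≋ root^m≈1)

        -- For b = 1 the exponents run from 1 to m + 1, and only the last survives. The variable n
        -- stands for the module parameter m so that it can be split into cases.
        total-full : ∀ n → n ≡ m → total 1 n ≈ y ^ n * sum {suc m} (λ _ → 1#)
        total-full zero    n≡m = trans (total-zero 1) (trans (full-power-sum 0 (≡.cong suc n≡m)) (sym (*-identityˡ _)))
        total-full (suc n) n≡m = begin
          total 1 (suc n)
            ≈⟨ total-suc 1 n ⟩
          x * total 1 n + y ^ suc n * (1# + sum (λ k → root k ^ suc (suc n)))
            ≈⟨ +-cong (trans (*-congˡ (total-vanishes 1 n ℕ.z<s (ℕ.≤-reflexive (≡.cong suc n≡m)))) (zeroʳ x))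
                      (*-congˡ (full-power-sum (suc n) (≡.cong suc n≡m))) ⟩
          0# + y ^ suc n * sum {suc m} (λ _ → 1#)
            ≈⟨ +-identityˡ _ ⟩
          y ^ suc n * sum {suc m} (λ _ → 1#)
            ∎

      module _ (r : Fin m → Carrier) (r-inverse : ∀ k → x * r k ≈ 1# + root k * (y * r k)) where

        private
          h : Carrier
          h = homogeneous m x y

          d : Fin m → Carrier
          d k = root k - 1#

          -- Multiplied by x - λ y, the left side becomes x ^ (m + 1) - y ^ (m + 1) = (x - y) h,
          -- because λ ^ (m + 1) = 1; and (x - y) / (x - λ y) = 1 + (λ - 1) y r.
          other : ∀ k → homogeneous m x (root k * y) ≈ (1# + d k * (y * r k)) * h
          other k = +-cancelʳ (z * (y * r k) * t + y * r k * h) _ _ (begin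
            t + (z * (y * r k) * t + y * r k * h)
              ≈⟨ solve 5 (λ t z y r h → t :+ (z :* (y :* r) :* t :+ y :* r :* h) := t :+ z :* (y :* r) :* t :+ y :* h :* r) refl t z y (r k) h ⟩
            t + z * (y * r k) * t + y * h * r k
              ≈⟨ +-congʳ (trans (+-congʳ (sym (*-identityˡ t))) (trans (sym (distribʳ t _ _)) (*-congʳ (sym (r-inverse k))))) ⟩
            x * r k * t + y * h * r k
              ≈⟨ solve 5 (λ x r t y h → x :* r :* t :+ y :* h :* r := (x :* t :+ y :* h) :* r) refl x (r k) t y h ⟩
            (x * t + y * h) * r k
              ≈⟨ *-congʳ cross ⟩
            (z * y * t + x * h) * r k
              ≈⟨ solve 6 (λ x r t y h z → (z :* y :* t :+ x :* h) :* r := z :* (y :* r) :* t :+ x :* r :* h) refl x (r k) t y h z ⟩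
            z * (y * r k) * t + x * r k * h
              ≈⟨ +-congˡ (*-congʳ (r-inverse k)) ⟩
            z * (y * r k) * t + (1# + z * (y * r k)) * h
              ≈⟨ +-congˡ (*-congʳ (+-congˡ (*-congʳ z≈d+1))) ⟩
            z * (y * r k) * t + (1# + (d k + 1#) * (y * r k)) * h
              ≈⟨ solve 5 (λ a o d κ h → a :+ (o :+ (d :+ o) :* κ) :* h := (o :+ d :* κ) :* h :+ (a :+ o :* κ :* h)) refl _ 1# (d k) (y * r k) h ⟩
            (1# + d k * (y * r k)) * h + (z * (y * r k) * t + 1# * (y * r k) * h)
              ≈⟨ +-congˡ (+-congˡ (*-congʳ (*-identityˡ _))) ⟩
            (1# + d k * (y * r k)) * h + (z * (y * r k) * t + y * r k * h)
              ∎)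
            where
            z = root k
            t = homogeneous m x (z * y)

            z≈d+1 : z ≈ d k + 1#
            z≈d+1 = sym (trans (+-assoc z (- 1#) 1#) (trans (+-congˡ (-‿inverseˡ 1#)) (+-identityʳ z)))

            v^≈y^ : (z * y) ^ suc m ≈ y ^ suc m
            v^≈y^ = trans (^-distrib-* z y (suc m)) (trans (*-congʳ (root^m≈1 k)) (*-identityˡ _))

            cross : x * t + y * h ≈ z * y * t + x * h
            cross = +-cancelʳ (y ^ suc m) _ _ (begin
              x * t + y * h + y ^ suc m             ≈⟨ solve 3 (λ a b c → a :+ b :+ c := (a :+ c) :+ b) refl _ _ _ ⟩
              x * t + y ^ suc m + y * h             ≈⟨ +-congʳ (trans (+-congˡ (sym v^≈y^)) (homogeneous-* m x (z * y))) ⟩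
              x ^ suc m + z * y * t + y * h         ≈⟨ solve 3 (λ a b c → a :+ b :+ c := b :+ (a :+ c)) refl _ _ _ ⟩
              z * y * t + (x ^ suc m + y * h)       ≈⟨ +-congˡ (homogeneous-* m x y) ⟨
              z * y * t + (x * h + y ^ suc m)       ≈⟨ +-assoc _ _ _ ⟨
              z * y * t + x * h + y ^ suc m         ∎)

        -- By `other` the product is α times the sum of λ * homogeneous m x (λ y) over all roots, of
        -- which orthogonality leaves the term y ^ m, taken m + 1 times.
        homogeneous-block : homogeneous m x y * (constantTerm α root + sum (λ k → weight α root k * (y * r k))) ≈ y ^ m
        homogeneous-block = begin
          h * (α * (1# + sum root) + sum (λ k → α * (root k * d k) * (y * r k)))
            ≈⟨ *-congˡ (+-congˡ (trans (sum-cong-≋ {m} (λ k → *-assoc α (root k * d k) (y * r k))) (sym (*-distribˡ-sum α (λ k → root k * d k * (y * r k)))))) ⟩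
          h * (α * (1# + sum root) + α * sum (λ k → root k * d k * (y * r k)))
            ≈⟨ solve 5 (λ h α o s t → h :* (α :* (o :+ s) :+ α :* t) := α :* (o :* h :+ (s :+ t) :* h)) refl h α 1# _ _ ⟩
          α * (1# * h + (sum root + sum (λ k → root k * d k * (y * r k))) * h)
            ≈⟨ *-congˡ (+-cong (*-identityˡ h) (trans (*-congʳ (sym (∑-distrib-+ root (λ k → root k * d k * (y * r k)))))
                 (*-distribʳ-sum h (λ k → root k + root k * d k * (y * r k))))) ⟩
          α * (h + sum (λ k → (root k + root k * d k * (y * r k)) * h))
            ≈⟨ *-congˡ (+-congˡ (sum-cong-≋ term)) ⟩
          α * total 1 m
            ≈⟨ *-congˡ (total-full m ≡.refl) ⟩
          α * (y ^ m * sum {suc m} (λ _ → 1#))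
            ≈⟨ solve 3 (λ a b c → a :* (b :* c) := (a :* c) :* b) refl α _ _ ⟩
          α * sum {suc m} (λ _ → 1#) * y ^ m
            ≈⟨ trans (*-congʳ α-inverse) (*-identityˡ _) ⟩
          y ^ m
            ∎
          where
          term : ∀ k → (root k + root k * d k * (y * r k)) * h ≈ root k ^ 1 * homogeneous m x (root k * y)
          term k = begin
            (root k + root k * d k * (y * r k)) * h
              ≈⟨ *-congʳ (+-cong (sym (*-identityʳ (root k))) (*-assoc _ _ _)) ⟩
            (root k * 1# + root k * (d k * (y * r k))) * h
              ≈⟨ *-congʳ (distribˡ (root k) _ _) ⟨
            root k * (1# + d k * (y * r k)) * h
              ≈⟨ *-assoc _ _ _ ⟩
            root k * ((1# + d k * (y * r k)) * h)
              ≈⟨ *-cong (sym (*-identityʳ (root k))) (sym (other k)) ⟩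
            root k ^ 1 * homogeneous m x (root k * y)
              ∎

  -- Decomposition of the whole product

  record RootSystem {n : ℕ} (m : Fin (suc n) → ℕ) : Set (c Level.⊔ ℓ) where
    field
      root      : Family m
      α         : Fin (suc n) → Carrier
      α-inverse : ∀ j → α j * sum {suc (m j)} (λ _ → 1#) ≈ 1#
      root^m≈1  : ∀ j k → root j k ^ suc (m j) ≈ 1#
      power-sum : ∀ j i → 0 ℕ.< i → i ℕ.< suc (m j) → 1# + sum (λ k → root j k ^ i) ≈ 0#
      -- δ i k j l = 1 / (root i k - root j l)
      δ         : ∀ i → Fin (m i) → Family m
      δ-inverse : ∀ i j → i ≢ j → ∀ k l → root i k * δ i k j l ≈ 1# + root j l * δ i k j l

  module Decomposition {n : ℕ} {m : Fin (suc n) → ℕ} (B : RootSystem m) where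
    open RootSystem B

    private
      module Block (j : Fin (suc n)) = RootBlock (root j) (α j) (α-inverse j) (root^m≈1 j) (power-sum j)

    q : Fin (suc n) → Carrier
    q j = constantTerm (α j) (root j)

    w : Family m
    w j = weight (α j) (root j)

    residueWeight : Family m
    residueWeight j k = w j k * cofactor q w δ j k

    -- This reads `δ i k` as the family of resolvents at the point (root i k, 1).
    δ-inverse′ : ∀ i j → i ≢ j → ∀ k l → root i k * δ i k j l ≈ 1# + root j l * (1# * δ i k j l)
    δ-inverse′ i j i≢j k l = trans (δ-inverse i j i≢j k l) (+-congˡ (*-congˡ (sym (*-identityˡ _))))

    -- At a root λ of block j the other blocks take the values 1 / Hᵢ(λ), and each reduces its
    -- factor λ ^ aᵢ - 1 to λ - 1. One further λ - 1 comes from the weight.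
    residueWeight-* : ∀ j k → residueWeight j k * product (λ i → root j k ^ suc (m (punchIn j i)) - 1#) ≈
                              α j * root j k * (root j k - 1#) ^ suc n
    residueWeight-* j k = begin
      w j k * cofactor q w δ j k * product (λ i → z ^ suc (m (punchIn j i)) - 1#)
        ≈⟨ *-assoc _ _ _ ⟩
      w j k * (cofactor q w δ j k * product (λ i → z ^ suc (m (punchIn j i)) - 1#))
        ≈⟨ *-congˡ (product-distrib-* (λ i → block q w (δ j k) (punchIn j i)) (λ i → z ^ suc (m (punchIn j i)) - 1#)) ⟨
      w j k * product (λ i → block q w (δ j k) (punchIn j i) * (z ^ suc (m (punchIn j i)) - 1#))
        ≈⟨ *-congˡ (product-cong factor) ⟩
      w j k * product {n} (λ _ → z - 1#)
        ≈⟨ *-cong (sym (*-assoc _ _ _)) (product-replicate n) ⟩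
      α j * z * (z - 1#) * (z - 1#) ^ n
        ≈⟨ *-assoc _ _ _ ⟩
      α j * z * (z - 1#) ^ suc n
        ∎
      where
      z : Carrier
      z = root j k

      factor : ∀ i → block q w (δ j k) (punchIn j i) * (z ^ suc (m (punchIn j i)) - 1#) ≈ z - 1#
      factor i = begin
        u * (z ^ suc (m i′) - 1#)
          ≈⟨ *-congˡ (homogeneous-1 (m i′) z) ⟩
        u * ((z - 1#) * homogeneous (m i′) z 1#)
          ≈⟨ solve 3 (λ u d h → u :* (d :* h) := d :* (h :* u)) refl u (z - 1#) _ ⟩
        (z - 1#) * (homogeneous (m i′) z 1# * u)
          ≈⟨ *-congˡ (*-congˡ (+-congˡ (sum-cong-≋ (λ l → *-congˡ (sym (*-identityˡ (δ j k i′ l))))))) ⟩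
        (z - 1#) * (homogeneous (m i′) z 1# * (q i′ + sum (λ l → w i′ l * (1# * δ j k i′ l))))
          ≈⟨ *-congˡ (Block.homogeneous-block i′ z 1# (δ j k i′) (δ-inverse′ j i′ (punchInᵢ≢i j i ∘ ≡.sym) k)) ⟩
        (z - 1#) * 1# ^ m i′
          ≈⟨ trans (*-congˡ (1^ (m i′))) (*-identityʳ _) ⟩
        z - 1#
          ∎
        where
        i′ = punchIn j i
        u = block q w (δ j k) i′

    -- The coefficients of 1 / ∏ⱼ homogeneous (m j) z 1 at z = ∞, from z⁻¹ on.
    moment : ℕ → Carrier
    moment s = sum₂ (λ j k → residueWeight j k * root j k ^ s)

    -- A Horner scheme for the polynomial part of z ^ s / ∏ Hⱼ(z): since z / (z - λ) = 1 + λ / (z -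
    -- λ), each multiplication by z releases one moment from the poles.
    polynomialPart : Carrier → ℕ → Carrier
    polynomialPart z zero    = product q
    polynomialPart z (suc s) = z * polynomialPart z s + moment s

    module _ (x y : Carrier) (r : Family m) (r-inverse : ∀ j k → x * r j k ≈ 1# + root j k * (y * r j k)) where

      -- ∏ⱼ y ^ m j / homogeneous (m j) x y
      fractions : Carrier
      fractions = product q + sum₂ (λ j k → residueWeight j k * (y * r j k))

      fractions-inverse : product (λ j → homogeneous (m j) x y) * fractions ≈ product (λ j → y ^ m j)
      fractions-inverse = begin
        product (λ j → homogeneous (m j) x y) * fractions
          ≈⟨ *-congˡ (partialFractions q w δ
               (λ h k i j h≢i h≢j i≢j → resolvent-arnold root δ i j
                 (δ-inverse i j i≢j) (λ k l → δ-inverse j i (i≢j ∘ ≡.sym) l k)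
                 (root h k) 1# (δ h k) (δ h k) (δ-inverse′ h i h≢i k) (δ-inverse′ h j h≢j k)
                 (λ j l → sym (*-identityˡ _)))
               (λ j k → y * r j k)
               (λ i j i≢j → resolvent-arnold root δ i j
                 (δ-inverse i j i≢j) (λ k l → δ-inverse j i (i≢j ∘ ≡.sym) l k)
                 x y r (λ j k → y * r j k) (r-inverse i) (r-inverse j) (λ j k → refl {y * r j k}))) ⟨
        product (λ j → homogeneous (m j) x y) * product (block q w (λ j k → y * r j k))
          ≈⟨ product-distrib-* (λ j → homogeneous (m j) x y) (block q w (λ j k → y * r j k)) ⟨
        product (λ j → homogeneous (m j) x y * block q w (λ j k → y * r j k) j)
          ≈⟨ product-cong (λ j → Block.homogeneous-block j x y (r j) (r-inverse j)) ⟩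
        product (λ j → y ^ m j)
          ∎

    module _ (z : Carrier) (r : Family m) (r-inverse : ∀ j k → z * r j k ≈ 1# + root j k * (1# * r j k)) where

      polarPart : ℕ → Carrier
      polarPart s = sum₂ (λ j k → residueWeight j k * root j k ^ s * r j k)

      polynomial+polar : ∀ s → z ^ s * fractions z 1# r r-inverse ≈ polynomialPart z s + polarPart s
      polynomial+polar zero    = trans (*-identityˡ _) (+-congˡ (sum₂-cong (λ j k →
        *-cong (sym (*-identityʳ (residueWeight j k))) (*-identityˡ (r j k)))))
      polynomial+polar (suc s) = begin
        z * z ^ s * fractions z 1# r r-inverse
          ≈⟨ trans (*-assoc _ _ _) (*-congˡ (polynomial+polar s)) ⟩
        z * (polynomialPart z s + polarPart s)
          ≈⟨ trans (distribˡ z _ _) (+-congˡ (*-distribˡ-sum₂ z (λ j k → residueWeight j k * root j k ^ s * r j k))) ⟩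
        z * polynomialPart z s + sum₂ (λ j k → z * (residueWeight j k * root j k ^ s * r j k))
          ≈⟨ +-congˡ (trans (sum₂-cong step) (sum₂-+ (λ j k → residueWeight j k * root j k ^ s) (λ j k → residueWeight j k * root j k ^ suc s * r j k))) ⟩
        z * polynomialPart z s + (moment s + polarPart (suc s))
          ≈⟨ +-assoc _ _ _ ⟨
        polynomialPart z (suc s) + polarPart (suc s)
          ∎
        where
        step : ∀ j k → z * (residueWeight j k * root j k ^ s * r j k) ≈
                       residueWeight j k * root j k ^ s + residueWeight j k * root j k ^ suc s * r j k
        step j k = begin
          z * (W * p * r j k)                        ≈⟨ solve 4 (λ z W p r → z :* (W :* p :* r) := W :* p :* (z :* r)) refl z W p (r j k) ⟩
          W * p * (z * r j k)                        ≈⟨ *-congˡ (trans (r-inverse j k) (+-congˡ (*-congˡ (*-identityˡ _)))) ⟩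
          W * p * (1# + root j k * r j k)            ≈⟨ trans (distribˡ (W * p) _ _) (+-congʳ (*-identityʳ _)) ⟩
          W * p + W * p * (root j k * r j k)         ≈⟨ +-congˡ (solve 4 (λ W p x r → W :* p :* (x :* r) := W :* (x :* p) :* r) refl W p (root j k) (r j k)) ⟩
          W * p + W * root j k ^ suc s * r j k       ∎
          where
          W = residueWeight j k
          p = root j k ^ s

      -- The product of the Hⱼ(z) has the inverse `fractions`, but z - 1 need not be invertible,
      -- being X at z = 1 + X. Cancellation of its power is therefore left to the caller.
      quotient : ∀ {d f e} → product (λ j → z ^ suc (m j) - 1#) * d ≈ e →
                 (∀ {g} → (z - 1#) ^ suc n * g ≈ e → g ≈ f) →
                 d ≈ f * fractions z 1# r r-inverse
      quotient {d} {f} {e} p cancel = begin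
        d                           ≈⟨ *-identityʳ d ⟨
        d * 1#                      ≈⟨ *-congˡ (trans (fractions-inverse z 1# r r-inverse) (trans (product-cong (λ j → 1^ (m j)))
                                         (trans (product-replicate (suc n)) (1^ (suc n))))) ⟨
        d * (H * F)                 ≈⟨ solve 3 (λ d H F → d :* (H :* F) := (H :* d) :* F) refl d H F ⟩
        H * d * F                   ≈⟨ *-congʳ (cancel (begin
          (z - 1#) ^ suc n * (H * d)                                        ≈⟨ *-assoc _ _ _ ⟨
          (z - 1#) ^ suc n * H * d                                          ≈⟨ *-congʳ (*-congʳ (product-replicate (suc n))) ⟨
          product {suc n} (λ _ → z - 1#) * H * d                            ≈⟨ *-congʳ (product-distrib-* {suc n} (λ _ → z - 1#) (λ j → homogeneous (m j) z 1#)) ⟨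
          product (λ j → (z - 1#) * homogeneous (m j) z 1#) * d             ≈⟨ *-congʳ (product-cong (λ j → homogeneous-1 (m j) z)) ⟨
          product (λ j → z ^ suc (m j) - 1#) * d                            ≈⟨ p ⟩
          e                                                                 ∎)) ⟩
        f * F                       ∎
        where
        H = product (λ j → homogeneous (m j) z 1#)
        F = fractions z 1# r r-inverse

-- Transport of a root system along a ring homomorphism

module Extension {c ℓ} (R S : CommutativeRing c ℓ)
  {φ : CommutativeRing.Carrier R → CommutativeRing.Carrier S}
  (φ-hom : IsRingHomomorphism (CommutativeRing.rawRing R) (CommutativeRing.rawRing S) φ) where

  private
    module R where
      open CommutativeRing R public
      open InvertibleElements R public
      open PartialFractions R public
      open Algebra.Properties.Semiring.Sum semiring public using (sum)

  open CommutativeRing S hiding (zero)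
  open InvertibleElements S
  open PartialFractions S
  open Algebra.Properties.Semiring.Sum semiring using (sum; sum-cong-≋)
  open Algebra.Properties.CommutativeMonoid.Sum *-commutativeMonoid
    using () renaming (sum-cong-≋ to product-cong)
  open IsRingHomomorphism φ-hom

  φ-sum : ∀ {n} (f : Fin n → R.Carrier) → φ (R.sum f) ≈ sum (φ ∘ f)
  φ-sum {zero}  f = 0#-homo
  φ-sum {suc n} f = trans (+-homo _ _) (+-congˡ (φ-sum (f ∘ suc)))

  φ-sum₂ : ∀ {n} {m : Fin n → ℕ} (f : R.Family m) → φ (R.sum₂ f) ≈ sum₂ (λ j k → φ (f j k))
  φ-sum₂ f = trans (φ-sum (λ j → R.sum (f j))) (sum-cong-≋ (λ j → φ-sum (f j)))

  φ-product : ∀ {n} (f : Fin n → R.Carrier) → φ (R.product f) ≈ product (φ ∘ f)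
  φ-product {zero}  f = 1#-homo
  φ-product {suc n} f = trans (*-homo _ _) (*-congˡ (φ-product (f ∘ suc)))

  φ-^ : ∀ x n → φ (x R.^ n) ≈ φ x ^ n
  φ-^ x zero    = 1#-homo
  φ-^ x (suc n) = trans (*-homo _ _) (*-congˡ (φ-^ x n))

  module _ {n : ℕ} {m : Fin (suc n) → ℕ} (B : R.RootSystem m) where
    open R.RootSystem B

    private
      module Rᴰ = R.Decomposition B

    -- The decomposition is applied in the power series ring although the roots are scalars. Taking
    -- the images of all data under φ makes the weights constant series, so that coefficients can be
    -- read off termwise.
    extend : RootSystem m
    extend = record
      { root      = λ j k → φ (root j k)
      ; α         = φ ∘ α
      ; α-inverse = λ j → trans (*-congˡ (sym (trans (φ-sum {suc (m j)} (λ _ → R.1#)) (sum-cong-≋ {suc (m j)} (λ _ → 1#-homo)))))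
                      (trans (sym (*-homo _ _)) (trans (⟦⟧-cong (α-inverse j)) 1#-homo))
      ; root^m≈1  = λ j k → trans (sym (φ-^ (root j k) (suc (m j)))) (trans (⟦⟧-cong (root^m≈1 j k)) 1#-homo)
      ; power-sum = λ j i 0<i i<m → trans
          (+-cong (sym 1#-homo) (trans (sum-cong-≋ (λ k → sym (φ-^ (root j k) i))) (sym (φ-sum (λ k → root j k R.^ i)))))
          (trans (sym (+-homo _ _)) (trans (⟦⟧-cong (power-sum j i 0<i i<m)) 0#-homo))
      ; δ         = λ i k j l → φ (δ i k j l)
      ; δ-inverse = λ i j i≢j k l → trans (sym (*-homo _ _)) (trans (⟦⟧-cong (δ-inverse i j i≢j k l))
                      (trans (+-homo _ _) (+-cong 1#-homo (*-homo _ _))))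
      }

    private
      module Sᴰ = Decomposition extend

      φ-q : ∀ j → φ (Rᴰ.q j) ≈ Sᴰ.q j
      φ-q j = trans (*-homo _ _) (*-congˡ (trans (+-homo _ _) (+-cong 1#-homo (φ-sum (root j)))))

      φ-w : ∀ j k → φ (Rᴰ.w j k) ≈ Sᴰ.w j k
      φ-w j k = trans (*-homo _ _) (*-congˡ (trans (*-homo _ _) (*-congˡ (trans (+-homo _ _)
        (+-congˡ (trans (-‿homo _) (-‿cong 1#-homo)))))))

    extend-constant : φ (R.product Rᴰ.q) ≈ product Sᴰ.q
    extend-constant = trans (φ-product Rᴰ.q) (product-cong φ-q)

    extend-residueWeight : ∀ j k → φ (Rᴰ.residueWeight j k) ≈ Sᴰ.residueWeight j k
    extend-residueWeight j k = trans (*-homo _ _) (*-cong (φ-w j k) (trans (φ-product (λ i → R.block Rᴰ.q Rᴰ.w (δ j k) (punchIn j i)))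
      (product-cong (λ i → trans (+-homo _ _) (+-cong (φ-q (punchIn j i))
        (trans (φ-sum (λ l → Rᴰ.w (punchIn j i) l R.* δ j k (punchIn j i) l)) (sum-cong-≋ (λ l →
          trans (*-homo _ _) (*-congʳ (φ-w (punchIn j i) l))))))))))

    extend-weight-* : ∀ j k s → φ (Rᴰ.residueWeight j k R.* root j k R.^ s) ≈ Sᴰ.residueWeight j k * φ (root j k) ^ s
    extend-weight-* j k s = trans (*-homo _ _) (*-cong (extend-residueWeight j k) (φ-^ (root j k) s))

    extend-moment : ∀ s → φ (Rᴰ.moment s) ≈ Sᴰ.moment s
    extend-moment s = trans (φ-sum₂ (λ j k → Rᴰ.residueWeight j k R.* root j k R.^ s)) (sum₂-cong (λ j k → extend-weight-* j k s))

-- Degrees and coefficients of power series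

-- Each factor z ^ aⱼ - 1 gives one degree to z - 1: the degree of the denominator is that of ∏ Hⱼ
-- plus the order of the pole at 1.
sum-suc : ∀ {n} (a m : Fin n → ℕ) → (∀ j → a j ≡ suc (m j)) → foldr ℕ._+_ 0 a ≡ foldr ℕ._+_ 0 m ℕ.+ n
sum-suc {zero}  a m p = ≡.refl
sum-suc {suc n} a m p = begin
  a zero ℕ.+ foldr ℕ._+_ 0 (a ∘ suc)                  ≡⟨ ≡.cong₂ ℕ._+_ (p zero) (sum-suc (a ∘ suc) (m ∘ suc) (p ∘ suc)) ⟩
  suc (m zero ℕ.+ (foldr ℕ._+_ 0 (m ∘ suc) ℕ.+ n))    ≡⟨ ≡.cong suc (ℕ.+-assoc (m zero) (foldr ℕ._+_ 0 (m ∘ suc)) n) ⟨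
  suc (m zero ℕ.+ foldr ℕ._+_ 0 (m ∘ suc) ℕ.+ n)      ≡⟨ ℕ.+-suc (m zero ℕ.+ foldr ℕ._+_ 0 (m ∘ suc)) n ⟨
  m zero ℕ.+ foldr ℕ._+_ 0 (m ∘ suc) ℕ.+ suc n        ∎
  where open ≡.≡-Reasoning

module SeriesCoefficients {c ℓ} (R : CommutativeRing c ℓ) where

  module R[[X]] where
    open CommutativeRing (PowerSeries.commutativeRing R) public
    open InvertibleElements (PowerSeries.commutativeRing R) public
    open Algebra.Properties.Semiring.Sum semiring public using (sum)
    open PartialFractions (PowerSeries.commutativeRing R) public
    open Algebra.Properties.CommutativeMonoid.Sum *-commutativeMonoid public
      using () renaming (sum-cong-≋ to product-cong)

  open CommutativeRing R hiding (zero)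
  open InvertibleElements R
  open Algebra.Properties.Ring ring using (-0#≈0#; -‿distribʳ-*; -‿+-comm; +-inverseʳ-unique)
  open Algebra.Properties.Semiring.Sum semiring
    using (sum; sum-cong-≋; *-distribˡ-sum; sum-replicate-zero)
  open PartialFractions R
  open Algebra.Properties.CommutativeSemiring.Exp commutativeSemiring using (^-congˡ; ^-congʳ; ^-distrib-*)
  open Algebra.Properties.CommutativeMonoid.Sum *-commutativeMonoid
    using () renaming (sum-cong-≋ to product-cong)
  open Algebra.Solver.Ring.NaturalCoefficients.Default commutativeSemiring
    using (solve; _:+_; _:*_; _:=_)
  open PowerSeries R
    using (Series; _≋_; _⊞_; _⊠_; constant; X; 1+X; ⊠-cong; ⊠-assoc; ⊠-identityˡ; 1+X-1; constant-product;
           LaurentExpansion; residue; laurentExpansion)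
  open Relation.Binary.Reasoning.Setoid setoid

  constant-⊠ : ∀ a f n → (constant a ⊠ f) n ≈ a * f n
  constant-⊠ a f n = trans
    (+-congˡ (trans (sum-cong-≋ {n} (λ i → zeroˡ _)) (sum-replicate-zero n)))
    (+-identityʳ _)

  constant-isRingHomomorphism : IsRingHomomorphism rawRing R[[X]].rawRing constant
  constant-isRingHomomorphism = record
    { isSemiringHomomorphism = record
      { isNearSemiringHomomorphism = record
        { +-isMonoidHomomorphism = record
          { isMagmaHomomorphism = record
            { isRelHomomorphism = record { cong = cong }
            ; homo = λ { a b zero → refl ; a b (suc n) → sym (+-identityʳ 0#) }
            }
          ; ε-homo = λ { zero → refl ; (suc n) → refl }
          }
        ; *-homo = λ { a b zero → sym (constant-⊠ a (constant b) 0)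
                     ; a b (suc n) → sym (trans (constant-⊠ a (constant b) (suc n)) (zeroʳ a)) }
        }
      ; 1#-homo = λ n → refl
      }
    ; -‿homo = λ { a zero → refl ; a (suc n) → sym -0#≈0# }
    }
    where
    cong : ∀ {a b} → a ≈ b → constant a ≋ constant b
    cong p zero    = p
    cong p (suc n) = refl

  X⊠-zero : ∀ f → (X ⊠ f) 0 ≈ 0#
  X⊠-zero f = trans (+-identityʳ _) (zeroˡ _)

  X⊠-suc : ∀ f n → (X ⊠ f) (suc n) ≈ f n
  X⊠-suc f n = begin
    0# * f (suc n) + ((λ i → X (suc i)) ⊠ f) n   ≈⟨ trans (+-congʳ (zeroˡ _)) (+-identityˡ _) ⟩
    ((λ i → X (suc i)) ⊠ f) n                    ≈⟨ ⊠-cong {λ i → X (suc i)} {constant 1#} {f} {f} (λ { zero → refl ; (suc i) → refl }) (λ i → refl) n ⟩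
    (constant 1# ⊠ f) n                          ≈⟨ ⊠-identityˡ f n ⟩
    f n                                          ∎

  X^⊠-low : ∀ k f i → i ℕ.< k → ((X R[[X]].^ k) ⊠ f) i ≈ 0#
  X^⊠-low (suc k) f i i<k = trans (⊠-assoc X (X R[[X]].^ k) f i) (helper i i<k)
    where
    helper : ∀ i → i ℕ.< suc k → (X ⊠ ((X R[[X]].^ k) ⊠ f)) i ≈ 0#
    helper zero    _             = X⊠-zero ((X R[[X]].^ k) ⊠ f)
    helper (suc i) (ℕ.s≤s i<k) = trans (X⊠-suc ((X R[[X]].^ k) ⊠ f) i) (X^⊠-low k f i i<k)

  X^⊠-shift : ∀ k f i → ((X R[[X]].^ k) ⊠ f) (k ℕ.+ i) ≈ f i
  X^⊠-shift zero    f i = ⊠-identityˡ f i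
  X^⊠-shift (suc k) f i = trans (⊠-assoc X (X R[[X]].^ k) f (suc k ℕ.+ i))
    (trans (X⊠-suc ((X R[[X]].^ k) ⊠ f) (k ℕ.+ i)) (X^⊠-shift k f i))

  X^⊠-cancel : ∀ k f g → (X R[[X]].^ k) ⊠ f ≋ (X R[[X]].^ k) ⊠ g → f ≋ g
  X^⊠-cancel k f g p i = trans (sym (X^⊠-shift k f i)) (trans (p (k ℕ.+ i)) (X^⊠-shift k g i))

  1+X⊠-zero : ∀ f → (1+X ⊠ f) 0 ≈ f 0
  1+X⊠-zero f = trans (R[[X]].distribʳ f (constant 1#) X 0) (trans (+-cong (⊠-identityˡ f 0) (X⊠-zero f)) (+-identityʳ _))

  1+X⊠-suc : ∀ f n → (1+X ⊠ f) (suc n) ≈ f (suc n) + f n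
  1+X⊠-suc f n = trans (R[[X]].distribʳ f (constant 1#) X (suc n)) (+-cong (⊠-identityˡ f (suc n)) (X⊠-suc f n))

  coeff-sum : ∀ {l} (f : Fin l → Series) n → R[[X]].sum f n ≈ sum (λ i → f i n)
  coeff-sum {zero}  f n = refl
  coeff-sum {suc l} f n = +-congˡ (coeff-sum (f ∘ suc) n)

  coeff-sum₂ : ∀ {l} {m : Fin l → ℕ} (f : R[[X]].Family m) n → R[[X]].sum₂ f n ≈ sum₂ (λ j k → f j k n)
  coeff-sum₂ f n = trans (coeff-sum (λ j → R[[X]].sum (f j)) n) (sum-cong-≋ (λ j → coeff-sum (f j) n))

  -- 1 / (1 - z X)
  geometricSeries : Carrier → Series
  geometricSeries z n = z ^ n

  geometricSeries-inverse : ∀ z → constant 1# ⊠ geometricSeries z ≋ constant 1# ⊞ (constant z ⊠ (X ⊠ geometricSeries z))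
  geometricSeries-inverse z zero    = trans (⊠-identityˡ (geometricSeries z) 0) (sym (trans
    (+-congˡ (trans (constant-⊠ z (X ⊠ geometricSeries z) 0) (trans (*-congˡ (X⊠-zero (geometricSeries z))) (zeroʳ z)))) (+-identityʳ 1#)))
  geometricSeries-inverse z (suc n) = trans (⊠-identityˡ (geometricSeries z) (suc n)) (sym (trans (+-identityˡ _)
    (trans (constant-⊠ z (X ⊠ geometricSeries z) (suc n)) (*-congˡ (X⊠-suc (geometricSeries z) n)))))

  -- 1 / (1 + X - z), where μ = 1 / (z - 1)
  poleSeries : Carrier → Series
  poleSeries μ n = - (μ ^ suc n)

  poleSeries-inverse : ∀ z μ → (z - 1#) * μ ≈ 1# →
    1+X ⊠ poleSeries μ ≋ constant 1# ⊞ (constant z ⊠ (constant 1# ⊠ poleSeries μ))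
  poleSeries-inverse z μ p n = trans (lhs n) (sym (+-congˡ (trans (constant-⊠ z (constant 1# ⊠ poleSeries μ) n)
                                 (*-congˡ (⊠-identityˡ (poleSeries μ) n)))))
    where
    zμ : z * μ ≈ 1# + μ
    zμ = trans (inverse-sub p) (+-congˡ (*-identityˡ μ))

    lhs : ∀ n → (1+X ⊠ poleSeries μ) n ≈ constant 1# n + z * poleSeries μ n
    lhs zero    = begin
      (1+X ⊠ poleSeries μ) 0           ≈⟨ 1+X⊠-zero (poleSeries μ) ⟩
      - (μ * 1#)                       ≈⟨ trans (+-congʳ (-‿inverseʳ 1#)) (+-identityˡ _) ⟨
      1# - 1# - μ * 1#                 ≈⟨ +-assoc _ _ _ ⟩
      1# + (- 1# - μ * 1#)             ≈⟨ +-congˡ (-‿+-comm 1# (μ * 1#)) ⟩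
      1# - (1# + μ * 1#)               ≈⟨ +-congˡ (-‿cong (trans (+-congˡ (*-identityʳ μ)) (trans (sym zμ) (*-congˡ (sym (*-identityʳ μ)))))) ⟩
      1# - z * (μ * 1#)                ≈⟨ +-congˡ (-‿distribʳ-* z (μ * 1#)) ⟩
      1# + z * - (μ * 1#)              ∎
    lhs (suc n) = begin
      (1+X ⊠ poleSeries μ) (suc n)     ≈⟨ 1+X⊠-suc (poleSeries μ) n ⟩
      - (μ * ν) - ν                    ≈⟨ -‿+-comm (μ * ν) ν ⟩
      - (μ * ν + ν)                    ≈⟨ -‿cong (trans (+-comm _ _) (+-congʳ (sym (*-identityˡ ν)))) ⟩
      - (1# * ν + μ * ν)               ≈⟨ -‿cong (trans (sym (distribʳ ν 1# μ)) (*-congʳ (sym zμ))) ⟩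
      - (z * μ * ν)                    ≈⟨ -‿cong (*-assoc z μ ν) ⟩
      - (z * (μ * ν))                  ≈⟨ -‿distribʳ-* z (μ * ν) ⟩
      z * - (μ * ν)                    ≈⟨ +-identityˡ _ ⟨
      0# + z * - (μ * ν)               ∎
      where
      ν = μ ^ suc n

  X^-product : ∀ {n} (m : Fin n → ℕ) → R[[X]].product (λ j → X R[[X]].^ m j) ≋ X R[[X]].^ foldr ℕ._+_ 0 m
  X^-product {zero}  m n = refl
  X^-product {suc l} m n = trans
    (R[[X]].*-congˡ {X R[[X]].^ m zero} {R[[X]].product (λ j → X R[[X]].^ m (suc j))} {X R[[X]].^ foldr ℕ._+_ 0 (m ∘ suc)} (X^-product (m ∘ suc)) n)
    (sym (Algebra.Properties.CommutativeSemiring.Exp.^-homo-* R[[X]].commutativeSemiring X (m zero) (foldr ℕ._+_ 0 (m ∘ suc)) n))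

  homogeneous-1-X : ∀ n → R[[X]].homogeneous n R[[X]].1# X 0 ≈ 1#
  homogeneous-1-X zero    = refl
  homogeneous-1-X (suc n) = trans (+-cong (trans (⊠-identityˡ (R[[X]].homogeneous n R[[X]].1# X) 0) (homogeneous-1-X n)) (X⊠-zero (X R[[X]].^ n))) (+-identityʳ 1#)

  -- Vanishing at infinity and the residue at 1

  module ResidueTheorem {n : ℕ} {m : Fin (suc n) → ℕ} (B : RootSystem m) where
    open RootSystem B
    open Decomposition B
    open Extension R (PowerSeries.commutativeRing R) constant-isRingHomomorphism

    M : ℕ
    M = foldr ℕ._+_ 0 m

    private
      module Dˢ = R[[X]].Decomposition (extend B)

      rˢ : R[[X]].Family m
      rˢ j k = geometricSeries (root j k)

      rˢ-inverse : ∀ j k → R[[X]].1# ⊠ rˢ j k ≋ R[[X]].1# ⊞ (constant (root j k) ⊠ (X ⊠ rˢ j k))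
      rˢ-inverse j k = geometricSeries-inverse (root j k)

      -- The expansion of 1 / ∏ Hⱼ(z) at z = ∞ in the variable X = 1 / z; its coefficients are
      -- `product q` and then the moments.
      F : Series
      F = Dˢ.fractions R[[X]].1# X rˢ rˢ-inverse

      -- The denominator H has constant coefficient 1, hence F is X ^ M times a power series.
      F-low : ∀ i → i ℕ.< M → F i ≈ 0#
      F-low i i<M = trans (F≋ i) (X^⊠-low M (R[[X]].inverse {H} H-invertible) i i<M)
        where
        H : Series
        H = R[[X]].product (λ j → R[[X]].homogeneous (m j) R[[X]].1# X)

        H-invertible : R[[X]].Invertible H
        H-invertible = PowerSeries.invertible R H (constant-product (λ j → R[[X]].homogeneous (m j) R[[X]].1# X)
          (λ j → invertible-resp (sym (homogeneous-1-X (m j))) invertible-1))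

        F≋ : F ≋ (X R[[X]].^ M) ⊠ R[[X]].inverse {H} H-invertible
        F≋ = R[[X]].divide {H} {F} {X R[[X]].^ M} H-invertible
          (λ i → trans (Dˢ.fractions-inverse R[[X]].1# X rˢ rˢ-inverse i) (X^-product m i))

      F-coeff : ∀ i → F i ≈ constant (product q) i + sum₂ (λ j k → residueWeight j k * (X ⊠ rˢ j k) i)
      F-coeff i = +-cong (sym (extend-constant B i)) (trans
        (coeff-sum₂ (λ j k → Dˢ.residueWeight j k ⊠ (X ⊠ rˢ j k)) i)
        (sum₂-cong (λ j k → trans
          (⊠-cong {Dˢ.residueWeight j k} {constant (residueWeight j k)} {X ⊠ rˢ j k} {X ⊠ rˢ j k}
            (λ i → sym (extend-residueWeight B j k i)) (λ i → refl) i)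
          (constant-⊠ (residueWeight j k) (X ⊠ rˢ j k) i))))

    constant-vanishes : 0 ℕ.< M → product q ≈ 0#
    constant-vanishes 0<M = begin
      product q                                              ≈⟨ +-identityʳ _ ⟨
      product q + 0#                                         ≈⟨ +-congˡ (sum₂-zero (λ j k → trans (*-congˡ (X⊠-zero (rˢ j k))) (zeroʳ (residueWeight j k)))) ⟨
      product q + sum₂ (λ j k → residueWeight j k * (X ⊠ rˢ j k) 0) ≈⟨ F-coeff 0 ⟨
      F 0                                                    ≈⟨ F-low 0 0<M ⟩
      0#                                                     ∎

    moment-vanishes : ∀ s → suc s ℕ.< M → moment s ≈ 0#
    moment-vanishes s s<M = begin
      moment s                                               ≈⟨ sum₂-cong (λ j k → *-congˡ {residueWeight j k} (X⊠-suc (rˢ j k) s)) ⟨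
      sum₂ (λ j k → residueWeight j k * (X ⊠ rˢ j k) (suc s))   ≈⟨ +-identityˡ _ ⟨
      0# + sum₂ (λ j k → residueWeight j k * (X ⊠ rˢ j k) (suc s)) ≈⟨ F-coeff (suc s) ⟨
      F (suc s)                                              ≈⟨ F-low (suc s) s<M ⟩
      0#                                                     ∎

    -- A degree bound: the polynomial part has degree at most s - M. Multiplication by 1 + X adds
    -- neighbouring coefficients, and the new moment is a constant series, so it matters only in
    -- degree 0, where `moment-vanishes` applies.
    polynomialPart-low : ∀ s i → s ℕ.< M ℕ.+ i → Dˢ.polynomialPart 1+X s i ≈ 0#
    polynomialPart-low zero    i s< = trans (sym (extend-constant B i)) (helper i s<)
      where
      helper : ∀ i → 0 ℕ.< M ℕ.+ i → constant (product q) i ≈ 0#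
      helper zero    0<M = constant-vanishes (≡.subst (0 ℕ.<_) (ℕ.+-identityʳ M) 0<M)
      helper (suc i) _   = refl
    polynomialPart-low (suc s) zero    s< = trans
      (+-cong (trans (1+X⊠-zero (Dˢ.polynomialPart 1+X s)) (polynomialPart-low s 0 (ℕ.<-trans (ℕ.n<1+n s) s<)))
              (trans (sym (extend-moment B s 0)) (moment-vanishes s (≡.subst (suc s ℕ.<_) (ℕ.+-identityʳ M) s<))))
      (+-identityʳ 0#)
    polynomialPart-low (suc s) (suc i) s< = trans
      (+-cong (trans (1+X⊠-suc (Dˢ.polynomialPart 1+X s) i) (trans
                (+-cong (polynomialPart-low s (suc i) (ℕ.<-trans (ℕ.n<1+n s) s<))
                        (polynomialPart-low s i (ℕ.≤-pred (≡.subst (suc s ℕ.<_) (ℕ.+-suc M i) s<))))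
                (+-identityʳ 0#)))
              (sym (extend-moment B s (suc i))))
      (+-identityʳ 0#)

    module _ (root#1 : ∀ j k → Invertible (root j k - 1#)) where

      private
        μ : Family m
        μ j k = inverse (root#1 j k)

        pole : R[[X]].Family m
        pole j k = poleSeries (μ j k)

        pole-inverse : ∀ j k → 1+X ⊠ pole j k ≋ R[[X]].1# ⊞ (constant (root j k) ⊠ (R[[X]].1# ⊠ pole j k))
        pole-inverse j k = poleSeries-inverse (root j k) (μ j k) (proj₂ (root#1 j k))

        polarPart-coeff : ∀ s i → Dˢ.polarPart 1+X pole pole-inverse s i ≈
                          sum₂ (λ j k → residueWeight j k * root j k ^ s * pole j k i)
        polarPart-coeff s i = trans
          (coeff-sum₂ (λ j k → Dˢ.residueWeight j k ⊠ (constant (root j k) R[[X]].^ s) ⊠ pole j k) i)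
          (sum₂-cong (λ j k → trans
            (⊠-cong {Dˢ.residueWeight j k ⊠ (constant (root j k) R[[X]].^ s)} {constant (residueWeight j k * root j k ^ s)} {pole j k} {pole j k}
              (λ i → sym (extend-weight-* B j k s i)) (λ i → refl) i)
            (constant-⊠ (residueWeight j k * root j k ^ s) (pole j k) i)))

      private
        X-1+X : ∀ f → X R[[X]].^ suc n ⊠ f ≋ (1+X R[[X]].- R[[X]].1#) R[[X]].^ suc n ⊠ f
        X-1+X f = R[[X]].*-congʳ {f} {X R[[X]].^ suc n} {(1+X R[[X]].- R[[X]].1#) R[[X]].^ suc n}
          (Algebra.Properties.CommutativeSemiring.Exp.^-congˡ R[[X]].commutativeSemiring (suc n) {X} {1+X R[[X]].- R[[X]].1#} (λ i → sym (1+X-1 i)))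

      -- `C` is the Laurent expansion shifted by the pole order n + 1, which places the residue at
      -- coefficient n.
      residue-coeff : ∀ s → suc s ℕ.< M ℕ.+ suc n → ∀ C →
        R[[X]].product (λ j → (1+X R[[X]].^ suc (m j)) R[[X]].- R[[X]].1#) ⊠ C ≋ (X R[[X]].^ suc n) ⊠ (1+X R[[X]].^ s) →
        C n ≈ sum₂ (λ j k → residueWeight j k * root j k ^ s * - (μ j k ^ suc n))
      residue-coeff s s< C p = begin
        C n
          ≈⟨ Dˢ.quotient 1+X pole pole-inverse {C} {1+X R[[X]].^ s} {(X R[[X]].^ suc n) ⊠ (1+X R[[X]].^ s)} p
               (λ {g} q → X^⊠-cancel (suc n) g (1+X R[[X]].^ s) (λ i → trans (X-1+X g i) (q i))) n ⟩
        ((1+X R[[X]].^ s) ⊠ Dˢ.fractions 1+X R[[X]].1# pole pole-inverse) n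
          ≈⟨ Dˢ.polynomial+polar 1+X pole pole-inverse s n ⟩
        Dˢ.polynomialPart 1+X s n + Dˢ.polarPart 1+X pole pole-inverse s n
          -- The bound s + 1 < M + (n + 1) becomes s < M + n, exactly what removes coefficient n of
          -- the polynomial part.
          ≈⟨ +-cong (polynomialPart-low s n (ℕ.≤-pred (≡.subst (suc s ℕ.<_) (ℕ.+-suc M n) s<))) (polarPart-coeff s n) ⟩
        0# + sum₂ (λ j k → residueWeight j k * root j k ^ s * - (μ j k ^ suc n))
          ≈⟨ +-identityˡ _ ⟩
        sum₂ (λ j k → residueWeight j k * root j k ^ s * - (μ j k ^ suc n))
          ∎

      -- The exponents `a` are kept apart from `suc ∘ m`, because for the roots of unity the two
      -- agree only after a case distinction on a j. `D` holds the reciprocals of the denominators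
      -- in the Fourier-Dedekind sums.
      residue-sum : ∀ (a : Fin (suc n) → ℕ) → (∀ j → a j ≡ suc (m j)) → ∀ s → suc s ℕ.< foldr ℕ._+_ 0 a → ∀ C →
        R[[X]].product (λ j → (1+X R[[X]].^ a j) R[[X]].- R[[X]].1#) ⊠ C ≋ (X R[[X]].^ suc n) ⊠ (1+X R[[X]].^ s) →
        (D : Family m) → (∀ j k → product (λ i → root j k ^ a (punchIn j i) - 1#) * D j k ≈ 1#) →
        C n + sum (λ j → α j * sum (λ k → root j k ^ suc s * D j k)) ≈ 0#
      residue-sum a a≡ s s< C p D D-inverse = begin
        C n + sum (λ j → α j * sum (λ k → root j k ^ suc s * D j k))
          ≈⟨ +-cong (residue-coeff s (≡.subst (suc s ℕ.<_) (sum-suc a m a≡) s<) C (λ i → trans (sym (series-product i)) (p i))) (sum-cong-≋ (λ j → *-distribˡ-sum (α j) (λ k → root j k ^ suc s * D j k))) ⟩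
        sum₂ (λ j k → residueWeight j k * root j k ^ s * - (μ j k ^ suc n)) + sum₂ (λ j k → α j * (root j k ^ suc s * D j k))
          ≈⟨ sum₂-+ (λ j k → residueWeight j k * root j k ^ s * - (μ j k ^ suc n)) (λ j k → α j * (root j k ^ suc s * D j k)) ⟨
        sum₂ (λ j k → residueWeight j k * root j k ^ s * - (μ j k ^ suc n) + α j * (root j k ^ suc s * D j k))
          ≈⟨ sum₂-zero cancel ⟩
        0#
          ∎
        where
        series-product : R[[X]].product (λ j → (1+X R[[X]].^ a j) R[[X]].- R[[X]].1#) ⊠ C ≋
                         R[[X]].product (λ j → (1+X R[[X]].^ suc (m j)) R[[X]].- R[[X]].1#) ⊠ C
        series-product = R[[X]].*-congʳ {C} {R[[X]].product (λ j → (1+X R[[X]].^ a j) R[[X]].- R[[X]].1#)} {R[[X]].product (λ j → (1+X R[[X]].^ suc (m j)) R[[X]].- R[[X]].1#)}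
          (R[[X]].product-cong {suc n} {λ j → (1+X R[[X]].^ a j) R[[X]].- R[[X]].1#} {λ j → (1+X R[[X]].^ suc (m j)) R[[X]].- R[[X]].1#}
            (λ j → R[[X]].reflexive (≡.cong (λ e → (1+X R[[X]].^ e) R[[X]].- R[[X]].1#) (a≡ j))))

        -- The identity already holds pole by pole: coefficient n of 1 / (1 + X - λ) is - μ ^ (n +
        -- 1), and this power of μ = 1 / (λ - 1) undoes the power of λ - 1 in `residueWeight-*`.
        cancel : ∀ j k → residueWeight j k * root j k ^ s * - (μ j k ^ suc n) + α j * (root j k ^ suc s * D j k) ≈ 0#
        cancel j k = begin
          W * z ^ s * - ν + α j * (z * z ^ s * D j k)
            ≈⟨ +-congˡ (begin
                 W * z ^ s * ν                   ≈⟨ *-congʳ (trans (sym (*-identityʳ _)) (*-congˡ (sym (trans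
                                                     (*-congʳ (product-cong (λ i → +-congʳ (^-congʳ z (≡.sym (a≡ (punchIn j i))))))) (D-inverse j k))))) ⟩
                 W * z ^ s * (P * D j k) * ν     ≈⟨ solve 5 (λ W t P D ν → W :* t :* (P :* D) :* ν := W :* P :* (t :* D) :* ν) refl W (z ^ s) P (D j k) ν ⟩
                 W * P * (z ^ s * D j k) * ν     ≈⟨ *-congʳ (*-congʳ (residueWeight-* j k)) ⟩
                 α j * z * (z - 1#) ^ suc n * (z ^ s * D j k) * ν
                   ≈⟨ solve 6 (λ a z e t D ν → a :* z :* e :* (t :* D) :* ν := a :* (z :* t :* D) :* (e :* ν)) refl (α j) z ((z - 1#) ^ suc n) (z ^ s) (D j k) ν ⟩
                 α j * (z * z ^ s * D j k) * ((z - 1#) ^ suc n * ν)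
                   ≈⟨ *-congˡ (trans (sym (^-distrib-* (z - 1#) (μ j k) (suc n))) (trans (^-congˡ (suc n) (proj₂ (root#1 j k))) (1^ (suc n)))) ⟩
                 α j * (z * z ^ s * D j k) * 1#  ≈⟨ *-identityʳ _ ⟩
                 α j * (z * z ^ s * D j k)       ∎) ⟨
          W * z ^ s * - ν + W * z ^ s * ν
            ≈⟨ trans (sym (distribˡ _ _ _)) (trans (*-congˡ (-‿inverseˡ ν)) (zeroʳ _)) ⟩
          0#
            ∎
          where
          W = residueWeight j k
          z = root j k
          ν = μ j k ^ suc n
          P = product (λ i → z ^ suc (m (punchIn j i)) - 1#)

      -- f, ρ and τ are arguments so that their definitions over ℂ, which are large, are not unfolded.
      residue-theorem : ∀ (a : Fin (suc n) → ℕ) → (∀ j → a j ≡ suc (m j)) → ∀ s → suc s ℕ.< foldr ℕ._+_ 0 a →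
        (a#0 : ∀ j → Invertible (sum {a j} (λ _ → 1#))) →
        (D : Family m) → (∀ j k → product (λ i → root j k ^ a (punchIn j i) - 1#) * D j k ≈ 1#) →
        ∀ f → f ≡ 1+X R[[X]].^ s → ∀ ρ → ρ ≡ residue (laurentExpansion a a#0 f) →
        ∀ τ → (∀ j → τ j ≈ α j * sum (λ k → root j k ^ suc s * D j k)) → sum τ ≈ - ρ
      residue-theorem a a≡ s s< a#0 D D-inverse f ≡.refl ρ ≡.refl τ τ≈ = trans (sum-cong-≋ τ≈)
        (+-inverseʳ-unique (coeff L n) _ (residue-sum a a≡ s s< (coeff L) (equation L) D D-inverse))
        where
        open LaurentExpansion
        L = laurentExpansion a a#0 f

-- The complex roots of unity as a root system

open Algebra.Properties.Semiring.Sum ℂᴿ.semiring using (sum-cong-≋)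

-- The n-fold sum of 1, the form in which aⱼ occurs in `α-inverse`.
naturalℚ : ℕ → ℚ
naturalℚ zero    = 0ℚ
naturalℚ (suc n) = 1ℚ ℚ.+ naturalℚ n

toℚᵘ-naturalℚ : ∀ n → ℚ.toℚᵘ (naturalℚ n) ℚᵘ.≃ mkℚᵘ (+ n) 0
toℚᵘ-naturalℚ zero    = ℚᵘ.≃-refl
toℚᵘ-naturalℚ (suc n) = begin
  ℚ.toℚᵘ (1ℚ ℚ.+ naturalℚ n)              ≈⟨ ℚ.toℚᵘ-homo-+ 1ℚ (naturalℚ n) ⟩
  ℚ.toℚᵘ 1ℚ ℚᵘ.+ ℚ.toℚᵘ (naturalℚ n)      ≈⟨ ℚᵘ.+-congʳ (ℚ.toℚᵘ 1ℚ) (toℚᵘ-naturalℚ n) ⟩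
  ℚ.toℚᵘ 1ℚ ℚᵘ.+ mkℚᵘ (+ n) 0             ≈⟨ *≡* (≡.cong (λ k → (+ 1 ℤ.+ k) ℤ.* + 1) (ℤ.*-identityʳ (+ n))) ⟩
  mkℚᵘ (+ suc n) 0                        ∎
  where open import Relation.Binary.Reasoning.Setoid ℚᵘ.≃-setoid

1/n*n≡1 : ∀ n .{{_ : NonZero n}} → (+ 1 ℚ./ n) ℚ.* naturalℚ n ≡ 1ℚ
1/n*n≡1 (suc n) = ℚ.toℚᵘ-injective (begin
  ℚ.toℚᵘ ((+ 1 ℚ./ suc n) ℚ.* naturalℚ (suc n))         ≈⟨ ℚ.toℚᵘ-homo-* (+ 1 ℚ./ suc n) (naturalℚ (suc n)) ⟩
  ℚ.toℚᵘ (+ 1 ℚ./ suc n) ℚᵘ.* ℚ.toℚᵘ (naturalℚ (suc n)) ≈⟨ ℚᵘ.*-cong (ℚ.toℚᵘ-fromℚᵘ (mkℚᵘ (+ 1) n)) (toℚᵘ-naturalℚ (suc n)) ⟩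
  mkℚᵘ (+ 1) n ℚᵘ.* mkℚᵘ (+ suc n) 0                    ≈⟨ ℚᵘ.*-inverseˡ (mkℚᵘ (+ suc n) 0) ⟩
  mkℚᵘ (+ 1) 0                                          ∎)
  where open import Relation.Binary.Reasoning.Setoid ℚᵘ.≃-setoid

reciprocal : ∀ n → .{{NonZero n}} → ℂ
reciprocal n = mkℂ (fromℚ (+ 1 ℚ./ n)) (fromℚ 0ℚ)

seq-natural : ∀ n k → seq (re (ℂᴿ.sum {n} (λ _ → 1ᶜ))) k ≡ naturalℚ n
seq-natural zero    k = ≡.refl
seq-natural (suc n) k = ≡.cong (1ℚ ℚ.+_) (seq-natural n k)

seq-natural-im : ∀ n k → seq (im (ℂᴿ.sum {n} (λ _ → 1ᶜ))) k ≡ 0ℚ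
seq-natural-im zero    k = ≡.refl
seq-natural-im (suc n) k = ≡.trans (≡.cong (0ℚ ℚ.+_) (seq-natural-im n k)) (ℚ.+-identityˡ 0ℚ)

reciprocal-inverse : ∀ n .{{_ : NonZero n}} → reciprocal n ℂᴿ.* ℂᴿ.sum {n} (λ _ → 1ᶜ) ≈ᶜ 1ᶜ
reciprocal-inverse n = ComplexNumbers.ℂ-pointwise
  (λ k → ≡.trans (≡.cong₂ (λ x y → (+ 1 ℚ./ n) ℚ.* x ℚ.+ ℚ.- (0ℚ ℚ.* y)) (seq-natural n k) (seq-natural-im n k))
    (≡.cong (ℚ._+ ℚ.- (0ℚ ℚ.* 0ℚ)) (1/n*n≡1 n)))
  (λ k → ≡.trans (≡.cong₂ (λ x y → (+ 1 ℚ./ n) ℚ.* y ℚ.+ 0ℚ ℚ.* x) (seq-natural n k) (seq-natural-im n k))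
    (≡.cong₂ ℚ._+_ (ℚ.*-zeroʳ (+ 1 ℚ./ n)) (ℚ.*-zeroˡ (naturalℚ n))))

-- Prefactor, numerators and reciprocals are separate arguments, so that `σ-sum` can match each of
-- them on its own by reflexivity.
σ-cong : ∀ t {m} (cs : Vector ℤ m) c .{{_ : NonZero c}} coprime → let open FourierDedekind c using (root±; denominator#) in
  ∀ α (x D : Fin (FourierDedekind.size c) → ℂ) → reciprocal c ℂᴿ.≈ α → (∀ k → root± k ℂᴿ.^ℤ t ℂᴿ.≈ x k) →
  (∀ k → ℂᴿ.inverse (denominator# cs coprime k) ℂᴿ.≈ D k) →
  σ t cs c coprime ℂᴿ.≈ α ℂᴿ.* ℂᴿ.sum (λ k → x k ℂᴿ.* D k)
σ-cong t cs c coprime α x D p q r = ℂᴿ.*-cong p (sum-cong-≋ (λ k → ℂᴿ.*-cong (q k) (r k)))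

open NontrivialRootsOfUnity

size-suc : ∀ c .{{_ : NonZero c}} → c ≡ suc (size (nontrivialRootsOfUnity c))
size-suc (suc n) = ≡.refl

-- The roots are listed as powers of a primitive root ζ. The sum, including 1, is thus geometric
-- with ratio ζ ^ i, and ζ ^ i - 1 is invertible for 0 < i < c.
power-sum-roots : ∀ c .{{_ : NonZero c}} i → 0 ℕ.< i → i ℕ.< c →
  1ᶜ ℂᴿ.+ ℂᴿ.sum (λ k → root (nontrivialRootsOfUnity c) k ℂᴿ.^ i) ≈ᶜ 0ᶜ
power-sum-roots (suc n) i 0<i i<c = begin
  1ᶜ ℂᴿ.+ ℂᴿ.sum {n} (λ k → (ζ ℂᴿ.^ suc (toℕ k)) ℂᴿ.^ i)   ≈⟨ ℂᴿ.+-congˡ (sum-cong-≋ {n} (λ k → swap (suc (toℕ k)))) ⟩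
  ℂᴿ.geometric (ζ ℂᴿ.^ i) (suc n)                        ≈⟨ ℂᴿ.invertible-cancel (isPrimitive i 0<i i<c)
                                                             (ℂᴿ.trans (ℂᴿ.geometric-* (ζ ℂᴿ.^ i) (suc n))
                                                               (ℂᴿ.x≈y⇒x∙y⁻¹≈ε (ℂᴿ.root-power ζ (suc n) i ζ^c≈1))) ⟩
  0ᶜ                                                     ∎
  where
  open import Relation.Binary.Reasoning.Setoid ℂᴿ.setoid

  ζ : ℂ
  ζ = proj₁ (ComplexNumbers.primitiveRoot (suc n))

  ζ^c≈1 = proj₁ (proj₂ (ComplexNumbers.primitiveRoot (suc n)))
  isPrimitive = proj₂ (proj₂ (ComplexNumbers.primitiveRoot (suc n)))

  swap : ∀ k → (ζ ℂᴿ.^ k) ℂᴿ.^ i ℂᴿ.≈ (ζ ℂᴿ.^ i) ℂᴿ.^ k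
  swap k = ℂᴿ.trans (ℂᴿ.^-assocʳ ζ k i) (ℂᴿ.trans (ℂᴿ.^-congʳ ζ (ℕ.*-comm k i)) (ℂᴿ.sym (ℂᴿ.^-assocʳ ζ i k)))

module _ {m : ℕ} (a : Vector ℕ (suc m)) (a≢0 : ∀ i → NonZero (a i))
  (coprime : ∀ i j → i ≢ j → Coprime (a i) (a j)) where

  private
    roots : ∀ j → NontrivialRootsOfUnity (a j)
    roots j = nontrivialRootsOfUnity (a j) {{a≢0 j}}

    sizes : Fin (suc m) → ℕ
    sizes j = size (roots j)

    a≡suc : ∀ j → a j ≡ suc (sizes j)
    a≡suc j = size-suc (a j) {{a≢0 j}}

    module ℂᶠ = PartialFractions ℂ-commutativeRing

    zs : ℂᶠ.Family sizes
    zs j = root (roots j)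

    -- Here coprimality keeps the poles of different blocks apart: a nontrivial aᵢ-th root of unity
    -- stays apart from 1 when raised to the power aⱼ, whereas an aⱼ-th root becomes 1.
    separated : ∃[ δ ] ∀ i j → i ≢ j → ∀ k l → zs i k ℂᴿ.* δ i k j l ≈ᶜ 1ᶜ ℂᴿ.+ zs j l ℂᴿ.* δ i k j l
    separated = ℂᶠ.separation zs (λ i j i≢j k l → ℂᶠ.roots-apart (a j) {{a≢0 j}}
      (ℂᴿ.root-coprime (zs i k) (a i) (a j) (root^c≈1 (roots i) k) (root#1 (roots i) k) (coprime j i (i≢j ∘ ≡.sym)))
      (root^c≈1 (roots j) l))

  rootSystem : ℂᶠ.RootSystem sizes
  rootSystem = record
    { root      = zs
    ; α         = λ j → reciprocal (a j) {{a≢0 j}}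
    ; α-inverse = λ j → ≡.subst (λ e → reciprocal (a j) {{a≢0 j}} ℂᴿ.* ℂᴿ.sum {e} (λ _ → 1ᶜ) ≈ᶜ 1ᶜ) (a≡suc j) (reciprocal-inverse (a j) {{a≢0 j}})
    ; root^m≈1  = λ j k → ≡.subst (λ e → zs j k ℂᴿ.^ e ≈ᶜ 1ᶜ) (a≡suc j) (root^c≈1 (roots j) k)
    ; power-sum = λ j i 0<i i<m → power-sum-roots (a j) {{a≢0 j}} i 0<i (≡.subst (i ℕ.<_) (≡.sym (a≡suc j)) i<m)
    ; δ         = proj₁ separated
    ; δ-inverse = proj₂ separated
    }

  open SeriesCoefficients.ResidueTheorem ℂ-commutativeRing rootSystem

  denominator : ∀ j k → ℂᴿ.Invertible (ℂᴿ.product (λ i → root (roots j) k ℂᴿ.^ a (punchIn j i) ℂᴿ.- 1ᶜ))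
  denominator j = FourierDedekind.denominator# (a j) {{a≢0 j}} (λ i → + removeAt a j i) (λ i → coprime (punchIn j i) j (punchInᵢ≢i j i))

  module _ (s : ℕ) (s< : suc s ℕ.< foldr ℕ._+_ 0 a) where

    σ-sum : ℂᴿ.sum (λ j → σ (+ suc s) (λ i → + removeAt a j i) (a j) {{a≢0 j}} (λ i → coprime (punchIn j i) j (punchInᵢ≢i j i)))
              ≈ᶜ -ᶜ R′ (+ suc s) a a≢0
    σ-sum = residue-theorem (λ j k → root#1 (roots j) k) a (λ j → size-suc (a j) {{a≢0 j}}) s s<
      (λ j → ComplexNumbers.natural-invertible (a j) {{a≢0 j}})
      (λ j k → ℂᴿ.inverse (denominator j k)) (λ j k → proj₂ (denominator j k))
      -- For t = s + 1 the integer t - 1 computes to s, so that the numerator is by definition the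
      -- natural power of `1+X`.
      ((ℂ[[X]].1+X , ℂ[[X]].invertible-1+X) ℂ[[X]].^ℤ (+ suc s ℤ.- ℤ.1ℤ)) ≡.refl (R′ (+ suc s) a a≢0) ≡.refl
      (λ j → σ (+ suc s) (λ i → + removeAt a j i) (a j) {{a≢0 j}} (λ i → coprime (punchIn j i) j (punchInᵢ≢i j i)))
      (λ j → σ-cong (+ suc s) (λ i → + removeAt a j i) (a j) {{a≢0 j}} (λ i → coprime (punchIn j i) j (punchInᵢ≢i j i))
        (ℂᶠ.RootSystem.α rootSystem j) (λ k → zs j k ℂᴿ.^ suc s) (λ k → ℂᴿ.inverse (denominator j k))
        ℂᴿ.refl (λ k → ℂᴿ.refl) (λ k → ℂᴿ.refl))

open import Data.Nat.Base using (_+_)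

theorem8 : ∀ {m : ℕ} (a : Vector ℕ (suc m))
    (a≢0 : ∀ i → NonZero (a i))
    (coprime : ∀ i j → i ≢ j → Coprime (a i) (a j))
    (t : ℤ) → 0ℤ < t → t < + foldr _+_ 0 a →
    ℂᴿ.sum (λ j → σ t (λ i → + removeAt a j i) (a j) {{a≢0 j}}
    (λ i → coprime (punchIn j i) j (punchInᵢ≢i j i)))
    ≈ᶜ -ᶜ R′ t a a≢0
theorem8 a a≢0 coprime (+ zero)  (+<+ ()) _
theorem8 a a≢0 coprime (+ suc s) _ (+<+ s<) = σ-sum a a≢0 coprime s s<
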